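{- Let $\alpha$ be a real algebraic number that is irrational and not quadratic. Then $\exists^{k}\forall^{k}\exists^{k}\forall^{k}$ $\alpha$-PA sentences are undecidable, where $k = 20000$; that is, there is no algorithm which, given such a sentence, determines whether it is true.
   Context: For a real number $\alpha$, an $\alpha$-PA sentence ($\alpha$-Presburger sentence) is a statement $Q_1 \mathbf{x}_1 \in \mathbb{Z}^{n_1} \dots Q_r \mathbf{x}_r \in \mathbb{Z}^{n_r}\ \Phi(\mathbf{x}_1,\dots,\mathbf{x}_r)$, where $Q_1,\dots,Q_r \in \{\forall,\exists\}$ are $r$ alternating quantifiers, $\mathbf{x}_1,\dots,\mathbf{x}_r$ are blocks of integer variables, and $\Phi$ is a Boolean combination of linear inequalities in $\mathbf{x}_1,\dots,\mathbf{x}_r$ with coefficients and constant terms in $\mathbb{Z}[\alpha]$. An $\exists^{k}\forall^{k}\exists^{k}\forall^{k}$ sentence is one with four quantifier blocks $\exists,\forall,\exists,\forall$, each having $k$ integer variables. A real algebraic number $\alpha$ of degree $d$ is given by its defining $\mathbb{Z}[x]$-polynomial of degree $d$ together with a rational interval singling out a unique root; it is quadratic if $d=2$. Elements of $\mathbb{Z}[\alpha]$ are represented as $c_0 + c_1\alpha + \dots + c_{d-1}\alpha^{d-1}$ with $c_i \in \mathbb{Z}$. -}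

module Defs where

open import Data.Nat as ℕ using (ℕ; zero; suc; _⊔_)
import Data.Nat.Properties as ℕₚ
open import Data.Integer using (ℤ; +_; -[1+_]; 0ℤ)
open import Data.Rational as ℚ using (ℚ; 0ℚ; 1ℚ; ½; ∣_∣)
import Data.Rational.Properties as ℚₚ
open import Data.Rational.Solver using (module +-*-Solver)
open import Data.Fin using (Fin; zero; suc)
open import Data.List using (List; []; _∷_)
open import Data.Vec as Vec using (Vec; []; _∷_; _++_; last; lookup; replicate)
open import Data.Product using (_×_; _,_; ∃-syntax)
open import Relation.Nullary using (¬_)
open import Relation.Binary.PropositionalEquality
  using (_≡_; _≢_; refl; sym; trans; cong; subst; subst₂)

------------------------------------------------------------------------
-- Real numbers: Cauchy sequences of rationals, up to _≈_.

Cauchy : (ℕ → ℚ) → Set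
Cauchy s = ∀ ε → 0ℚ ℚ.< ε →
  ∃[ N ] (∀ m n → N ℕ.≤ m → N ℕ.≤ n → ∣ s m ℚ.- s n ∣ ℚ.< ε)

record ℝ : Set where
  constructor mkℝ
  field
    seq    : ℕ → ℚ
    cauchy : Cauchy seq

open ℝ public

infix 4 _<_ _≤_ _≈_

_<_ : ℝ → ℝ → Set
x < y = ∃[ ε ] (0ℚ ℚ.< ε ×
        ∃[ N ] (∀ n → N ℕ.≤ n → seq x n ℚ.+ ε ℚ.< seq y n))

_≤_ : ℝ → ℝ → Set
x ≤ y = ¬ (y < x)

_≈_ : ℝ → ℝ → Set
x ≈ y = x ≤ y × y ≤ x

private
  |p-p|<ε : ∀ p {ε} → 0ℚ ℚ.< ε → ∣ p ℚ.- p ∣ ℚ.< ε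
  |p-p|<ε p 0<ε = subst (λ z → ∣ z ∣ ℚ.< _) (sym (ℚₚ.+-inverseʳ p)) 0<ε

  half : ∀ ε → ½ ℚ.* ε ℚ.+ ½ ℚ.* ε ≡ ε
  half ε = trans (sym (ℚₚ.*-distribʳ-+ ε ½ ½)) (ℚₚ.*-identityˡ ε)

  0<½ε : ∀ {ε} → 0ℚ ℚ.< ε → 0ℚ ℚ.< ½ ℚ.* ε
  0<½ε {ε} 0<ε = subst (ℚ._< ½ ℚ.* ε) (ℚₚ.*-zeroʳ ½) (ℚₚ.*-monoʳ-<-pos ½ 0<ε)

  +-cauchy : ∀ s t → Cauchy s → Cauchy t → Cauchy (λ n → s n ℚ.+ t n)
  +-cauchy s t cs ct ε 0<ε
    with cs (½ ℚ.* ε) (0<½ε 0<ε) | ct (½ ℚ.* ε) (0<½ε 0<ε)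
  ... | M , hs | N , ht = M ⊔ N , λ m n p q →
    let open ℚₚ.≤-Reasoning in begin-strict
      ∣ (s m ℚ.+ t m) ℚ.- (s n ℚ.+ t n) ∣
        ≡⟨ cong ∣_∣ (rearrange (s m) (t m) (s n) (t n)) ⟩
      ∣ (s m ℚ.- s n) ℚ.+ (t m ℚ.- t n) ∣
        ≤⟨ ℚₚ.∣p+q∣≤∣p∣+∣q∣ (s m ℚ.- s n) (t m ℚ.- t n) ⟩
      ∣ s m ℚ.- s n ∣ ℚ.+ ∣ t m ℚ.- t n ∣
        <⟨ ℚₚ.+-mono-< (hs m n (ℕₚ.m⊔n≤o⇒m≤o M N p) (ℕₚ.m⊔n≤o⇒m≤o M N q))
                       (ht m n (ℕₚ.m⊔n≤o⇒n≤o M N p) (ℕₚ.m⊔n≤o⇒n≤o M N q)) ⟩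
      ½ ℚ.* ε ℚ.+ ½ ℚ.* ε
        ≡⟨ half ε ⟩
      ε ∎
    where
    rearrange : ∀ a b c d →
      (a ℚ.+ b) ℚ.- (c ℚ.+ d) ≡ (a ℚ.- c) ℚ.+ (b ℚ.- d)
    rearrange = +-*-Solver.solve 4
      (λ a b c d → (a :+ b) :- (c :+ d) := (a :- c) :+ (b :- d)) refl
      where open +-*-Solver

  bounded : ∀ s → Cauchy s →
    ∃[ B ] (0ℚ ℚ.< B × ∃[ N ] (∀ n → N ℕ.≤ n → ∣ s n ∣ ℚ.< B))
  bounded s cs with cs 1ℚ (ℚₚ.positive⁻¹ 1ℚ)
  ... | N , h = 1ℚ ℚ.+ ∣ s N ∣ , 0<B , N , bound
    where
    0<B : 0ℚ ℚ.< 1ℚ ℚ.+ ∣ s N ∣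
    0<B = ℚₚ.+-mono-<-≤ (ℚₚ.positive⁻¹ 1ℚ) (ℚₚ.0≤∣p∣ (s N))

    split : ∀ a b → a ≡ (a ℚ.- b) ℚ.+ b
    split = +-*-Solver.solve 2 (λ a b → a := (a :- b) :+ b) refl
      where open +-*-Solver

    bound : ∀ n → N ℕ.≤ n → ∣ s n ∣ ℚ.< 1ℚ ℚ.+ ∣ s N ∣
    bound n p = let open ℚₚ.≤-Reasoning in begin-strict
      ∣ s n ∣                          ≡⟨ cong ∣_∣ (split (s n) (s N)) ⟩
      ∣ (s n ℚ.- s N) ℚ.+ s N ∣        ≤⟨ ℚₚ.∣p+q∣≤∣p∣+∣q∣ (s n ℚ.- s N) (s N) ⟩
      ∣ s n ℚ.- s N ∣ ℚ.+ ∣ s N ∣      <⟨ ℚₚ.+-monoˡ-< ∣ s N ∣ (h n N p ℕₚ.≤-refl) ⟩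
      1ℚ ℚ.+ ∣ s N ∣                   ∎

  *-mono-≤-abs : ∀ p q {B δ} → ∣ p ∣ ℚ.< B → ∣ q ∣ ℚ.< δ → ∣ p ℚ.* q ∣ ℚ.≤ B ℚ.* δ
  *-mono-≤-abs p q {B} {δ} p<B q<δ = let open ℚₚ.≤-Reasoning in begin
    ∣ p ℚ.* q ∣          ≡⟨ ℚₚ.∣p*q∣≡∣p∣*∣q∣ p q ⟩
    ∣ p ∣ ℚ.* ∣ q ∣      ≤⟨ ℚₚ.*-monoˡ-≤-nonNeg ∣ p ∣ {{ℚ.nonNegative (ℚₚ.0≤∣p∣ p)}} (ℚₚ.<⇒≤ q<δ) ⟩
    ∣ p ∣ ℚ.* δ          ≤⟨ ℚₚ.*-monoʳ-≤-nonNeg δ {{ℚ.nonNegative 0≤δ}} (ℚₚ.<⇒≤ p<B) ⟩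
    B ℚ.* δ              ∎
    where
    0≤δ : 0ℚ ℚ.≤ δ
    0≤δ = ℚₚ.≤-trans (ℚₚ.0≤∣p∣ q) (ℚₚ.<⇒≤ q<δ)

  divide : ∀ K ε → 0ℚ ℚ.< K → 0ℚ ℚ.< ε → ∃[ δ ] (0ℚ ℚ.< δ × K ℚ.* δ ≡ ε)
  divide K ε 0<K 0<ε = ℚ.1/ K ℚ.* ε ,
    subst (ℚ._< ℚ.1/ K ℚ.* ε) (ℚₚ.*-zeroʳ (ℚ.1/ K))
      (ℚₚ.*-monoʳ-<-pos (ℚ.1/ K) {{ℚₚ.1/pos⇒pos K}} 0<ε) ,
    trans (sym (ℚₚ.*-assoc K (ℚ.1/ K) ε))
      (trans (cong (ℚ._* ε) (ℚₚ.*-inverseʳ K)) (ℚₚ.*-identityˡ ε))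
    where
    instance
      K-pos : ℚ.Positive K
      K-pos = ℚ.positive 0<K

      K-nonZero : ℚ.NonZero K
      K-nonZero = ℚₚ.pos⇒nonZero K

  ½ε<ε : ∀ ε → 0ℚ ℚ.< ε → ½ ℚ.* ε ℚ.< ε
  ½ε<ε ε 0<ε = subst₂ ℚ._<_ (ℚₚ.+-identityʳ (½ ℚ.* ε)) (half ε)
    (ℚₚ.+-monoʳ-< (½ ℚ.* ε) (0<½ε 0<ε))

  product-diff : ∀ a b c d → a ℚ.* b ℚ.- c ℚ.* d ≡ a ℚ.* (b ℚ.- d) ℚ.+ d ℚ.* (a ℚ.- c)
  product-diff = +-*-Solver.solve 4
    (λ a b c d → a :* b :- c :* d := a :* (b :- d) :+ d :* (a :- c)) refl
    where open +-*-Solver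

  ∣product-diff∣ : ∀ a b c d {B C δ} →
    ∣ a ∣ ℚ.< B → ∣ d ∣ ℚ.< C → ∣ a ℚ.- c ∣ ℚ.< δ → ∣ b ℚ.- d ∣ ℚ.< δ →
    ∣ a ℚ.* b ℚ.- c ℚ.* d ∣ ℚ.≤ (B ℚ.+ C) ℚ.* δ
  ∣product-diff∣ a b c d {B} {C} {δ} a<B d<C ac bd = let open ℚₚ.≤-Reasoning in begin
    ∣ a ℚ.* b ℚ.- c ℚ.* d ∣
      ≡⟨ cong ∣_∣ (product-diff a b c d) ⟩
    ∣ a ℚ.* (b ℚ.- d) ℚ.+ d ℚ.* (a ℚ.- c) ∣
      ≤⟨ ℚₚ.∣p+q∣≤∣p∣+∣q∣ (a ℚ.* (b ℚ.- d)) (d ℚ.* (a ℚ.- c)) ⟩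
    ∣ a ℚ.* (b ℚ.- d) ∣ ℚ.+ ∣ d ℚ.* (a ℚ.- c) ∣
      ≤⟨ ℚₚ.+-mono-≤ (*-mono-≤-abs a (b ℚ.- d) a<B bd) (*-mono-≤-abs d (a ℚ.- c) d<C ac) ⟩
    B ℚ.* δ ℚ.+ C ℚ.* δ
      ≡⟨ ℚₚ.*-distribʳ-+ δ B C ⟨
    (B ℚ.+ C) ℚ.* δ ∎

  *-cauchy : ∀ s t → Cauchy s → Cauchy t → Cauchy (λ n → s n ℚ.* t n)
  *-cauchy s t cs ct ε 0<ε =
    let B , 0<B , M , hB = bounded s cs
        C , 0<C , N , hC = bounded t ct
        δ , 0<δ , Kδ≡½ε  = divide (B ℚ.+ C) (½ ℚ.* ε) (ℚₚ.+-mono-< 0<B 0<C) (0<½ε 0<ε)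
        M′ , hs          = cs δ 0<δ
        N′ , ht          = ct δ 0<δ
    in (M ⊔ M′) ⊔ (N ⊔ N′) , λ m n p q → ℚₚ.≤-<-trans
         (subst (∣ s m ℚ.* t m ℚ.- s n ℚ.* t n ∣ ℚ.≤_) Kδ≡½ε
           (∣product-diff∣ (s m) (t m) (s n) (t n)
             (hB m (ℕₚ.m⊔n≤o⇒m≤o M M′ (ℕₚ.m⊔n≤o⇒m≤o (M ⊔ M′) (N ⊔ N′) p)))
             (hC n (ℕₚ.m⊔n≤o⇒m≤o N N′ (ℕₚ.m⊔n≤o⇒n≤o (M ⊔ M′) (N ⊔ N′) q)))
             (hs m n (ℕₚ.m⊔n≤o⇒n≤o M M′ (ℕₚ.m⊔n≤o⇒m≤o (M ⊔ M′) (N ⊔ N′) p)) (ℕₚ.m⊔n≤o⇒n≤o M M′ (ℕₚ.m⊔n≤o⇒m≤o (M ⊔ M′) (N ⊔ N′) q)))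
             (ht m n (ℕₚ.m⊔n≤o⇒n≤o N N′ (ℕₚ.m⊔n≤o⇒n≤o (M ⊔ M′) (N ⊔ N′) p)) (ℕₚ.m⊔n≤o⇒n≤o N N′ (ℕₚ.m⊔n≤o⇒n≤o (M ⊔ M′) (N ⊔ N′) q)))))
         (½ε<ε ε 0<ε)

infixl 6 _+_
infixl 7 _*_

_+_ : ℝ → ℝ → ℝ
x + y = mkℝ (λ n → seq x n ℚ.+ seq y n) (+-cauchy (seq x) (seq y) (cauchy x) (cauchy y))

_*_ : ℝ → ℝ → ℝ
x * y = mkℝ (λ n → seq x n ℚ.* seq y n) (*-cauchy (seq x) (seq y) (cauchy x) (cauchy y))

fromℚ : ℚ → ℝ
fromℚ q = mkℝ (λ _ → q) (λ ε 0<ε → 0 , λ _ _ _ _ → |p-p|<ε q 0<ε)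

fromℤ : ℤ → ℝ
fromℤ i = fromℚ (i ℚ./ 1)

0ℝ : ℝ
0ℝ = fromℤ 0ℤ

Irrational : ℝ → Set
Irrational x = ∀ q → ¬ (x ≈ fromℚ q)

------------------------------------------------------------------------
-- Real algebraic numbers

-- Coefficients are listed from the constant term upwards.
eval : ∀ {n} → Vec ℤ n → ℝ → ℝ
eval []       x = 0ℝ
eval (c ∷ cs) x = fromℤ c + x * eval cs x

record RealAlgebraic : Set where
  field
    value     : ℝ
    degree    : ℕ
    poly      : Vec ℤ (suc degree)
    leading≢0 : last poly ≢ 0ℤ
    root      : eval poly value ≈ 0ℝ
    minimal   : (g : Vec ℤ degree) → eval g value ≈ 0ℝ → g ≡ replicate degree 0ℤ
    lo hi     : ℚ
    lo<value  : fromℚ lo < value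
    value<hi  : value < fromℚ hi
    isolated  : ∀ y → fromℚ lo < y → y < fromℚ hi → eval poly y ≈ 0ℝ → y ≈ value

open RealAlgebraic public

Quadratic : RealAlgebraic → Set
Quadratic α = degree α ≡ 2

-- An element of ℤ[α], represented as c₀ + c₁ α + … + c_{d-1} α^{d-1}.
ℤ[_] : RealAlgebraic → Set
ℤ[ α ] = Vec ℤ (degree α)

⟦_⟧ : ∀ {α} → ℤ[ α ] → ℝ
⟦_⟧ {α} c = eval c (value α)

------------------------------------------------------------------------
-- α-PA sentences

-- The atom  a ≤ᵃ b  is the inequality  a · x ≤ b.  Strict inequalities and
-- equations are Boolean combinations of these, since coefficients can be negated.
data Formula (α : RealAlgebraic) (n : ℕ) : Set where
  _≤ᵃ_    : Vec ℤ[ α ] n → ℤ[ α ] → Formula α n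
  ¬ᶠ_     : Formula α n → Formula α n
  _∧ᶠ_    : Formula α n → Formula α n → Formula α n
  _∨ᶠ_    : Formula α n → Formula α n → Formula α n

data Quantifier : Set where
  ∀ᑫ ∃ᑫ : Quantifier

-- Each block is a quantifier with its number of variables, outermost first.
Prefix : Set
Prefix = List (Quantifier × ℕ)

#vars : Prefix → ℕ
#vars []            = 0
#vars ((_ , n) ∷ p) = n ℕ.+ #vars p

Sentence : RealAlgebraic → Prefix → Set
Sentence α p = Formula α (#vars p)

∃∀∃∀ : ℕ → Prefix
∃∀∃∀ k = (∃ᑫ , k) ∷ (∀ᑫ , k) ∷ (∃ᑫ , k) ∷ (∀ᑫ , k) ∷ []

linear : ∀ {α n} → Vec ℤ[ α ] n → Vec ℤ n → ℝ
linear         []       []       = 0ℝ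
linear {α = α} (a ∷ as) (x ∷ xs) = ⟦_⟧ {α} a * fromℤ x + linear {α} as xs

-- Truth is classical truth: ∃ and ∨ are double-negated, and the clauses for
-- atoms, ¬, ∧ and ∀ already preserve stability under double negation.
_⊨_ : ∀ {α n} → Vec ℤ n → Formula α n → Set
_⊨_ {α} x (a ≤ᵃ b) = linear {α} a x ≤ ⟦_⟧ {α} b
x ⊨ (¬ᶠ φ)         = ¬ (x ⊨ φ)
x ⊨ (φ ∧ᶠ ψ)       = (x ⊨ φ) × (x ⊨ ψ)
x ⊨ (φ ∨ᶠ ψ)       = ¬ (¬ (x ⊨ φ) × ¬ (x ⊨ ψ))

Quantify : (p : Prefix) → (Vec ℤ (#vars p) → Set) → Set
Quantify []             P = P []
Quantify ((∀ᑫ , n) ∷ p) P = (x : Vec ℤ n) → Quantify p (λ y → P (x ++ y))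
Quantify ((∃ᑫ , n) ∷ p) P = ¬ ¬ (∃[ x ] Quantify p (λ y → P (Vec._++_ {m = n} x y)))

True : ∀ {α} p → Sentence α p → Set
True p φ = Quantify p (λ x → x ⊨ φ)

------------------------------------------------------------------------
-- Algorithms: partial recursive functions

data Rec : ℕ → Set where
  zeroᴿ : Rec 0
  sucᴿ  : Rec 1
  projᴿ : ∀ {n} → Fin n → Rec n
  compᴿ : ∀ {m n} → Rec m → Vec (Rec n) m → Rec n
  precᴿ : ∀ {n} → Rec n → Rec (2 ℕ.+ n) → Rec (1 ℕ.+ n)
  μᴿ    : ∀ {n} → Rec (1 ℕ.+ n) → Rec n

infix 4 _[_]⇓_ _[_]⇓*_

mutual
  -- f [ xs ]⇓ y : the computation of f on xs halts with result y.
  data _[_]⇓_ : ∀ {n} → Rec n → Vec ℕ n → ℕ → Set where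
    zero⇓  : zeroᴿ [ [] ]⇓ 0
    suc⇓   : ∀ {x} → sucᴿ [ x ∷ [] ]⇓ suc x
    proj⇓  : ∀ {n xs} (i : Fin n) → projᴿ i [ xs ]⇓ lookup xs i
    comp⇓  : ∀ {m n xs ys z} {f : Rec m} {gs : Vec (Rec n) m} →
             gs [ xs ]⇓* ys → f [ ys ]⇓ z → compᴿ f gs [ xs ]⇓ z
    prec⇓₀ : ∀ {n xs y} {f : Rec n} {g} →
             f [ xs ]⇓ y → precᴿ f g [ 0 ∷ xs ]⇓ y
    prec⇓₁ : ∀ {n xs k y z} {f : Rec n} {g} →
             precᴿ f g [ k ∷ xs ]⇓ y → g [ k ∷ y ∷ xs ]⇓ z →
             precᴿ f g [ suc k ∷ xs ]⇓ z
    μ⇓     : ∀ {n xs y} {f : Rec (1 ℕ.+ n)} →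
             f [ y ∷ xs ]⇓ 0 →
             (∀ z → z ℕ.< y → ∃[ w ] f [ z ∷ xs ]⇓ suc w) →
             μᴿ f [ xs ]⇓ y

  data _[_]⇓*_ {n} : ∀ {m} → Vec (Rec n) m → Vec ℕ n → Vec ℕ m → Set where
    []⇓ : ∀ {xs} → [] [ xs ]⇓* []
    ∷⇓  : ∀ {m xs y ys f} {fs : Vec (Rec n) m} →
          f [ xs ]⇓ y → fs [ xs ]⇓* ys → (f ∷ fs) [ xs ]⇓* (y ∷ ys)

------------------------------------------------------------------------
-- Gödel numbering of sentences

triangle : ℕ → ℕ
triangle zero    = 0
triangle (suc n) = suc n ℕ.+ triangle n

-- Cantor's pairing bijection ℕ × ℕ → ℕ.
pair : ℕ → ℕ → ℕ
pair a b = triangle (a ℕ.+ b) ℕ.+ b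

codeℤ : ℤ → ℕ
codeℤ (+ n)    = 2 ℕ.* n
codeℤ -[1+ n ] = 1 ℕ.+ 2 ℕ.* n

codeVec : ∀ {A : Set} {n} → (A → ℕ) → Vec A n → ℕ
codeVec code []       = 0
codeVec code (x ∷ xs) = pair (code x) (codeVec code xs)

code : ∀ {α n} → Formula α n → ℕ
code (a ≤ᵃ b) = pair 0 (pair (codeVec (codeVec codeℤ) a) (codeVec codeℤ b))
code (¬ᶠ φ)   = pair 1 (code φ)
code (φ ∧ᶠ ψ) = pair 2 (pair (code φ) (code ψ))
code (φ ∨ᶠ ψ) = pair 3 (pair (code φ) (code ψ))

------------------------------------------------------------------------
-- Decidability

-- f halts on every sentence with quantifier prefix p, with output 1 or 0
-- according to whether the sentence is true.
Decides : (α : RealAlgebraic) → Prefix → Rec 1 → Set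
Decides α p f = (φ : Sentence α p) →
  (True p φ → f [ code φ ∷ [] ]⇓ 1) × (¬ True p φ → f [ code φ ∷ [] ]⇓ 0)

Undecidable : RealAlgebraic → Prefix → Set
Undecidable α p = ¬ (∃[ f ] Decides α p f)

{-# OPTIONS --safe #-}
module Submission where

{-
Write u(n, p) = nα − p and v(n, q) = nα² − q.  As 1, α, α² are linearly independent over ℚ, Kronecker's
theorem puts (u(n, p), v(n, q)) into any given box with n as large as desired.

For reals s and r, call (n, p) an element if u(n, p) is the first value closer to s than all v(k, l) with
0 ≤ k ≤ n are to r (everything from above).  Approximating r and s in turn, one can make n₁ < n₂ < … < n_m
the elements up to n_m, and at each step v(n_i, q) is still free: placing it in (αX + α²Y, αX + α²Y + ε) stores
the pair (X, Y) of natural numbers.  So boundedly many integers code any finite list of pairs.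

A halting computation of a recursive program P is a derivation from finitely many Horn clauses about pairs,
hence a list in which each pair follows from at most five earlier ones.  That P halts with value 0 thus means: there
are parameters and a goal element such that every element up to the goal has earlier elements justifying it.
Being an element is a universal statement, which gives the prefix ∃∀∃∀; the number of variables does not
depend on P.  The theorem follows by diagonalising against a supposed decision procedure.
-}

open import Defs
import Algebra.Definitions
open import Algebra.Bundles using (CommutativeRing)
import Algebra.Solver.Ring
open import Algebra.Solver.Ring.AlmostCommutativeRing
  using (AlmostCommutativeRing; _-Raw-AlmostCommutative⟶_)
open import Data.Bool using (Bool; true; false)
open import Data.Empty using (⊥)
open import Data.Fin as Fin using (Fin; zero; suc; #_; _↑ˡ_; _↑ʳ_)
import Data.Fin.Properties as Finₚ
open import Data.Integer as ℤ using (ℤ; +_; -[1+_]; 0ℤ; 1ℤ; ∣_∣)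
import Data.Integer.DivMod as ℤ
import Data.Integer.Properties as ℤₚ
import Data.Integer.Tactic.RingSolver as ℤ-Tactic
open import Data.List as List using (List; []; _∷_; _++_)
open import Data.List.Membership.Propositional using (_∈_)
import Data.List.Membership.Propositional.Properties as ∈ₚ
open import Data.List.Relation.Unary.All as All using (All; []; _∷_)
import Data.List.Relation.Unary.All.Properties as Allₚ
open import Data.List.Relation.Unary.Any using (here; there)
open import Data.Maybe as Maybe using (Maybe)
open import Data.Nat as ℕ using (ℕ; zero; suc; _⊔_; s≤s; z≤n)
open import Data.Nat.ListAction using (sum)
import Data.Nat.Properties as ℕₚ
open import Data.Product using (_×_; _,_; ∃-syntax; proj₁; proj₂)
open import Data.Rational as ℚ using (ℚ; 0ℚ; 1ℚ; ½)
import Data.Rational.Properties as ℚₚ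
open import Data.Rational.Solver using () renaming (module +-*-Solver to ℚ-Solver)
import Data.Rational.Unnormalised as ℚᵘ
import Data.Rational.Unnormalised.Properties as ℚᵘₚ
open import Data.Sum as Sum using (_⊎_; inj₁; inj₂; [_,_]′)
open import Data.Unit using (⊤)
open import Data.Vec as Vec using (Vec; []; _∷_; last; lookup; tabulate; replicate)
import Data.Vec.Properties as Vecₚ
open import Function using (_∘_; id; case_of_; _⇔_; mk⇔; Equivalence)
open import Level using (0ℓ)
open import Relation.Binary.Definitions using (tri<; tri≈; tri>)
open import Relation.Binary.PropositionalEquality
open import Relation.Nullary using (¬_; yes; no; contradiction)
open import Relation.Nullary.Decidable using (dec⇒maybe; decidable-stable; _×-dec_)
open import Tactic.RingSolver using (solve-∀)
open import Tactic.RingSolver.Core.AlmostCommutativeRing as TACR using (fromCommutativeRing)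

-- The double negation monad

-- The obstacle is that a linear formula can neither pair numbers nor name arbitrary reals. Pairing
-- is therefore split off: triangular numbers are derived as facts of their own, and every pair in a
-- clause becomes a sum of variables. The reals s, r and ε of the coding must be integer
-- combinations of 1, α, α², so the construction keeps whole open intervals of admissible s and r
-- and picks values in them only at the end. Nothing forces the outer ∃ to choose the intended
-- parameters. Soundness survives this because justifications point to strictly smaller n, so
-- induction on n makes every fact stored up to the goal true. The delicate direction is the
-- converse: no unintended element may occur up to the goal, since it would have to be justified as
-- well. Storing (k, l) together with (n, p) is what keeps "first" a universal condition. The input
-- m enters the sentence through two bounds on variables only, so its Gödel number is an explicit
-- function of m and the number of the rest.

infixl 1 _>>=_

_>>=_ : {A B : Set} → ¬ ¬ A → (A → ¬ ¬ B) → ¬ ¬ B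
(m >>= f) k = m λ a → f a k

return : {A : Set} → A → ¬ ¬ A
return a k = k a

excluded-middle : (A : Set) → ¬ ¬ (A ⊎ ¬ A)
excluded-middle A k = k (inj₂ (k ∘ inj₁))

stable¬ : {A : Set} → ¬ ¬ (¬ A) → ¬ A
stable¬ m a = m λ n → n a

-- Ring structure on ℝ up to pointwise equality

ringℚ : TACR.AlmostCommutativeRing 0ℓ 0ℓ
ringℚ = fromCommutativeRing ℚₚ.+-*-commutativeRing (λ x → dec⇒maybe (0ℚ ℚₚ.≟ x))

infix 4 _≐_
infix 8 ⊖_
infixl 7 _⊗_
infixl 6 _⊕_ _⊝_

-- The rational ring laws hold term by term, so this relation, finer than `_≈_`, already makes `ℝ` a
-- commutative ring to which a ring solver applies.
record _≐_ (x y : ℝ) : Set where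
  constructor pointwise
  field at : ∀ n → seq x n ≡ seq y n

open _≐_ public

≡⇒≐ : ∀ {x y} → x ≡ y → x ≐ y
≡⇒≐ refl = pointwise λ n → refl

≐-refl : ∀ {x} → x ≐ x
≐-refl = pointwise λ n → refl

≐-sym : ∀ {x y} → x ≐ y → y ≐ x
≐-sym e = pointwise λ n → sym (at e n)

≐-trans : ∀ {x y z} → x ≐ y → y ≐ z → x ≐ z
≐-trans e f = pointwise λ n → trans (at e n) (at f n)

open Algebra.Definitions _≐_

-- The operations are kept abstract because unfolding them exposes Cauchy proofs to unification.
abstract

  _⊕_ _⊗_ : ℝ → ℝ → ℝ
  _⊕_ = _+_
  _⊗_ = _*_

  ⊖_ : ℝ → ℝ
  ⊖ x = mkℝ (λ n → ℚ.- seq x n) λ ε 0<ε →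
    let N , h = cauchy x ε 0<ε in
    N , λ m n N≤m N≤n → subst (ℚ._< ε)
      (trans (sym (ℚₚ.∣-p∣≡∣p∣ (seq x m ℚ.- seq x n))) (cong ℚ.∣_∣ (distrib (seq x m) (seq x n))))
      (h m n N≤m N≤n)
    where
    distrib : ∀ p q → ℚ.- (p ℚ.- q) ≡ ℚ.- p ℚ.- (ℚ.- q)
    distrib = solve-∀ ringℚ

  ι : ℤ → ℝ
  ι = fromℤ

  ⊕≐+ : ∀ x y → x ⊕ y ≐ x + y
  ⊕≐+ x y = ≐-refl

  ⊗≐* : ∀ x y → x ⊗ y ≐ x * y
  ⊗≐* x y = ≐-refl

  ι≐ : ∀ i → ι i ≐ fromℤ i
  ι≐ i = ≐-refl

_⊝_ : ℝ → ℝ → ℝ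
x ⊝ y = x ⊕ (⊖ y)

/1≃ : ∀ i → ℚ.toℚᵘ (i ℚ./ 1) ℚᵘ.≃ ℚᵘ.mkℚᵘ i 0
/1≃ i = ℚₚ.toℚᵘ-fromℚᵘ (ℚᵘ.mkℚᵘ i 0)

/1-mono-< : ∀ {i j} → i ℤ.< j → (i ℚ./ 1) ℚ.< (j ℚ./ 1)
/1-mono-< {i} {j} i<j = ℚₚ.toℚᵘ-cancel-< (ℚᵘₚ.<-respˡ-≃ (ℚᵘₚ.≃-sym (/1≃ i))
  (ℚᵘₚ.<-respʳ-≃ (ℚᵘₚ.≃-sym (/1≃ j)) (ℚᵘ.*<* (ℤₚ.*-monoʳ-<-pos 1ℤ i<j))))

/1-homo-+ : ∀ i j → (i ℤ.+ j) ℚ./ 1 ≡ (i ℚ./ 1) ℚ.+ (j ℚ./ 1)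
/1-homo-+ i j = ℚₚ.toℚᵘ-injective (ℚᵘₚ.≃-trans (/1≃ (i ℤ.+ j)) (ℚᵘₚ.≃-trans
  (ℚᵘ.*≡* (cong (ℤ._* 1ℤ) (sym (cong₂ ℤ._+_ (ℤₚ.*-identityʳ i) (ℤₚ.*-identityʳ j)))))
  (ℚᵘₚ.≃-sym (ℚᵘₚ.≃-trans (ℚₚ.toℚᵘ-homo-+ (i ℚ./ 1) (j ℚ./ 1)) (ℚᵘₚ.+-cong (/1≃ i) (/1≃ j))))))

/1-homo-* : ∀ i j → (i ℤ.* j) ℚ./ 1 ≡ (i ℚ./ 1) ℚ.* (j ℚ./ 1)
/1-homo-* i j = ℚₚ.toℚᵘ-injective (ℚᵘₚ.≃-trans (/1≃ (i ℤ.* j)) (ℚᵘₚ.≃-trans ℚᵘₚ.≃-refl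
  (ℚᵘₚ.≃-sym (ℚᵘₚ.≃-trans (ℚₚ.toℚᵘ-homo-* (i ℚ./ 1) (j ℚ./ 1)) (ℚᵘₚ.*-cong (/1≃ i) (/1≃ j))))))

/1-homo-neg : ∀ i → (ℤ.- i) ℚ./ 1 ≡ ℚ.- (i ℚ./ 1)
/1-homo-neg i = ℚₚ.toℚᵘ-injective (ℚᵘₚ.≃-trans (/1≃ (ℤ.- i)) (ℚᵘₚ.≃-trans ℚᵘₚ.≃-refl
  (ℚᵘₚ.≃-sym (ℚᵘₚ.≃-trans (ℚₚ.toℚᵘ-homo‿- (i ℚ./ 1)) (ℚᵘₚ.-‿cong (/1≃ i))))))

abstract

  ⊕-cong : ∀ {x y z w} → x ≐ y → z ≐ w → x ⊕ z ≐ y ⊕ w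
  ⊕-cong e f = pointwise λ n → cong₂ ℚ._+_ (at e n) (at f n)

  ⊗-cong : ∀ {x y z w} → x ≐ y → z ≐ w → x ⊗ z ≐ y ⊗ w
  ⊗-cong e f = pointwise λ n → cong₂ ℚ._*_ (at e n) (at f n)

  ⊖-cong : ∀ {x y} → x ≐ y → ⊖ x ≐ ⊖ y
  ⊖-cong e = pointwise λ n → cong ℚ.-_ (at e n)

  ⊕-assoc : Associative _⊕_
  ⊕-assoc x y z = pointwise λ n → ℚₚ.+-assoc (seq x n) (seq y n) (seq z n)

  ⊕-identity : Identity (ι 0ℤ) _⊕_
  ⊕-identity = (λ x → pointwise λ n → ℚₚ.+-identityˡ (seq x n))
             , (λ x → pointwise λ n → ℚₚ.+-identityʳ (seq x n))

  ⊕-comm : Commutative _⊕_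
  ⊕-comm x y = pointwise λ n → ℚₚ.+-comm (seq x n) (seq y n)

  ⊗-assoc : Associative _⊗_
  ⊗-assoc x y z = pointwise λ n → ℚₚ.*-assoc (seq x n) (seq y n) (seq z n)

  ⊗-identity : Identity (ι 1ℤ) _⊗_
  ⊗-identity = (λ x → pointwise λ n → ℚₚ.*-identityˡ (seq x n))
             , (λ x → pointwise λ n → ℚₚ.*-identityʳ (seq x n))

  ⊗-comm : Commutative _⊗_
  ⊗-comm x y = pointwise λ n → ℚₚ.*-comm (seq x n) (seq y n)

  ⊗-distrib-⊕ : _⊗_ DistributesOver _⊕_
  ⊗-distrib-⊕ = (λ x y z → pointwise λ n → ℚₚ.*-distribˡ-+ (seq x n) (seq y n) (seq z n))
              , (λ x y z → pointwise λ n → ℚₚ.*-distribʳ-+ (seq x n) (seq y n) (seq z n))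

  ⊗-zero : Zero (ι 0ℤ) _⊗_
  ⊗-zero = (λ x → pointwise λ n → ℚₚ.*-zeroˡ (seq x n))
         , (λ x → pointwise λ n → ℚₚ.*-zeroʳ (seq x n))

  ⊖-⊗-distribˡ : ∀ x y → (⊖ x) ⊗ y ≐ ⊖ (x ⊗ y)
  ⊖-⊗-distribˡ x y = pointwise λ n → sym (ℚₚ.neg-distribˡ-* (seq x n) (seq y n))

  ⊖-⊕-comm : ∀ x y → (⊖ x) ⊕ (⊖ y) ≐ ⊖ (x ⊕ y)
  ⊖-⊕-comm x y = pointwise λ n → sym (ℚₚ.neg-distrib-+ (seq x n) (seq y n))

  ι-+ : ∀ i j → ι (i ℤ.+ j) ≐ ι i ⊕ ι j
  ι-+ i j = pointwise λ _ → /1-homo-+ i j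

  ι-* : ∀ i j → ι (i ℤ.* j) ≐ ι i ⊗ ι j
  ι-* i j = pointwise λ _ → /1-homo-* i j

  ι-neg : ∀ i → ι (ℤ.- i) ≐ ⊖ ι i
  ι-neg i = pointwise λ _ → /1-homo-neg i

ringℝ : AlmostCommutativeRing 0ℓ 0ℓ
ringℝ = record
  { isAlmostCommutativeRing = record
    { isCommutativeSemiring = record
      { isSemiring = record
        { isSemiringWithoutAnnihilatingZero = record
          { +-isCommutativeMonoid = record
            { isMonoid = record
              { isSemigroup = record
                { isMagma = record
                  { isEquivalence = record { refl = ≐-refl ; sym = ≐-sym ; trans = ≐-trans }
                  ; ∙-cong = ⊕-cong
                  }
                ; assoc = ⊕-assoc
                }
              ; identity = ⊕-identity
              }
            ; comm = ⊕-comm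
            }
          ; *-cong = ⊗-cong
          ; *-assoc = ⊗-assoc
          ; *-identity = ⊗-identity
          ; distrib = ⊗-distrib-⊕
          }
        ; zero = ⊗-zero
        }
      ; *-comm = ⊗-comm
      }
    ; -‿cong = ⊖-cong
    ; -‿*-distribˡ = ⊖-⊗-distribˡ
    ; -‿+-comm = ⊖-⊕-comm
    }
  }

ℤ⟶ℝ : CommutativeRing.rawRing ℤₚ.+-*-commutativeRing -Raw-AlmostCommutative⟶ ringℝ
ℤ⟶ℝ = record
  { ⟦_⟧ = ι ; +-homo = ι-+ ; *-homo = ι-* ; -‿homo = ι-neg ; 0-homo = ≐-refl ; 1-homo = ≐-refl }

ι-≟ : ∀ i j → Maybe (ι i ≐ ι j)
ι-≟ i j = Maybe.map (≡⇒≐ ∘ cong ι) (dec⇒maybe (i ℤ.≟ j))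

module ℝ-Solver = Algebra.Solver.Ring
  (CommutativeRing.rawRing ℤₚ.+-*-commutativeRing) ringℝ ℤ⟶ℝ ι-≟

-- Positivity

-- The rational bound is kept as data for the estimates on products, cancellation and Archimedean
-- multiples; `Pos` later hides it under a double negation.
record Pos⁺ (x : ℝ) : Set where
  constructor mkPos⁺
  field
    bound    : ℚ
    bound>0  : 0ℚ ℚ.< bound
    from     : ℕ
    bounded  : ∀ n → from ℕ.≤ n → bound ℚ.< seq x n

abstract
  below-integer : ∀ p → ∃[ n ] (p ℚ.< (+ n) ℚ./ 1)
  below-integer p@(ℚ.mkℚ i d _) = suc ℤ.∣ i ∣ , ℚₚ.toℚᵘ-cancel-<
    (ℚᵘₚ.<-respʳ-≃ (ℚᵘₚ.≃-sym (/1≃ (+ suc ℤ.∣ i ∣))) (ℚᵘ.*<* (begin-strict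
      i ℤ.* 1ℤ                       ≡⟨ ℤₚ.*-identityʳ i ⟩
      i                              ≤⟨ i≤∣i∣ i ⟩
      + ℤ.∣ i ∣                      <⟨ ℤ.+<+ ℕₚ.≤-refl ⟩
      + suc ℤ.∣ i ∣                  ≤⟨ ℤ.+≤+ (ℕₚ.m≤m*n (suc ℤ.∣ i ∣) (suc d)) ⟩
      + (suc ℤ.∣ i ∣ ℕ.* suc d)      ≡⟨ ℤₚ.pos-* (suc ℤ.∣ i ∣) (suc d) ⟩
      (+ suc ℤ.∣ i ∣) ℤ.* (+ suc d)  ∎)))
    where
    open ℤₚ.≤-Reasoning
    i≤∣i∣ : ∀ i → i ℤ.≤ + ℤ.∣ i ∣
    i≤∣i∣ (+ n)    = ℤₚ.≤-refl
    i≤∣i∣ -[1+ n ] = ℤ.-≤+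

abstract

  Pos⁺⇒< : ∀ {x y} → Pos⁺ (y ⊝ x) → x < y
  Pos⁺⇒< {x} {y} (mkPos⁺ ε 0<ε N h) = ε , 0<ε , N , λ n N≤n →
    subst (ℚ._< seq y n) (ℚₚ.+-comm ε (seq x n))
      (subst (ε ℚ.+ seq x n ℚ.<_) (cancel (seq y n) (seq x n)) (ℚₚ.+-monoˡ-< (seq x n) (h n N≤n)))
    where
    cancel : ∀ p q → p ℚ.- q ℚ.+ q ≡ p
    cancel = solve-∀ ringℚ

  <⇒Pos⁺ : ∀ {x y} → x < y → Pos⁺ (y ⊝ x)
  <⇒Pos⁺ {x} {y} (ε , 0<ε , N , h) = mkPos⁺ ε 0<ε N λ n N≤n →
    subst (ℚ._< seq y n ℚ.- seq x n) (cancel (seq x n) ε) (ℚₚ.+-monoˡ-< (ℚ.- seq x n) (h n N≤n))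
    where
    cancel : ∀ p ε → p ℚ.+ ε ℚ.- p ≡ ε
    cancel = solve-∀ ringℚ

  Pos⁺-resp : ∀ {x y} → x ≐ y → Pos⁺ x → Pos⁺ y
  Pos⁺-resp e (mkPos⁺ ε 0<ε N h) = mkPos⁺ ε 0<ε N λ n N≤n → subst (ε ℚ.<_) (at e n) (h n N≤n)

  Pos⁺-+ : ∀ {x y} → Pos⁺ x → Pos⁺ y → Pos⁺ (x ⊕ y)
  Pos⁺-+ (mkPos⁺ ε 0<ε M h) (mkPos⁺ δ 0<δ N k) =
    mkPos⁺ (ε ℚ.+ δ) (ℚₚ.+-mono-< 0<ε 0<δ) (M ⊔ N) λ n p →
    ℚₚ.+-mono-< (h n (ℕₚ.m⊔n≤o⇒m≤o M N p)) (k n (ℕₚ.m⊔n≤o⇒n≤o M N p))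

  0<*0< : ∀ {p q} → 0ℚ ℚ.< p → 0ℚ ℚ.< q → 0ℚ ℚ.< p ℚ.* q
  0<*0< {p} {q} 0<p 0<q =
    subst (ℚ._< p ℚ.* q) (ℚₚ.*-zeroʳ p) (ℚₚ.*-monoʳ-<-pos p {{ℚ.positive 0<p}} 0<q)

  Pos⁺-* : ∀ {x y} → Pos⁺ x → Pos⁺ y → Pos⁺ (x ⊗ y)
  Pos⁺-* {x} {y} (mkPos⁺ ε 0<ε M h) (mkPos⁺ δ 0<δ N k) =
    mkPos⁺ (ε ℚ.* δ) (0<*0< 0<ε 0<δ) (M ⊔ N) λ n p →
    let h′ = h n (ℕₚ.m⊔n≤o⇒m≤o M N p) ; k′ = k n (ℕₚ.m⊔n≤o⇒n≤o M N p) in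
    ℚₚ.<-trans (ℚₚ.*-monoʳ-<-pos ε {{ℚ.positive 0<ε}} k′)
      (ℚₚ.*-monoˡ-<-pos (seq y n) {{ℚ.positive (ℚₚ.<-trans 0<δ k′)}} h′)

  ¬Pos⁺0 : ¬ Pos⁺ (ι 0ℤ)
  ¬Pos⁺0 (mkPos⁺ ε 0<ε N h) = ℚₚ.<-asym 0<ε (h N ℕₚ.≤-refl)

  half< : ∀ {ε} → 0ℚ ℚ.< ε → 0ℚ ℚ.< ½ ℚ.* ε
  half< = 0<*0< (ℚₚ.positive⁻¹ ½)

  ∣∣-lower : ∀ p q {ε} → ℚ.∣ p ℚ.- q ∣ ℚ.< ε → p ℚ.- ε ℚ.< q
  ∣∣-lower p q {ε} h = subst₂ ℚ._<_ (identity₁ p q ε) (identity₂ ε q)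
    (ℚₚ.+-monoˡ-< (q ℚ.- ε) (ℚₚ.≤-<-trans (p≤∣p∣ (p ℚ.- q)) h))
    where
    p≤∣p∣ : ∀ p → p ℚ.≤ ℚ.∣ p ∣
    p≤∣p∣ p with ℚₚ.≤-total 0ℚ p
    ... | inj₁ 0≤p = ℚₚ.≤-reflexive (sym (ℚₚ.0≤p⇒∣p∣≡p 0≤p))
    ... | inj₂ p≤0 = ℚₚ.≤-trans p≤0 (ℚₚ.0≤∣p∣ p)
    identity₁ : ∀ p q ε → p ℚ.- q ℚ.+ (q ℚ.- ε) ≡ p ℚ.- ε
    identity₁ = solve-∀ ringℚ
    identity₂ : ∀ ε q → ε ℚ.+ (q ℚ.- ε) ≡ q
    identity₂ = solve-∀ ringℚ

  -- Beyond `N` the terms differ by less than `δ`, so a single term above 2δ keeps all later ones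
  -- above `δ`.
  exceeds-eventually : ∀ x {δ} N → (∀ m n → N ℕ.≤ m → N ℕ.≤ n → ℚ.∣ seq x m ℚ.- seq x n ∣ ℚ.< δ) →
    0ℚ ℚ.< δ → ∀ m → N ℕ.≤ m → δ ℚ.+ δ ℚ.< seq x m → Pos⁺ x
  exceeds-eventually x {δ} N h 0<δ m N≤m big = mkPos⁺ δ 0<δ N λ n N≤n → ℚₚ.<-trans
    (subst (ℚ._< seq x m ℚ.- δ) (identity δ) (ℚₚ.+-monoˡ-< (ℚ.- δ) big))
    (∣∣-lower (seq x m) (seq x n) (h m n N≤m N≤n))
    where
    identity : ∀ δ → δ ℚ.+ δ ℚ.+ ℚ.- δ ≡ δ
    identity = solve-∀ ringℚ

  quarters : ∀ ε → let δ = ½ ℚ.* (½ ℚ.* ε) in ε ≡ (δ ℚ.+ δ) ℚ.+ (δ ℚ.+ δ)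
  quarters = S.solve 1 (λ ε → let δ = S.con ½ S.:* (S.con ½ S.:* ε) in
    ε S.:= (δ S.:+ δ) S.:+ (δ S.:+ δ)) refl
    where module S = ℚ-Solver

  large-sum : ∀ {p q r} → r ℚ.+ r ℚ.< p ℚ.+ q → r ℚ.< p ⊎ r ℚ.< q
  large-sum {p} {q} {r} h with r ℚₚ.<? p | r ℚₚ.<? q
  ... | yes r<p | _       = inj₁ r<p
  ... | no _    | yes r<q = inj₂ r<q
  ... | no r≮p  | no r≮q  = contradiction
    (ℚₚ.<-≤-trans h (ℚₚ.+-mono-≤ (ℚₚ.≮⇒≥ r≮p) (ℚₚ.≮⇒≥ r≮q))) (ℚₚ.<-irrefl refl)

  -- With `δ` a quarter of the bound, a late term of x + y exceeds 4δ, hence the same term of x or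
  -- of y exceeds 2δ. The choice is a decidable comparison of rationals.
  Pos⁺-cotrans : ∀ {x y} → Pos⁺ (x ⊕ y) → Pos⁺ x ⊎ Pos⁺ y
  Pos⁺-cotrans {x} {y} (mkPos⁺ ε 0<ε N h) =
    let δ = ½ ℚ.* (½ ℚ.* ε)
        0<δ = half< (half< 0<ε)
        Nx , hx = cauchy x δ 0<δ
        Ny , hy = cauchy y δ 0<δ
        m = N ⊔ (Nx ⊔ Ny)
        Nx≤m = ℕₚ.≤-trans (ℕₚ.m≤m⊔n Nx Ny) (ℕₚ.m≤n⊔m N _)
        Ny≤m = ℕₚ.≤-trans (ℕₚ.m≤n⊔m Nx Ny) (ℕₚ.m≤n⊔m N _)
    in Sum.map (exceeds-eventually x Nx hx 0<δ m Nx≤m) (exceeds-eventually y Ny hy 0<δ m Ny≤m)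
      (large-sum (subst (ℚ._< seq x m ℚ.+ seq y m) (quarters ε) (h m (ℕₚ.m≤m⊔n N _))))

  halve : ∀ {p} → 0ℚ ℚ.< p → ½ ℚ.* p ℚ.< p
  halve {p} 0<p = subst (½ ℚ.* p ℚ.<_) (ℚₚ.*-identityˡ p)
    (ℚₚ.*-monoˡ-<-pos p {{ℚ.positive 0<p}} ½<1)
    where
    ½<1 : ½ ℚ.< 1ℚ
    ½<1 = ℚ.*<* (ℤ.+<+ (s≤s (s≤s z≤n)))

  Pos⁺-const : ∀ {p} → 0ℚ ℚ.< p → Pos⁺ (fromℚ p)
  Pos⁺-const {p} 0<p = mkPos⁺ (½ ℚ.* p) (half< 0<p) 0 λ _ _ → halve 0<p

  Pos⁺-ι : ∀ {i} → 0ℤ ℤ.< i → Pos⁺ (ι i)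
  Pos⁺-ι 0<i = Pos⁺-const (/1-mono-< 0<i)

  upper-bound : ∀ x → ∃[ B ] ∃[ N ] (∀ n → N ℕ.≤ n → seq x n ℚ.< B)
  upper-bound x with cauchy x 1ℚ (ℚₚ.positive⁻¹ 1ℚ)
  ... | N , h = seq x N ℚ.+ 1ℚ , N , λ n N≤n →
    subst (ℚ._< seq x N ℚ.+ 1ℚ) (identity (seq x n) 1ℚ)
      (ℚₚ.+-monoˡ-< 1ℚ (∣∣-lower (seq x n) (seq x N) (h n N N≤n ℕₚ.≤-refl)))
    where
    identity : ∀ p q → p ℚ.- q ℚ.+ q ≡ p
    identity = solve-∀ ringℚ

  <⇒0<- : ∀ {p q} → p ℚ.< q → 0ℚ ℚ.< q ℚ.- p
  <⇒0<- {p} {q} p<q = subst (ℚ._< q ℚ.- p) (ℚₚ.+-inverseʳ p) (ℚₚ.+-monoˡ-< (ℚ.- p) p<q)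

  eventually-below⇒Pos⁺ : ∀ {p B N} x y → B ℚ.< p → (∀ n → p ≡ seq y n) →
    (∀ n → N ℕ.≤ n → seq x n ℚ.< B) → Pos⁺ (y ⊝ x)
  eventually-below⇒Pos⁺ {p} {B} {N} x y B<p y≡ h =
    mkPos⁺ (½ ℚ.* (p ℚ.- B)) (half< (<⇒0<- B<p)) N λ n N≤n →
    ℚₚ.<-trans (halve (<⇒0<- B<p))
      (subst (λ q → p ℚ.- B ℚ.< q ℚ.- seq x n) (y≡ n) (ℚₚ.+-monoʳ-< p (ℚₚ.neg-antimono-< (h n N≤n))))

  archimedean : ∀ x → ∃[ m ] Pos⁺ (ι (+ m) ⊝ x)
  archimedean x =
    let B , N , h = upper-bound x
        m , B<m   = below-integer B
    in m , eventually-below⇒Pos⁺ x (ι (+ m)) B<m (λ _ → refl) h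

  inverse< : ∀ {ε} → 0ℚ ℚ.< ε → ∃[ δ ] (0ℚ ℚ.< δ × ε ℚ.* δ ≡ 1ℚ)
  inverse< {ε} 0<ε = ℚ.1/ ε , ℚₚ.positive⁻¹ _ {{ℚₚ.1/pos⇒pos ε}} , ℚₚ.*-inverseʳ ε
    where
    instance
      ε-pos : ℚ.Positive ε
      ε-pos = ℚ.positive 0<ε
      ε-nonZero : ℚ.NonZero ε
      ε-nonZero = ℚₚ.pos⇒nonZero ε

  divide-< : ∀ {x y B b ε} → 0ℚ ℚ.< x → x ℚ.< B → 0ℚ ℚ.< ε → 0ℚ ℚ.< b → B ℚ.* b ≡ 1ℚ →
    ε ℚ.< x ℚ.* y → ε ℚ.* b ℚ.< y
  divide-< {x} {y} {B} {b} {ε} 0<x x<B 0<ε 0<b Bb≡1 ε<xy = ℚₚ.≰⇒> λ y≤εb → ℚₚ.<-irrefl refl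
    (ℚₚ.<-≤-trans ε<xy (ℚₚ.≤-trans (*-mono y≤εb) (ℚₚ.≤-trans (ℚₚ.<⇒≤ *-mono′) (ℚₚ.≤-reflexive regroup))))
    where
    *-mono : y ℚ.≤ ε ℚ.* b → x ℚ.* y ℚ.≤ x ℚ.* (ε ℚ.* b)
    *-mono = ℚₚ.*-monoˡ-≤-nonNeg x {{ℚ.nonNegative (ℚₚ.<⇒≤ 0<x)}}
    *-mono′ : x ℚ.* (ε ℚ.* b) ℚ.< B ℚ.* (ε ℚ.* b)
    *-mono′ = ℚₚ.*-monoˡ-<-pos (ε ℚ.* b) {{ℚ.positive (0<*0< 0<ε 0<b)}} x<B
    swap : ∀ p q r → p ℚ.* (q ℚ.* r) ≡ q ℚ.* (p ℚ.* r)
    swap = solve-∀ ringℚ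
    regroup : B ℚ.* (ε ℚ.* b) ≡ ε
    regroup = trans (swap B ε b) (trans (cong (ε ℚ.*_) Bb≡1) (ℚₚ.*-identityʳ ε))

  -- Eventually x lies between 0 and some `B`, so ε < x y forces y above ε / B.
  Pos⁺-cancel : ∀ {x y} → Pos⁺ x → Pos⁺ (x ⊗ y) → Pos⁺ y
  Pos⁺-cancel {x} {y} (mkPos⁺ δ 0<δ M k) (mkPos⁺ ε 0<ε N h) =
    let B , N′ , x<B = upper-bound x
        L = M ⊔ (N ⊔ N′)
        M≤ : ∀ {n} → L ℕ.≤ n → M ℕ.≤ n
        M≤ = ℕₚ.m⊔n≤o⇒m≤o M (N ⊔ N′)
        N≤ : ∀ {n} → L ℕ.≤ n → N ℕ.≤ n
        N≤ p = ℕₚ.m⊔n≤o⇒m≤o N N′ (ℕₚ.m⊔n≤o⇒n≤o M (N ⊔ N′) p)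
        N′≤ : ∀ {n} → L ℕ.≤ n → N′ ℕ.≤ n
        N′≤ p = ℕₚ.m⊔n≤o⇒n≤o N N′ (ℕₚ.m⊔n≤o⇒n≤o M (N ⊔ N′) p)
        0<x : ∀ n → L ℕ.≤ n → 0ℚ ℚ.< seq x n
        0<x n p = ℚₚ.<-trans 0<δ (k n (M≤ p))
        b , 0<b , Bb≡1 = inverse< (ℚₚ.<-trans (0<x L ℕₚ.≤-refl) (x<B L (N′≤ ℕₚ.≤-refl)))
    in mkPos⁺ (ε ℚ.* b) (0<*0< 0<ε 0<b) L λ n p →
       divide-< {y = seq y n} (0<x n p) (x<B n (N′≤ p)) 0<ε 0<b Bb≡1 (h n (N≤ p))

  large-multiple⇒Pos⁺ : ∀ {p ε δ N} x y z → 0ℚ ℚ.< ε → ε ℚ.* δ ≡ 1ℚ → 0ℚ ℚ.< δ → δ ℚ.< p →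
    (∀ n → p ≡ seq y n) → (∀ n → 1ℚ ≡ seq z n) → (∀ n → N ℕ.≤ n → ε ℚ.< seq x n) → Pos⁺ (y ⊗ x ⊝ z)
  large-multiple⇒Pos⁺ {p} {ε} {δ} {N} x y z 0<ε εδ≡1 0<δ δ<p y≡ z≡ h =
    mkPos⁺ (½ ℚ.* (p ℚ.* ε ℚ.- 1ℚ)) (half< gap) N λ n N≤n →
    ℚₚ.<-trans (halve gap) (subst₂ (λ q r → p ℚ.* ε ℚ.- 1ℚ ℚ.< q ℚ.* seq x n ℚ.- r) (y≡ n) (z≡ n)
      (ℚₚ.+-monoˡ-< (ℚ.- 1ℚ) (ℚₚ.*-monoʳ-<-pos p {{ℚ.positive (ℚₚ.<-trans 0<δ δ<p)}} (h n N≤n))))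
    where
    gap : 0ℚ ℚ.< p ℚ.* ε ℚ.- 1ℚ
    gap = <⇒0<- (subst (ℚ._< p ℚ.* ε) (trans (ℚₚ.*-comm δ ε) εδ≡1)
      (ℚₚ.*-monoˡ-<-pos ε {{ℚ.positive 0<ε}} δ<p))

  archimedean⁻¹ : ∀ {x} → Pos⁺ x → ∃[ m ] Pos⁺ (ι (+ m) ⊗ x ⊝ ι 1ℤ)
  archimedean⁻¹ {x} (mkPos⁺ ε 0<ε N h) =
    let δ , 0<δ , εδ≡1 = inverse< 0<ε
        m , δ<m        = below-integer δ
    in m , large-multiple⇒Pos⁺ x (ι (+ m)) (ι 1ℤ) 0<ε εδ≡1 0<δ δ<m (λ _ → refl) (λ _ → refl) h

  Pos⁺-⊝-constant : ∀ {p ε N} x y → p ℚ.< ε → (∀ n → p ≡ seq y n) →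
    (∀ n → N ℕ.≤ n → ε ℚ.< seq x n) → Pos⁺ (x ⊝ y)
  Pos⁺-⊝-constant {p} {ε} {N} x y p<ε y≡ h = mkPos⁺ (ε ℚ.- p) (<⇒0<- p<ε) N λ n N≤n →
    subst (λ q → ε ℚ.- p ℚ.< seq x n ℚ.- q) (y≡ n) (ℚₚ.+-monoˡ-< (ℚ.- p) (h n N≤n))

  divide-by-larger : ∀ {p q b ε} → p ℚ.< q → q ℚ.* b ≡ 1ℚ → 0ℚ ℚ.< b → 0ℚ ℚ.< ε →
    p ℚ.* (b ℚ.* ε) ℚ.< ε
  divide-by-larger {p} {q} {b} {ε} p<q qb≡1 0<b 0<ε = subst (p ℚ.* (b ℚ.* ε) ℚ.<_)
    (trans (sym (ℚₚ.*-assoc q b ε)) (trans (cong (ℚ._* ε) qb≡1) (ℚₚ.*-identityˡ ε)))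
    (ℚₚ.*-monoˡ-<-pos (b ℚ.* ε) {{ℚ.positive (0<*0< 0<b 0<ε)}} p<q)

  fraction⁺ : ∀ {x} n → Pos⁺ x → ∃[ y ] (Pos⁺ y × Pos⁺ (x ⊝ ι (+ n) ⊗ y))
  fraction⁺ {x} n (mkPos⁺ ε 0<ε N h) =
    -- y is ε / (n + 1): dividing by the successor keeps n y strictly below ε and covers n = 0.
    let b , 0<b , b≡ = inverse< (/1-mono-< {0ℤ} {+ suc n} (ℤ.+<+ ℕ.z<s))
        y = fromℚ (b ℚ.* ε)
    in y , Pos⁺-const (0<*0< 0<b 0<ε) , Pos⁺-⊝-constant x (ι (+ n) ⊗ y)
      (divide-by-larger (/1-mono-< {+ n} {+ suc n} (ℤ.+<+ ℕₚ.≤-refl)) b≡ 0<b 0<ε) (λ _ → refl) h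

  rational-root : ∀ i {j} → j ≢ 0ℤ → ∃[ q ] fromℚ q ⊗ ι j ≐ ⊖ ι i
  rational-root i {j} j≢0 = ℚ.- (i ℚ./ 1) ℚ.* ℚ.1/ (j ℚ./ 1) , pointwise λ _ →
    trans (ℚₚ.*-assoc (ℚ.- (i ℚ./ 1)) (ℚ.1/ (j ℚ./ 1)) (j ℚ./ 1))
      (trans (cong (ℚ.- (i ℚ./ 1) ℚ.*_) (ℚₚ.*-inverseˡ (j ℚ./ 1))) (ℚₚ.*-identityʳ _))
    where
    instance
      j/1≢0 : ℚ.NonZero (j ℚ./ 1)
      j/1≢0 = ℚ.≢-nonZero λ j/1≡0 → case ℤₚ.<-cmp j 0ℤ of λ
        { (tri< j<0 _ _) → ℚₚ.<-irrefl j/1≡0 (/1-mono-< j<0)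
        ; (tri≈ _ j≡0 _) → j≢0 j≡0
        ; (tri> _ _ 0<j) → ℚₚ.<-irrefl (sym j/1≡0) (/1-mono-< 0<j) }

open ℝ-Solver using (solve; _:=_; _:+_; _:*_; _:-_; :-_; con)

-- The classical order

record Pos (x : ℝ) : Set where
  constructor pos
  field classical : ¬ ¬ Pos⁺ x

open Pos public

infix 4 _≺_ _≼_

record _≺_ (x y : ℝ) : Set where
  constructor diff
  field gap : Pos (y ⊝ x)

open _≺_ public

_≼_ : ℝ → ℝ → Set
x ≼ y = ¬ (y ≺ x)

pos⁺ : ∀ {x} → Pos⁺ x → Pos x
pos⁺ p = pos (return p)

Pos-stable : ∀ {x} → ¬ ¬ Pos x → Pos x
Pos-stable p = pos (p >>= classical)

≺-stable : ∀ {x y} → ¬ ¬ (x ≺ y) → x ≺ y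
≺-stable p = diff (Pos-stable (p >>= λ p → return (gap p)))

Pos-resp : ∀ {x y} → x ≐ y → Pos x → Pos y
Pos-resp e p = pos (classical p >>= λ p → return (Pos⁺-resp e p))

Pos-+ : ∀ {x y} → Pos x → Pos y → Pos (x ⊕ y)
Pos-+ p q = pos (classical p >>= λ p → classical q >>= λ q → return (Pos⁺-+ p q))

Pos-* : ∀ {x y} → Pos x → Pos y → Pos (x ⊗ y)
Pos-* p q = pos (classical p >>= λ p → classical q >>= λ q → return (Pos⁺-* p q))

Pos-cancel : ∀ {x y} → Pos x → Pos (x ⊗ y) → Pos y
Pos-cancel p q = pos (classical p >>= λ p → classical q >>= λ q → return (Pos⁺-cancel p q))

Pos-cotrans : ∀ {x y} → Pos (x ⊕ y) → ¬ Pos x → Pos y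
Pos-cotrans p ¬q = pos (classical p >>= λ p → case Pos⁺-cotrans p of λ
  { (inj₁ q) → contradiction (pos⁺ q) ¬q ; (inj₂ r) → return r })

Pos-ι : ∀ {i} → 0ℤ ℤ.< i → Pos (ι i)
Pos-ι 0<i = pos⁺ (Pos⁺-ι 0<i)

¬Pos0 : ¬ Pos (ι 0ℤ)
¬Pos0 p = classical p ¬Pos⁺0

Pos-asym : ∀ {x} → Pos x → ¬ Pos (⊖ x)
Pos-asym {x} p q = ¬Pos0 (Pos-resp (solve 1 (λ x → x :+ :- x := con 0ℤ) ≐-refl x) (Pos-+ p q))

Pos-ι⁻¹ : ∀ {i} → Pos (ι i) → 0ℤ ℤ.< i
Pos-ι⁻¹ {+ zero}   p = contradiction p ¬Pos0
Pos-ι⁻¹ {+ suc n}  p = ℤ.+<+ ℕ.z<s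
Pos-ι⁻¹ { -[1+ n ]} p = contradiction (Pos-resp (ι-neg -[1+ n ]) (Pos-ι (ℤ.+<+ ℕ.z<s))) (Pos-asym p)

-- The order sees only the difference of the two sides, so rearranging an inequality amounts to one
-- ring identity for the solver.
≺-shift : ∀ {x y z w} → y ⊝ x ≐ w ⊝ z → x ≺ y → z ≺ w
≺-shift e p = diff (Pos-resp e (gap p))

≼-shift : ∀ {x y z w} → x ⊝ y ≐ z ⊝ w → x ≼ y → z ≼ w
≼-shift e p = p ∘ ≺-shift (≐-sym e)

≺-resp : ∀ {x y z w} → x ≐ z → y ≐ w → x ≺ y → z ≺ w
≺-resp e f = ≺-shift (⊕-cong f (⊖-cong e))

≼-resp : ∀ {x y z w} → x ≐ z → y ≐ w → x ≼ y → z ≼ w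
≼-resp e f = ≼-shift (⊕-cong e (⊖-cong f))

≺-irrefl : ∀ {x} → ¬ (x ≺ x)
≺-irrefl {x} p = ¬Pos0 (Pos-resp (solve 1 (λ x → x :- x := con 0ℤ) ≐-refl x) (gap p))

≼-refl : ∀ {x} → x ≼ x
≼-refl = ≺-irrefl

≺-trans : ∀ {x y z} → x ≺ y → y ≺ z → x ≺ z
≺-trans {x} {y} {z} p q = diff
  (Pos-resp (solve 3 (λ x y z → (y :- x) :+ (z :- y) := z :- x) ≐-refl x y z) (Pos-+ (gap p) (gap q)))

≼-≺-trans : ∀ {x y z} → x ≼ y → y ≺ z → x ≺ z
≼-≺-trans {x} {y} {z} p q = diff (Pos-cotrans
  (Pos-resp (solve 3 (λ x y z → z :- y := (x :- y) :+ (z :- x)) ≐-refl x y z) (gap q)) (p ∘ diff))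

≺-≼-trans : ∀ {x y z} → x ≺ y → y ≼ z → x ≺ z
≺-≼-trans {x} {y} {z} p q = diff (Pos-cotrans
  (Pos-resp (solve 3 (λ x y z → y :- x := (y :- z) :+ (z :- x)) ≐-refl x y z) (gap p)) (q ∘ diff))

≼-trans : ∀ {x y z} → x ≼ y → y ≼ z → x ≼ z
≼-trans p q r = p (≼-≺-trans q r)

≺⇒≼ : ∀ {x y} → x ≺ y → x ≼ y
≺⇒≼ p q = ≺-irrefl (≺-trans p q)

≐⇒≼ : ∀ {x y} → x ≐ y → x ≼ y
≐⇒≼ e p = ≺-irrefl (≺-resp ≐-refl e p)

⊕-mono-≺ : ∀ {x y z w} → x ≺ y → z ≺ w → x ⊕ z ≺ y ⊕ w
⊕-mono-≺ {x} {y} {z} {w} p q = diff (Pos-resp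
  (solve 4 (λ x y z w → (y :- x) :+ (w :- z) := (y :+ w) :- (x :+ z)) ≐-refl x y z w)
  (Pos-+ (gap p) (gap q)))

⊗-monoˡ-≺ : ∀ {x y z} → Pos x → y ≺ z → x ⊗ y ≺ x ⊗ z
⊗-monoˡ-≺ {x} {y} {z} p q = diff (Pos-resp
  (solve 3 (λ x y z → x :* (z :- y) := x :* z :- x :* y) ≐-refl x y z) (Pos-* p (gap q)))

⊗-cancelˡ-≺ : ∀ {x y z} → Pos x → x ⊗ y ≺ x ⊗ z → y ≺ z
⊗-cancelˡ-≺ {x} {y} {z} p q = diff (Pos-cancel p (Pos-resp
  (solve 3 (λ x y z → x :* z :- x :* y := x :* (z :- y)) ≐-refl x y z) (gap q)))

⊗-monoˡ-≼ : ∀ {x y z} → Pos x → y ≼ z → x ⊗ y ≼ x ⊗ z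
⊗-monoˡ-≼ p q = q ∘ ⊗-cancelˡ-≺ p

Pos⇒≻0 : ∀ {x} → Pos x → ι 0ℤ ≺ x
Pos⇒≻0 {x} p = diff (Pos-resp (solve 1 (λ x → x := x :- con 0ℤ) ≐-refl x) p)

≻0⇒Pos : ∀ {x} → ι 0ℤ ≺ x → Pos x
≻0⇒Pos {x} p = Pos-resp (solve 1 (λ x → x :- con 0ℤ := x) ≐-refl x) (gap p)

m<n⇒0<n-m : ∀ {i j} → i ℤ.< j → 0ℤ ℤ.< j ℤ.- i
m<n⇒0<n-m {i} {j} i<j = subst (ℤ._< j ℤ.- i) (ℤₚ.+-inverseʳ i) (ℤₚ.+-monoˡ-< (ℤ.- i) i<j)

0<n-m⇒m<n : ∀ {i j} → 0ℤ ℤ.< j ℤ.- i → i ℤ.< j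
0<n-m⇒m<n {i} {j} p = subst₂ ℤ._<_ (ℤₚ.+-identityˡ i)
  (trans (ℤₚ.+-assoc j (ℤ.- i) i) (trans (cong (λ k → j ℤ.+ k) (ℤₚ.+-inverseˡ i)) (ℤₚ.+-identityʳ j)))
  (ℤₚ.+-monoˡ-< i p)

ι-sub : ∀ i j → ι (i ℤ.- j) ≐ ι i ⊝ ι j
ι-sub i j = ≐-trans (ι-+ i (ℤ.- j)) (⊕-cong ≐-refl (ι-neg j))

ι-mono-≺ : ∀ {i j} → i ℤ.< j → ι i ≺ ι j
ι-mono-≺ {i} {j} i<j = diff (Pos-resp (ι-sub j i) (Pos-ι (m<n⇒0<n-m i<j)))

ι-cancel-≺ : ∀ {i j} → ι i ≺ ι j → i ℤ.< j
ι-cancel-≺ {i} {j} p = 0<n-m⇒m<n (Pos-ι⁻¹ (Pos-resp (≐-sym (ι-sub j i)) (gap p)))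

ι-mono-≼ : ∀ {i j} → i ℤ.≤ j → ι i ≼ ι j
ι-mono-≼ i≤j p = ℤₚ.<⇒≱ (ι-cancel-≺ p) i≤j

minimum : ∀ {x y} → Pos x → Pos y → ¬ ¬ (∃[ z ] (Pos z × z ≼ x × z ≼ y))
minimum {x} {y} p q = excluded-middle (x ≺ y) >>= λ
  { (inj₁ x≺y) → return (x , p , ≼-refl , ≺⇒≼ x≺y)
  ; (inj₂ y≼x) → return (y , q , y≼x , ≼-refl) }

fraction : ∀ {x} n → Pos x → ¬ ¬ (∃[ y ] (Pos y × ι (+ n) ⊗ y ≺ x))
fraction {x} n p = classical p >>= λ p →
  let y , q , r = fraction⁺ {x} n p in return (y , pos⁺ q , diff (pos⁺ r))

≺-above : ∀ x → ∃[ m ] x ≺ ι (+ m)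
≺-above x = let m , p = archimedean x in m , diff (pos⁺ p)

≺-multiple : ∀ {x} → Pos x → ¬ ¬ (∃[ m ] ι 1ℤ ≺ ι (+ m) ⊗ x)
≺-multiple {x} p = classical p >>= λ p →
  let m , q = archimedean⁻¹ {x} p in return (m , diff (pos⁺ q))

-- Floors relative to a positive unit

ι-suc≻0 : ∀ m → Pos (ι (+ suc m))
ι-suc≻0 m = Pos-ι (ℤ.+<+ ℕ.z<s)

archimedean-unit : ∀ {d} → Pos d → ∀ x → ¬ ¬ (∃[ m ] x ≺ ι (+ m) ⊗ d)
archimedean-unit {d} p x = ≺-multiple p >>= λ (k , 1≺kd) →
  let m , x≺m = ≺-above x in
  -- `suc m` in place of `m` makes the factor positive, so that 1 ≺ k d may be multiplied by it.
  return (suc m ℕ.* k , ≺-trans x≺m (≺-trans (ι-mono-≺ (ℤ.+<+ ℕₚ.≤-refl))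
    (≺-resp (⊗-identityʳ _) (assoc m k) (⊗-monoˡ-≺ (ι-suc≻0 m) 1≺kd))))
  where
  ⊗-identityʳ : ∀ x → x ⊗ ι 1ℤ ≐ x
  ⊗-identityʳ = solve 1 (λ x → x :* con 1ℤ := x) ≐-refl
  assoc : ∀ m k → ι (+ suc m) ⊗ (ι (+ k) ⊗ d) ≐ ι (+ (suc m ℕ.* k)) ⊗ d
  assoc m k = ≐-trans (≐-sym (⊗-assoc _ _ d))
    (⊗-cong (≐-trans (≐-sym (ι-* (+ suc m) (+ k))) (≡⇒≐ (cong ι (sym (ℤₚ.pos-* (suc m) k))))) ≐-refl)

Floor : ℝ → ℝ → ℤ → Set
Floor d x i = (ι i ⊗ d ≼ x) × (x ≺ ι (i ℤ.+ 1ℤ) ⊗ d)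

-- An upward search from i, each comparison settled classically; after k steps the upper bound would
-- meet the lower one.
floor-between : ∀ d x k i → ι i ⊗ d ≼ x → x ≺ ι (i ℤ.+ + k) ⊗ d → ¬ ¬ (∃[ j ] Floor d x j)
floor-between d x zero i p q = contradiction
  (subst (λ j → x ≺ ι j ⊗ d) (ℤₚ.+-identityʳ i) q) p
floor-between d x (suc k) i p q = excluded-middle (x ≺ ι (i ℤ.+ 1ℤ) ⊗ d) >>= λ
  { (inj₁ r) → return (i , p , r)
  ; (inj₂ r) → floor-between d x k (i ℤ.+ 1ℤ) r
      (subst (λ j → x ≺ ι j ⊗ d) (sym (ℤₚ.+-assoc i 1ℤ (+ k))) q) }

floor : ∀ {d} → Pos d → ∀ x → ¬ ¬ (∃[ i ] Floor d x i)
floor {d} p x = archimedean-unit p x >>= λ (m , x≺m) → archimedean-unit p (⊖ x) >>= λ (m′ , -x≺m′) →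
  floor-between d x (m ℕ.+ m′) (ℤ.- + m′)
    (≺⇒≼ (≺-shift (≐-trans (⊕-cong ≐-refl ≐-refl) (≐-trans (flip (ι (+ m′)) x d)
      (⊕-cong ≐-refl (⊖-cong (⊗-cong (≐-sym (ι-neg (+ m′))) ≐-refl))))) -x≺m′))
    (subst (λ j → x ≺ ι j ⊗ d) (index m m′) x≺m)
  where
  flip : ∀ m x d → m ⊗ d ⊝ (⊖ x) ≐ x ⊝ (⊖ m) ⊗ d
  flip = solve 3 (λ m x d → m :* d :- (:- x) := x :- (:- m) :* d) ≐-refl
  index : ∀ m m′ → + m ≡ ℤ.- + m′ ℤ.+ + (m ℕ.+ m′)
  index m m′ = sym (trans (cong (λ k → ℤ.- + m′ ℤ.+ k) (ℤₚ.+-comm (+ m) (+ m′)))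
    (trans (sym (ℤₚ.+-assoc (ℤ.- + m′) (+ m′) (+ m)))
      (trans (cong (ℤ._+ + m) (ℤₚ.+-inverseˡ (+ m′))) (ℤₚ.+-identityˡ (+ m)))))

-- Simultaneous approximation and planar lattices

Within : ℝ → ℝ → Set
Within ε x = (⊖ ε ≺ x) × (x ≺ ε)

¬¬-∀Fin : ∀ {n} {P : Fin n → Set} → (∀ i → ¬ ¬ P i) → ¬ ¬ (∀ i → P i)
¬¬-∀Fin {zero}  h = return λ ()
¬¬-∀Fin {suc n} h = h zero >>= λ p₀ → ¬¬-∀Fin (h ∘ suc) >>= λ p →
  return λ { zero → p₀ ; (suc i) → p i }

pt : ℝ → ℤ → ℤ → ℝ
pt a n p = ι n ⊗ a ⊝ ι p

fractional-part : ∀ {x i} → Floor (ι 1ℤ) x i → (ι i ≼ x) × (x ≺ ι i ⊕ ι 1ℤ)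
fractional-part {x} {i} (p , q) =
  ≼-resp (solve 1 (λ i → i :* con 1ℤ := i) ≐-refl (ι i)) ≐-refl p ,
  ≺-resp ≐-refl (≐-trans (⊗-cong (ι-+ i 1ℤ) ≐-refl)
    (solve 1 (λ i → (i :+ con 1ℤ) :* con 1ℤ := i :+ con 1ℤ) ≐-refl (ι i))) q

floor-difference : ∀ {x y i j} → Floor (ι 1ℤ) x i → Floor (ι 1ℤ) y j →
  Within (ι 1ℤ) ((x ⊝ ι i) ⊝ (y ⊝ ι j))
floor-difference {x} {y} {i} {j} f g =
  let i≼x , x≺i+1 = fractional-part f
      j≼y , y≺j+1 = fractional-part g
  in ≺-shift (solve 4 (λ x y i j → (j :+ con 1ℤ :+ x) :- (y :+ i)
                                := ((x :- i) :- (y :- j)) :- (:- con 1ℤ)) ≐-refl x y (ι i) (ι j))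
       (≺-≼-trans (mono y≺j+1) (mono′ i≼x)) ,
     ≺-shift (solve 4 (λ x y i j → (i :+ con 1ℤ :+ y) :- (x :+ j)
                                := con 1ℤ :- ((x :- i) :- (y :- j))) ≐-refl x y (ι i) (ι j))
       (≺-≼-trans (mono x≺i+1) (mono′ j≼y))
  where
  mono : ∀ {x y z} → x ≺ y → x ⊕ z ≺ y ⊕ z
  mono {x} {y} {z} = ≺-shift (solve 3 (λ x y z → y :- x := (y :+ z) :- (x :+ z)) ≐-refl x y z)
  mono′ : ∀ {x y z} → x ≼ y → z ⊕ x ≼ z ⊕ y
  mono′ {x} {y} {z} = ≼-shift (solve 3 (λ x y z → x :- y := (z :+ x) :- (z :+ y)) ≐-refl x y z)

-- Pigeonhole on K² + 1 multiples: i is filed under the residues modulo K of the floors of K i a and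
-- K i b. Equal residues make the floors differ by some K p, so K ((j - i) a - p) is a difference of
-- two fractional parts.
dirichlet : ∀ a b K → ¬ ¬ (∃[ n ] ∃[ p ] ∃[ q ]
  (0ℤ ℤ.< n × Within (ι 1ℤ) (ι (+ suc K) ⊗ pt a n p) × Within (ι 1ℤ) (ι (+ suc K) ⊗ pt b n q)))
dirichlet a b K′ = ¬¬-∀Fin {suc (K ℕ.* K)} (λ i → floor 0<1 (x a i)) >>= λ fa →
  ¬¬-∀Fin {suc (K ℕ.* K)} (λ i → floor 0<1 (x b i)) >>= λ fb →
  return (collide fa fb)
  where
  K = suc K′
  0<1 = Pos-ι {1ℤ} (ℤ.+<+ ℕ.z<s)
  x : ℝ → ∀ {n} → Fin n → ℝ
  x c i = ι (+ K) ⊗ (ι (+ Fin.toℕ i) ⊗ c)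
  residue : ℤ → Fin K
  residue m = Fin.fromℕ< (ℤ.n%ℕd<d m K)
  quotient : ∀ m m′ → residue m ≡ residue m′ → m ℤ.- m′ ≡ + K ℤ.* (m ℤ./ℕ K ℤ.- m′ ℤ./ℕ K)
  quotient m m′ eq = trans (cong₂ ℤ._-_ (ℤ.a≡a%ℕn+[a/ℕn]*n m K) (ℤ.a≡a%ℕn+[a/ℕn]*n m′ K))
    (trans (cong (λ r → (+ r ℤ.+ m ℤ./ℕ K ℤ.* + K) ℤ.- (+ (m′ ℤ.%ℕ K) ℤ.+ m′ ℤ./ℕ K ℤ.* + K)) %≡)
      (identity (+ (m′ ℤ.%ℕ K)) (m ℤ./ℕ K) (m′ ℤ./ℕ K) (+ K)))
    where
    %≡ : m ℤ.%ℕ K ≡ m′ ℤ.%ℕ K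
    %≡ = trans (sym (Finₚ.toℕ-fromℕ< _)) (trans (cong Fin.toℕ eq) (Finₚ.toℕ-fromℕ< _))
    identity : ∀ r s t k → (r ℤ.+ s ℤ.* k) ℤ.- (r ℤ.+ t ℤ.* k) ≡ k ℤ.* (s ℤ.- t)
    identity = ℤ-Tactic.solve-∀
  module _ (c : ℝ) {n} (i j : Fin n) {m m′} (f : Floor (ι 1ℤ) (x c j) m) (g : Floor (ι 1ℤ) (x c i) m′)
           (eq : residue m ≡ residue m′) where
    close : Within (ι 1ℤ) (ι (+ K) ⊗ pt c (+ Fin.toℕ j ℤ.- + Fin.toℕ i) (m ℤ./ℕ K ℤ.- m′ ℤ./ℕ K))
    close = let l , u = floor-difference f g in ≺-resp ≐-refl same l , ≺-resp same ≐-refl u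
      where
      same : (x c j ⊝ ι m) ⊝ (x c i ⊝ ι m′) ≐
             ι (+ K) ⊗ pt c (+ Fin.toℕ j ℤ.- + Fin.toℕ i) (m ℤ./ℕ K ℤ.- m′ ℤ./ℕ K)
      same = ≐-trans
        (solve 6 (λ k j i m m′ c → (k :* (j :* c) :- m) :- (k :* (i :* c) :- m′)
                                 := k :* ((j :- i) :* c) :- (m :- m′)) ≐-refl
          (ι (+ K)) (ι (+ Fin.toℕ j)) (ι (+ Fin.toℕ i)) (ι m) (ι m′) c)
        (≐-trans (⊕-cong ≐-refl (⊖-cong (≐-trans (≐-sym (ι-sub m m′))
          (≐-trans (≡⇒≐ (cong ι (quotient m m′ eq))) (ι-* (+ K) _)))))
        (≐-trans (⊕-cong (⊗-cong ≐-refl (⊗-cong (≐-sym (ι-sub (+ Fin.toℕ j) (+ Fin.toℕ i))) ≐-refl)) ≐-refl)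
          (solve 3 (λ k nc p → k :* nc :- k :* p := k :* (nc :- p)) ≐-refl (ι (+ K)) _ _)))
  collide : (∀ i → ∃[ m ] Floor (ι 1ℤ) (x a {suc (K ℕ.* K)} i) m) →
    (∀ i → ∃[ m ] Floor (ι 1ℤ) (x b {suc (K ℕ.* K)} i) m) → _
  collide fa fb =
    let i , j , i<j , eq = Finₚ.pigeonhole ℕₚ.≤-refl λ i → Fin.combine (residue (proj₁ (fa i))) (residue (proj₁ (fb i)))
        eqa , eqb = Finₚ.combine-injective _ _ _ _ eq
    in + Fin.toℕ j ℤ.- + Fin.toℕ i , _ , _ , m<n⇒0<n-m (ℤ.+<+ i<j) ,
       close a i j (proj₂ (fa j)) (proj₂ (fa i)) (sym eqa) , close b i j (proj₂ (fb j)) (proj₂ (fb i)) (sym eqb)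

Within-mono : ∀ {ε δ x} → ε ≼ δ → Within ε x → Within δ x
Within-mono ε≼δ (l , u) = ≼-≺-trans
  (≼-shift (solve 2 (λ e d → e :- d := (:- d) :- (:- e)) ≐-refl _ _) ε≼δ) l , ≺-≼-trans u ε≼δ

Within-resp : ∀ {ε x y} → x ≐ y → Within ε x → Within ε y
Within-resp e (l , u) = ≺-resp ≐-refl e l , ≺-resp e ≐-refl u

Within-cancel : ∀ {k ε x δ} → Pos k → δ ≼ k ⊗ ε → Within δ (k ⊗ x) → Within ε x
Within-cancel {k} {ε} p h w =
  let l , u = Within-mono h w in
  ⊗-cancelˡ-≺ p (≺-resp (solve 2 (λ k e → :- (k :* e) := k :* (:- e)) ≐-refl k ε) ≐-refl l) ,
  ⊗-cancelˡ-≺ p u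

Within-neg : ∀ {ε x} → Within ε x → Within ε (⊖ x)
Within-neg {ε} {x} (l , u) =
  ≺-shift (solve 2 (λ e x → e :- x := (:- x) :- (:- e)) ≐-refl ε x) u ,
  ≺-shift (solve 2 (λ e x → x :- (:- e) := e :- (:- x)) ≐-refl ε x) l

Within-+ : ∀ {ε δ x y} → Within ε x → Within δ y → Within (ε ⊕ δ) (x ⊕ y)
Within-+ {ε} {δ} {x} {y} (l , u) (l′ , u′) =
  ≺-resp (⊖-⊕-comm ε δ) ≐-refl (⊕-mono-≺ l l′) , ⊕-mono-≺ u u′

Within⇒Pos : ∀ {ε x} → Within ε x → Pos ε
Within⇒Pos {ε} {x} (l , u) = Pos-cancel (Pos-ι {+ 2} (ℤ.+<+ ℕ.z<s))
  (Pos-resp (solve 1 (λ e → e :- (:- e) := con (+ 2) :* e) ≐-refl ε) (gap (≺-trans l u)))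

small : ∀ a b {ε} → Pos ε → ¬ ¬ (∃[ n ] ∃[ p ] ∃[ q ]
  (0ℤ ℤ.< n × Within ε (pt a n p) × Within ε (pt b n q)))
small a b {ε} 0<ε = ≺-multiple 0<ε >>= λ
  { (zero , 1≺0) → contradiction (≺-resp ≐-refl (proj₁ ⊗-zero ε) 1≺0) (≺⇒≼ (ι-mono-≺ (ℤ.+<+ ℕ.z<s)))
  ; (suc K , 1≺Kε) → dirichlet a b K >>= λ (n , p , q , 0<n , wu , wv) →
      return (n , p , q , 0<n , Within-cancel (ι-suc≻0 K) (≺⇒≼ 1≺Kε) wu , Within-cancel (ι-suc≻0 K) (≺⇒≼ 1≺Kε) wv) }

-- Here x = (e/d) u + (f/d) w with weights in [0, 1).
combination-small : ∀ {d ε u w e f x} → Pos d → ι 0ℤ ≼ e → e ≺ d → ι 0ℤ ≼ f → f ≺ d →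
  Within ε u → Within ε w → d ⊗ x ≐ u ⊗ e ⊕ w ⊗ f → Within (ε ⊕ ε) x
combination-small {d} {ε} {u} {w} {e} {f} {x} 0<d 0≤e e<d 0≤f f<d wu ww eq =
  Within-cancel 0<d (≐⇒≼ (solve 2 (λ d e → d :* e :+ d :* e := d :* (e :+ e)) ≐-refl d ε))
    (Within-resp (≐-sym eq) (Within-+ (term 0≤e e<d wu) (term 0≤f f<d ww)))
  where
  term : ∀ {u e} → ι 0ℤ ≼ e → e ≺ d → Within ε u → Within (d ⊗ ε) (u ⊗ e)
  term {u} {e} 0≤e e<d (l , r) =
    diff (Pos-resp (solve 4 (λ d ε u e → ε :* (d :- e) :+ (u :- (:- ε)) :* e := u :* e :- (:- (d :* ε))) ≐-refl d ε u e)
      (Pos-+-nonneg (Pos-* 0<ε (gap e<d)) (nonneg (gap l)))) ,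
    diff (Pos-resp (solve 4 (λ d ε u e → ε :* (d :- e) :+ (ε :- u) :* e := d :* ε :- u :* e) ≐-refl d ε u e)
      (Pos-+-nonneg (Pos-* 0<ε (gap e<d)) (nonneg (gap r))))
    where
    0<ε = Within⇒Pos {x = u} (l , r)
    nonneg : ∀ {x} → Pos x → ¬ Pos (⊖ (x ⊗ e))
    nonneg {x} 0<x p = 0≤e (diff (Pos-resp (solve 1 (λ e → :- e := con 0ℤ :- e) ≐-refl e)
      (Pos-cancel 0<x (Pos-resp (solve 2 (λ x e → :- (x :* e) := x :* (:- e)) ≐-refl x e) p))))
    Pos-+-nonneg : ∀ {x y} → Pos x → ¬ Pos (⊖ y) → Pos (x ⊕ y)
    Pos-+-nonneg {x} {y} p q = Pos-cotrans
      (Pos-resp (solve 2 (λ x y → x := :- y :+ (x :+ y)) ≐-refl x y) p) q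

-- Cramer's rule: the coordinates of (x, y) in the given basis are quotients by the determinant D.
-- Floors in units of D leave remainders in [0, D), so the error combines the basis vectors with
-- weights in [0, 1).
lattice-approximation : ∀ {ε u₁ v₁ u₂ v₂} → Pos (u₁ ⊗ v₂ ⊝ u₂ ⊗ v₁) →
  Within ε u₁ → Within ε v₁ → Within ε u₂ → Within ε v₂ → ∀ x y →
  ¬ ¬ (∃[ i ] ∃[ j ] (Within (ε ⊕ ε) (x ⊝ (ι i ⊗ u₁ ⊕ ι j ⊗ u₂)) × Within (ε ⊕ ε) (y ⊝ (ι i ⊗ v₁ ⊕ ι j ⊗ v₂))))
lattice-approximation {ε} {u₁} {v₁} {u₂} {v₂} 0<D wu₁ wv₁ wu₂ wv₂ x y =
  floor 0<D (x ⊗ v₂ ⊝ y ⊗ u₂) >>= λ (i , i≤ , <i) →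
  floor 0<D (u₁ ⊗ y ⊝ v₁ ⊗ x) >>= λ (j , j≤ , <j) →
  return (i , j ,
    combination-small 0<D (lower i≤) (upper <i) (lower j≤) (upper <j) wu₁ wu₂
      (solve 8 (λ u₁ v₁ u₂ v₂ x y i j → let D = u₁ :* v₂ :- u₂ :* v₁ in
        D :* (x :- (i :* u₁ :+ j :* u₂)) :=
        u₁ :* (x :* v₂ :- y :* u₂ :- i :* D) :+ u₂ :* (u₁ :* y :- v₁ :* x :- j :* D)) ≐-refl
        u₁ v₁ u₂ v₂ x y (ι i) (ι j)) ,
    combination-small 0<D (lower i≤) (upper <i) (lower j≤) (upper <j) wv₁ wv₂
      (solve 8 (λ u₁ v₁ u₂ v₂ x y i j → let D = u₁ :* v₂ :- u₂ :* v₁ in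
        D :* (y :- (i :* v₁ :+ j :* v₂)) :=
        v₁ :* (x :* v₂ :- y :* u₂ :- i :* D) :+ v₂ :* (u₁ :* y :- v₁ :* x :- j :* D)) ≐-refl
        u₁ v₁ u₂ v₂ x y (ι i) (ι j)))
  where
  D = u₁ ⊗ v₂ ⊝ u₂ ⊗ v₁
  lower : ∀ {i z} → ι i ⊗ D ≼ z → ι 0ℤ ≼ z ⊝ ι i ⊗ D
  lower {i} {z} = ≼-shift (solve 3 (λ i d z → i :* d :- z := con 0ℤ :- (z :- i :* d)) ≐-refl (ι i) D z)
  upper : ∀ {i z} → z ≺ ι (i ℤ.+ 1ℤ) ⊗ D → z ⊝ ι i ⊗ D ≺ D
  upper {i} {z} p = ≺-shift (solve 3 (λ i d z → (i :+ con 1ℤ) :* d :- z := d :- (z :- i :* d)) ≐-refl (ι i) D z)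
    (≺-resp ≐-refl (⊗-cong (ι-+ i 1ℤ) ≐-refl) p)

pt-linear : ∀ a i n p j n′ p′ →
  ι i ⊗ pt a n p ⊕ ι j ⊗ pt a n′ p′ ≐ pt a (i ℤ.* n ℤ.+ j ℤ.* n′) (i ℤ.* p ℤ.+ j ℤ.* p′)
pt-linear a i n p j n′ p′ = ≐-trans
  (solve 7 (λ a i n p j n′ p′ → i :* (n :* a :- p) :+ j :* (n′ :* a :- p′) :=
                               (i :* n :+ j :* n′) :* a :- (i :* p :+ j :* p′)) ≐-refl
     a (ι i) (ι n) (ι p) (ι j) (ι n′) (ι p′))
  (⊕-cong (⊗-cong (hom n n′) ≐-refl) (⊖-cong (hom p p′)))
  where
  hom : ∀ n n′ → ι i ⊗ ι n ⊕ ι j ⊗ ι n′ ≐ ι (i ℤ.* n ℤ.+ j ℤ.* n′)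
  hom n n′ = ≐-sym (≐-trans (ι-+ (i ℤ.* n) (j ℤ.* n′)) (⊕-cong (ι-* i n) (ι-* j n′)))

-- Kronecker's theorem

form : ℝ → ℝ → ℤ → ℤ → ℤ → ℝ
form a b x y z = ι x ⊕ ι y ⊗ a ⊕ ι z ⊗ b

Independent : ℝ → ℝ → Set
Independent a b = ∀ x y z → ¬ Pos (form a b x y z) → ¬ Pos (⊖ form a b x y z) →
  x ≡ 0ℤ × y ≡ 0ℤ × z ≡ 0ℤ

module Kronecker (a b : ℝ) (independent : Independent a b) where

  sign : ∀ {x y z} e → form a b x y z ≐ e → (x ≡ 0ℤ × y ≡ 0ℤ × z ≡ 0ℤ → ⊥) → ¬ ¬ (Pos e ⊎ Pos (⊖ e))
  sign e eq nz k = nz (independent _ _ _ (λ p → k (inj₁ (Pos-resp eq p)))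
    (λ p → k (inj₂ (Pos-resp (⊖-cong eq) p))))

  pt-form : ∀ n p → form a b (ℤ.- p) n 0ℤ ≐ pt a n p
  pt-form n p = ≐-trans (⊕-cong (⊕-cong (ι-neg p) ≐-refl) ≐-refl)
    (solve 4 (λ a b n p → :- p :+ n :* a :+ con 0ℤ :* b := n :* a :- p) ≐-refl a b (ι n) (ι p))

  det : ℤ → ℤ → ℤ → ℤ → ℤ → ℤ → ℝ
  det n p q n′ p′ q′ = pt a n p ⊗ pt b n′ q′ ⊝ pt a n′ p′ ⊗ pt b n q

  -- The terms in a b cancel in the determinant. What remains is an integer form in 1, a, b, nonzero
  -- by independence as soon as one coefficient is.
  det-form : ∀ n p q n′ p′ q′ →
    form a b (p ℤ.* q′ ℤ.- p′ ℤ.* q) (n′ ℤ.* q ℤ.- n ℤ.* q′) (p′ ℤ.* n ℤ.- p ℤ.* n′) ≐ det n p q n′ p′ q′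
  det-form n p q n′ p′ q′ = ≐-trans
    (⊕-cong (⊕-cong (hom p q′ p′ q) (⊗-cong (hom n′ q n q′) ≐-refl)) (⊗-cong (hom p′ n p n′) ≐-refl))
    (solve 8 (λ a b n p q n′ p′ q′ →
      (p :* q′ :- p′ :* q) :+ (n′ :* q :- n :* q′) :* a :+ (p′ :* n :- p :* n′) :* b :=
      (n :* a :- p) :* (n′ :* b :- q′) :- (n′ :* a :- p′) :* (n :* b :- q)) ≐-refl
      a b (ι n) (ι p) (ι q) (ι n′) (ι p′) (ι q′))
    where
    hom : ∀ i j k l → ι (i ℤ.* j ℤ.- k ℤ.* l) ≐ ι i ⊗ ι j ⊝ ι k ⊗ ι l
    hom i j k l = ≐-trans (ι-sub (i ℤ.* j) (k ℤ.* l)) (⊕-cong (ι-* i j) (⊖-cong (ι-* k l)))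

  -- Two parallel lattice points (n, p), (n′, p′) with n, n′ > 0 satisfy n |u′| = n′ |u| ≥ |u|.
  not-parallel : ∀ {n p n′ p′ ε} → 0ℤ ℤ.< n → 0ℤ ℤ.< n′ → Pos (pt a n p) ⊎ Pos (⊖ pt a n p) →
    (Pos (pt a n p) → ι n ⊗ ε ≺ pt a n p) → (Pos (⊖ pt a n p) → ι n ⊗ ε ≺ ⊖ pt a n p) →
    Within ε (pt a n′ p′) → p′ ℤ.* n ℤ.- p ℤ.* n′ ≡ 0ℤ → ⊥
  not-parallel {n} {p} {n′} {p′} {ε} 0<n 0<n′ signed small₊ small₋ w eq = [ (λ 0<u → contra 0<u (small₊ 0<u) same (proj₂ w))
    , (λ 0<-u → contra 0<-u (small₋ 0<-u) (≐-trans (solve 2 (λ n u → n :* (:- u) := :- (n :* u)) ≐-refl (ι n) (pt a n′ p′))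
        (≐-trans (⊖-cong same) (solve 2 (λ n u → :- (n :* u) := n :* (:- u)) ≐-refl (ι n′) (pt a n p))))
        (proj₂ (Within-neg w))) ]′ signed
    where
    same : ι n ⊗ pt a n′ p′ ≐ ι n′ ⊗ pt a n p
    same = ≐-trans (solve 5 (λ a n p n′ p′ → n :* (n′ :* a :- p′) := n′ :* (n :* a :- p) :- (p′ :* n :- p :* n′)) ≐-refl
        a (ι n) (ι p) (ι n′) (ι p′))
      (≐-trans (⊕-cong ≐-refl (⊖-cong (≐-trans
          (≐-sym (≐-trans (ι-sub (p′ ℤ.* n) (p ℤ.* n′)) (⊕-cong (ι-* p′ n) (⊖-cong (ι-* p n′)))))
          (≡⇒≐ (cong ι eq)))))
        (solve 1 (λ x → x :- con 0ℤ := x) ≐-refl _))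
    contra : ∀ {u u′} → Pos u → ι n ⊗ ε ≺ u → ι n ⊗ u′ ≐ ι n′ ⊗ u → u′ ≺ ε → ⊥
    contra {u} {u′} 0<u nε<u eq u′<ε = ≺-irrefl
      (≺-≼-trans (≺-trans (⊗-monoˡ-≺ (Pos-ι 0<n) u′<ε) nε<u) (≼-trans u≼n′u (≐⇒≼ (≐-sym eq))))
      where
      u≼n′u : u ≼ ι n′ ⊗ u
      u≼n′u = ≼-resp (solve 1 (λ u → u :* con 1ℤ := u) ≐-refl u) (⊗-comm u (ι n′))
        (⊗-monoˡ-≼ 0<u (ι-mono-≼ (ℤₚ.i<j⇒suc[i]≤j 0<n′)))

  -- The second vector is taken so short that n times its first coordinate stays below |u|, which
  -- excludes parallel vectors. If the determinant comes out negative, the vectors are swapped.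
  independent-pair : ∀ {ε} → Pos ε → ¬ ¬ (∃[ n ] ∃[ p ] ∃[ q ] ∃[ n′ ] ∃[ p′ ] ∃[ q′ ]
    (Pos (det n p q n′ p′ q′) × Within ε (pt a n p) × Within ε (pt b n q) ×
     Within ε (pt a n′ p′) × Within ε (pt b n′ q′)))
  independent-pair {ε} 0<ε =
    small a b 0<ε >>= λ (n , p , q , 0<n , wu , wv) →
    sign (pt a n p) (pt-form n p) (λ (_ , n≡0 , _) → ℤₚ.<-irrefl (sym n≡0) 0<n) >>= λ signed →
    separation n p 0<n signed >>= λ (δ , 0<δ , sep₊ , sep₋) →
    minimum 0<ε 0<δ >>= λ (η , 0<η , η≼ε , η≼δ) →
    small a b 0<η >>= λ (n′ , p′ , q′ , 0<n′ , wu′ , wv′) →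
    sign (det n p q n′ p′ q′) (det-form n p q n′ p′ q′)
      (λ (_ , _ , eq) → not-parallel {ε = δ} 0<n 0<n′ signed sep₊ sep₋ (Within-mono η≼δ wu′) eq) >>= λ
    { (inj₁ 0<D) → return (n , p , q , n′ , p′ , q′ , 0<D , wu , wv , Within-mono η≼ε wu′ , Within-mono η≼ε wv′)
    ; (inj₂ 0<-D) → return (n′ , p′ , q′ , n , p , q ,
        Pos-resp (solve 4 (λ x y z w → :- (x :* y :- z :* w) := z :* w :- x :* y) ≐-refl
          (pt a n p) (pt b n′ q′) (pt a n′ p′) (pt b n q)) 0<-D ,
        Within-mono η≼ε wu′ , Within-mono η≼ε wv′ , wu , wv) }
    where
    separation : ∀ n p → 0ℤ ℤ.< n → Pos (pt a n p) ⊎ Pos (⊖ pt a n p) → ¬ ¬ (∃[ δ ] (Pos δ ×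
      (Pos (pt a n p) → ι n ⊗ δ ≺ pt a n p) × (Pos (⊖ pt a n p) → ι n ⊗ δ ≺ ⊖ pt a n p)))
    separation (+ n) p _ (inj₁ 0<u) = fraction n 0<u >>= λ (δ , 0<δ , lt) →
      return (δ , 0<δ , (λ _ → lt) , (λ 0<-u → contradiction 0<-u (Pos-asym 0<u)))
    separation (+ n) p _ (inj₂ 0<-u) = fraction n 0<-u >>= λ (δ , 0<δ , lt) →
      return (δ , 0<δ , (λ 0<u → contradiction 0<-u (Pos-asym 0<u)) , (λ _ → lt))
    separation -[1+ n ] p () _

  approximate : ∀ {ε} → Pos ε → ∀ x y → ¬ ¬ (∃[ n ] ∃[ p ] ∃[ q ]
    (Within (ε ⊕ ε) (x ⊝ pt a n p) × Within (ε ⊕ ε) (y ⊝ pt b n q)))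
  approximate 0<ε x y =
    independent-pair 0<ε >>= λ (n , p , q , n′ , p′ , q′ , 0<D , wu , wv , wu′ , wv′) →
    lattice-approximation 0<D wu wv wu′ wv′ x y >>= λ (i , j , wx , wy) →
    return (_ , _ , _ ,
      Within-resp (⊕-cong ≐-refl (⊖-cong (pt-linear a i n p j n′ p′))) wx ,
      Within-resp (⊕-cong ≐-refl (⊖-cong (pt-linear b i n q j n′ q′))) wy)

  -- Adding T copies of a tiny lattice point of positive index raises the index by at least T = |N -
  -- n| + 1 and moves the point by less than ε.
  approximate-large : ∀ {ε} → Pos ε → ∀ x y N → ¬ ¬ (∃[ n ] ∃[ p ] ∃[ q ]
    (N ℤ.≤ n × Within (ε ⊕ ε ⊕ ε) (pt a n p ⊝ x) × Within (ε ⊕ ε ⊕ ε) (pt b n q ⊝ y)))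
  approximate-large {ε} 0<ε x y N =
    approximate 0<ε x y >>= λ (n , p , q , wx , wy) →
    fraction (suc ∣ N ℤ.- n ∣) 0<ε >>= λ (δ , 0<δ , lt) →
    small a b 0<δ >>= λ (n′ , p′ , q′ , 0<n′ , wu , wv) →
    let T = suc ∣ N ℤ.- n ∣ in
    return (1ℤ ℤ.* n ℤ.+ + T ℤ.* n′ , 1ℤ ℤ.* p ℤ.+ + T ℤ.* p′ , 1ℤ ℤ.* q ℤ.+ + T ℤ.* q′ ,
      large n n′ 0<n′ , near a lt wx wu , near b lt wy wv)
    where
    large : ∀ n n′ → 0ℤ ℤ.< n′ → N ℤ.≤ 1ℤ ℤ.* n ℤ.+ + (suc ∣ N ℤ.- n ∣) ℤ.* n′
    large n (+ zero) 0<n′ = contradiction 0<n′ (ℤₚ.<-irrefl refl)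
    large n (+ suc m) _ = begin
      N                           ≡⟨ identity N n ⟩
      1ℤ ℤ.* n ℤ.+ (N ℤ.- n)      ≤⟨ ℤₚ.+-monoʳ-≤ (1ℤ ℤ.* n) (≤T (N ℤ.- n)) ⟩
      1ℤ ℤ.* n ℤ.+ + T ℤ.* + suc m ∎
      where
      open ℤₚ.≤-Reasoning
      T = suc ∣ N ℤ.- n ∣
      identity : ∀ N n → N ≡ 1ℤ ℤ.* n ℤ.+ (N ℤ.- n)
      identity = ℤ-Tactic.solve-∀
      ≤T : ∀ k → k ℤ.≤ + suc ∣ k ∣ ℤ.* + suc m
      ≤T (+ k)    = subst (+ k ℤ.≤_) (ℤₚ.pos-* (suc k) (suc m))
        (ℤ.+≤+ (ℕₚ.≤-trans (ℕₚ.n≤1+n k) (ℕₚ.m≤m*n (suc k) (suc m))))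
      ≤T -[1+ k ] = subst (-[1+ k ] ℤ.≤_) (ℤₚ.pos-* (suc (suc k)) (suc m)) ℤ.-≤+
    near : ∀ c {T n p n′ p′ x δ} → ι (+ T) ⊗ δ ≺ ε → Within (ε ⊕ ε) (x ⊝ pt c n p) → Within δ (pt c n′ p′) →
      Within (ε ⊕ ε ⊕ ε) (pt c (1ℤ ℤ.* n ℤ.+ + T ℤ.* n′) (1ℤ ℤ.* p ℤ.+ + T ℤ.* p′) ⊝ x)
    near c {T} {n} {p} {n′} {p′} {x} {δ} lt w w′ = Within-resp
      (≐-trans (solve 4 (λ x u t u′ → :- (x :- u) :+ t :* u′ := (con 1ℤ :* u :+ t :* u′) :- x) ≐-refl
          x (pt c n p) (ι (+ T)) (pt c n′ p′))
        (⊕-cong (pt-linear c 1ℤ n p (+ T) n′ p′) ≐-refl))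
      (Within-+ (Within-neg w) (scale T lt))
      where
      scale : ∀ T → ι (+ T) ⊗ δ ≺ ε → Within ε (ι (+ T) ⊗ pt c n′ p′)
      scale zero    lt = Within-resp (≐-sym (proj₁ ⊗-zero _))
        ( ≺-shift (solve 1 (λ e → e :- con 0ℤ := con 0ℤ :- (:- e)) ≐-refl ε) (Pos⇒≻0 0<ε)
        , Pos⇒≻0 0<ε )
      scale (suc T) lt = Within-mono (≺⇒≼ lt)
        ( ≺-resp (solve 2 (λ t d → t :* (:- d) := :- (t :* d)) ≐-refl (ι (+ suc T)) δ) ≐-refl (⊗-monoˡ-≺ (ι-suc≻0 T) (proj₁ w′))
        , ⊗-monoˡ-≺ (ι-suc≻0 T) (proj₂ w′) )

  kronecker : ∀ {x x′ y y′} → x ≺ x′ → y ≺ y′ → ∀ N → ¬ ¬ (∃[ n ] ∃[ p ] ∃[ q ]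
    (N ℤ.≤ n × (x ≺ pt a n p × pt a n p ≺ x′) × (y ≺ pt b n q × pt b n q ≺ y′)))
  kronecker {x} {x′} {y} {y′} x<x′ y<y′ N =
    minimum (gap x<x′) (gap y<y′) >>= λ (η , 0<η , η≼x , η≼y) →
    -- Each window is centred at distance 3ε above its lower end, and the approximation errs by less
    -- than 3ε to either side.
    fraction 6 0<η >>= λ (ε , 0<ε , lt) →
    approximate-large 0<ε (x ⊕ (ε ⊕ ε ⊕ ε)) (y ⊕ (ε ⊕ ε ⊕ ε)) N >>= λ (n , p , q , N≤n , wu , wv) →
    return (n , p , q , N≤n , inside (≺-≼-trans lt η≼x) wu , inside (≺-≼-trans lt η≼y) wv)
    where
    inside : ∀ {x x′ u ε} → ι (+ 6) ⊗ ε ≺ x′ ⊝ x → Within (ε ⊕ ε ⊕ ε) (u ⊝ (x ⊕ (ε ⊕ ε ⊕ ε))) → x ≺ u × u ≺ x′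
    inside {x} {x′} {u} {ε} lt (l , r) =
      ≺-shift (solve 3 (λ x u e → (u :- (x :+ (e :+ e :+ e))) :- (:- (e :+ e :+ e)) := u :- x) ≐-refl x u ε) l ,
      ≺-trans (≺-shift (solve 3 (λ x u e → (e :+ e :+ e) :- (u :- (x :+ (e :+ e :+ e)))
          := (x :+ con (+ 6) :* e) :- u) ≐-refl x u ε) r)
        (≺-shift (solve 3 (λ x x′ e → (x′ :- x) :- con (+ 6) :* e := x′ :- (x :+ con (+ 6) :* e)) ≐-refl x x′ ε) lt)

-- Linear independence of 1, α, α²

≈0⇒¬Pos : ∀ {x} → x ≈ 0ℝ → ¬ Pos x
≈0⇒¬Pos {x} (x≤0 , _) p = classical p λ p → x≤0 (Pos⁺⇒<
  (Pos⁺-resp (≐-trans (solve 1 (λ x → x := x :- con 0ℤ) ≐-refl x) (⊕-cong ≐-refl (⊖-cong (ι≐ 0ℤ)))) p))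

≈0⇒¬Neg : ∀ {x} → x ≈ 0ℝ → ¬ Pos (⊖ x)
≈0⇒¬Neg {x} (_ , 0≤x) p = classical p λ p → 0≤x (Pos⁺⇒<
  (Pos⁺-resp (≐-trans (solve 1 (λ x → :- x := con 0ℤ :- x) ≐-refl x) (⊕-cong (ι≐ 0ℤ) ≐-refl)) p))

¬Pos⇒≈0 : ∀ {x} → ¬ Pos x → ¬ Pos (⊖ x) → x ≈ 0ℝ
¬Pos⇒≈0 {x} p q =
  (λ 0<x → p (Pos-resp (≐-trans (⊕-cong ≐-refl (⊖-cong (≐-sym (ι≐ 0ℤ)))) (solve 1 (λ x → x :- con 0ℤ := x) ≐-refl x))
    (pos⁺ (<⇒Pos⁺ 0<x)))) ,
  (λ x<0 → q (Pos-resp (≐-trans (⊕-cong (≐-sym (ι≐ 0ℤ)) ≐-refl) (solve 1 (λ x → con 0ℤ :- x := :- x) ≐-refl x))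
    (pos⁺ (<⇒Pos⁺ x<0))))

-- A non-reducing name for eval, for the same reason as the abstract operations.
abstract

  ⟪_⟫ : ∀ {n} → Vec ℤ n → ℝ → ℝ
  ⟪ cs ⟫ x = eval cs x

  ⟪⟫≐eval : ∀ {n} (cs : Vec ℤ n) x → ⟪ cs ⟫ x ≐ eval cs x
  ⟪⟫≐eval cs x = ≐-refl

  ⟪⟫-∷ : ∀ {n} c (cs : Vec ℤ n) x → ⟪ c ∷ cs ⟫ x ≐ ι c ⊕ x ⊗ ⟪ cs ⟫ x
  ⟪⟫-∷ c cs x = pointwise λ n → sym (trans (at (⊕≐+ (ι c) (x ⊗ eval cs x)) n)
    (cong₂ ℚ._+_ (at (ι≐ c) n) (at (⊗≐* x (eval cs x)) n)))

  ⟪⟫-[] : ∀ x → ⟪ [] ⟫ x ≐ ι 0ℤ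
  ⟪⟫-[] x = ≐-sym (ι≐ 0ℤ)

⟪⟫-zeros : ∀ n x → ⟪ replicate n 0ℤ ⟫ x ≐ ι 0ℤ
⟪⟫-zeros zero    x = ⟪⟫-[] x
⟪⟫-zeros (suc n) x = ≐-trans (⟪⟫-∷ 0ℤ (replicate n 0ℤ) x)
  (≐-trans (⊕-cong ≐-refl (⊗-cong ≐-refl (⟪⟫-zeros n x)))
    (solve 1 (λ x → con 0ℤ :+ x :* con 0ℤ := con 0ℤ) ≐-refl x))

⟪⟫-triple : ∀ x y z d a → ⟪ x ∷ y ∷ z ∷ replicate d 0ℤ ⟫ a ≐ form a (a ⊗ a) x y z
⟪⟫-triple x y z d a = ≐-trans
  (expand x (expand y (expand z (⟪⟫-zeros d a))))
  (solve 4 (λ a x y z → x :+ a :* (y :+ a :* (z :+ a :* con 0ℤ)) := x :+ y :* a :+ z :* (a :* a)) ≐-refl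
    a (ι x) (ι y) (ι z))
  where
  expand : ∀ {n} c {cs : Vec ℤ n} {y} → ⟪ cs ⟫ a ≐ y → ⟪ c ∷ cs ⟫ a ≐ ι c ⊕ a ⊗ y
  expand c {cs} e = ≐-trans (⟪⟫-∷ c cs a) (⊕-cong ≐-refl (⊗-cong ≐-refl e))

nonzero-sign : ∀ {i} → i ≢ 0ℤ → Pos (ι i) ⊎ Pos (⊖ ι i)
nonzero-sign {i} i≢0 with ℤₚ.<-cmp i 0ℤ
... | tri< i<0 _ _ = inj₂ (Pos-resp (ι-neg i) (Pos-ι (ℤₚ.neg-mono-< i<0)))
... | tri≈ _ i≡0 _ = contradiction i≡0 i≢0
... | tri> _ _ 0<i = inj₁ (Pos-ι 0<i)

-- For q = -i / j one has (x - q) j = i + x j, so x ≺ q or q ≺ x would give the vanishing value a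
-- sign.
linear-root-rational : ∀ {x} i {j} → j ≢ 0ℤ → ι i ⊕ x ⊗ ι j ≈ 0ℝ → ∃[ q ] x ≈ fromℚ q
linear-root-rational {x} i {j} j≢0 root =
  let q , eq = rational-root i j≢0 in
  q , (λ q<x → classical (pos⁺ (<⇒Pos⁺ q<x)) λ p → case nonzero-sign j≢0 of λ
        { (inj₁ 0<j) → ≈0⇒¬Pos root (Pos-resp (above eq) (Pos-* (pos⁺ p) 0<j))
        ; (inj₂ j<0) → ≈0⇒¬Neg root (Pos-resp (below eq) (Pos-* (pos⁺ p) j<0)) })
    , (λ x<q → classical (pos⁺ (<⇒Pos⁺ x<q)) λ p → case nonzero-sign j≢0 of λ
        { (inj₁ 0<j) → ≈0⇒¬Neg root (Pos-resp (≐-trans (flip (fromℚ q) x (ι j)) (below eq)) (Pos-* (pos⁺ p) 0<j))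
        ; (inj₂ j<0) → ≈0⇒¬Pos root (Pos-resp (≐-trans (flip′ (fromℚ q) x (ι j)) (above eq)) (Pos-* (pos⁺ p) j<0)) })
  where
  flip : ∀ q x j → (q ⊝ x) ⊗ j ≐ (x ⊝ q) ⊗ (⊖ j)
  flip = solve 3 (λ q x j → (q :- x) :* j := (x :- q) :* (:- j)) ≐-refl
  flip′ : ∀ q x j → (q ⊝ x) ⊗ (⊖ j) ≐ (x ⊝ q) ⊗ j
  flip′ = solve 3 (λ q x j → (q :- x) :* (:- j) := (x :- q) :* j) ≐-refl
  above : ∀ {q} → fromℚ q ⊗ ι j ≐ ⊖ ι i → (x ⊝ fromℚ q) ⊗ ι j ≐ ι i ⊕ x ⊗ ι j
  above {q} eq = ≐-trans (solve 3 (λ q x j → (x :- q) :* j := :- (q :* j) :+ x :* j) ≐-refl (fromℚ q) x (ι j))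
    (⊕-cong (≐-trans (⊖-cong eq) (solve 1 (λ i → :- (:- i) := i) ≐-refl (ι i))) ≐-refl)
  below : ∀ {q} → fromℚ q ⊗ ι j ≐ ⊖ ι i → (x ⊝ fromℚ q) ⊗ (⊖ ι j) ≐ ⊖ (ι i ⊕ x ⊗ ι j)
  below {q} eq = ≐-trans (solve 3 (λ q x j → (x :- q) :* (:- j) := :- ((x :- q) :* j)) ≐-refl (fromℚ q) x (ι j))
    (⊖-cong (above eq))

≈0-resp : ∀ {x y} → x ≐ y → x ≈ 0ℝ → y ≈ 0ℝ
≈0-resp e p = ¬Pos⇒≈0 (≈0⇒¬Pos p ∘ Pos-resp (≐-sym e)) (≈0⇒¬Neg p ∘ Pos-resp (⊖-cong (≐-sym e)))

-- In degree 0 a nonzero constant would vanish, and in degree 1 the root would be rational.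
degree≥3 : ∀ a d (f : Vec ℤ (suc d)) → last f ≢ 0ℤ → ⟪ f ⟫ a ≈ 0ℝ → Irrational a → d ≢ 2 → 3 ℕ.≤ d
degree≥3 a 0 (c ∷ []) c≢0 root _ _ = contradiction
  (≈0-resp (≐-trans (⟪⟫-∷ c [] a) (≐-trans (⊕-cong ≐-refl (⊗-cong ≐-refl (⟪⟫-[] a)))
    (solve 2 (λ c a → c :+ a :* con 0ℤ := c) ≐-refl (ι c) a))) root)
  λ c≈0 → [ ≈0⇒¬Pos c≈0 , ≈0⇒¬Neg c≈0 ]′ (nonzero-sign c≢0)
degree≥3 a 1 (c ∷ c′ ∷ []) c′≢0 root irrational _ =
  let q , a≈q = linear-root-rational c c′≢0 (≈0-resp (≐-trans (⟪⟫-∷ c (c′ ∷ []) a) (⊕-cong ≐-refl (⊗-cong ≐-refl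
        (≐-trans (⟪⟫-∷ c′ [] a) (≐-trans (⊕-cong ≐-refl (⊗-cong ≐-refl (⟪⟫-[] a)))
        (solve 2 (λ c a → c :+ a :* con 0ℤ := c) ≐-refl (ι c′) a)))))) root)
  in contradiction a≈q (irrational q)
degree≥3 a 2 _ _ _ _ d≢2 = contradiction refl d≢2
degree≥3 a (suc (suc (suc d))) _ _ _ _ _ = s≤s (s≤s (s≤s z≤n))

-- A relation x + y a + z a² = 0 is a polynomial with d coefficients vanishing at a, so minimality
-- kills it.
powers-independent : ∀ a {d} → 3 ℕ.≤ d → ((g : Vec ℤ d) → ⟪ g ⟫ a ≈ 0ℝ → g ≡ replicate d 0ℤ) →
  Independent a (a ⊗ a)
powers-independent a {suc (suc (suc d))} (s≤s (s≤s (s≤s z≤n))) minimal x y z p q =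
  let eq = minimal (x ∷ y ∷ z ∷ replicate d 0ℤ) (≈0-resp (≐-sym (⟪⟫-triple x y z d a)) (¬Pos⇒≈0 p q))
      x≡0 , eq′ = Vecₚ.∷-injective eq
      y≡0 , eq″ = Vecₚ.∷-injective eq′
  in x≡0 , y≡0 , Vecₚ.∷-injectiveˡ eq″

α-degree≥3 : ∀ α → Irrational (value α) → ¬ Quadratic α → 3 ℕ.≤ degree α
α-degree≥3 α = degree≥3 (value α) (degree α) (poly α) (leading≢0 α)
  (≈0-resp (≐-sym (⟪⟫≐eval (poly α) (value α))) (root α))

α-powers-independent : ∀ α → 3 ℕ.≤ degree α → Independent (value α) (value α ⊗ value α)
α-powers-independent α 3≤d = powers-independent (value α) 3≤d
  (λ g g≈0 → minimal α g (≈0-resp (⟪⟫≐eval g (value α)) g≈0))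

-- Separation of bounded integer combinations

Gap : (ℤ → ℝ → Set) → Set
Gap P = ∀ {i γ δ} → δ ≼ γ → P i γ → P i δ

-- A minimum over finitely many i; monotonicity in the bound lets the smallest one serve them all.
bounded-gap : ∀ {P : ℤ → ℝ → Set} → Gap P → (∀ i → ¬ ¬ (∃[ γ ] (Pos γ × P i γ))) →
  ∀ M → ¬ ¬ (∃[ γ ] (Pos γ × (∀ i → ∣ i ∣ ℕ.≤ M → P i γ)))
bounded-gap {P} mono each zero = each 0ℤ >>= λ (γ , 0<γ , p) →
  return (γ , 0<γ , λ i ∣i∣≤0 → subst (λ i → P i γ) (sym (ℤₚ.∣i∣≡0⇒i≡0 (ℕₚ.n≤0⇒n≡0 ∣i∣≤0))) p)
bounded-gap {P} mono each (suc M) =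
  bounded-gap mono each M >>= λ (γ , 0<γ , p) →
  each (+ suc M) >>= λ (γ₊ , 0<γ₊ , p₊) →
  each -[1+ M ] >>= λ (γ₋ , 0<γ₋ , p₋) →
  minimum 0<γ₊ 0<γ₋ >>= λ (δ , 0<δ , δ≼γ₊ , δ≼γ₋) →
  minimum 0<γ 0<δ >>= λ (η , 0<η , η≼γ , η≼δ) →
  return (η , 0<η , λ i ∣i∣≤1+M → case ℕₚ.m≤n⇒m<n∨m≡n ∣i∣≤1+M of λ
    { (inj₁ (s≤s ∣i∣≤M)) → mono η≼γ (p i ∣i∣≤M)
    ; (inj₂ eq) → extreme i eq (mono (≼-trans η≼δ δ≼γ₊) p₊) (mono (≼-trans η≼δ δ≼γ₋) p₋) })
  where
  extreme : ∀ {η} i → ∣ i ∣ ≡ suc M → P (+ suc M) η → P -[1+ M ] η → P i η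
  extreme (+ _)    refl p q = p
  extreme -[1+ _ ] refl p q = q

Within⇒∣∣≤ : ∀ {L i} → Within (ι (+ suc L)) (ι i) → ∣ i ∣ ℕ.≤ L
Within⇒∣∣≤ {L} {+ n}     (_ , u) with ι-cancel-≺ u
... | ℤ.+<+ (s≤s n≤L) = n≤L
Within⇒∣∣≤ {L} { -[1+ n ]} (l , _) with ι-cancel-≺ (≺-resp (≐-sym (ι-neg (+ suc L))) ≐-refl l)
... | ℤ.-<- n<L = n<L

bounded : ∀ x → ∃[ L ] Within (ι (+ L)) x
bounded x =
  let m , x<m = ≺-above x
      m′ , -x<m′ = ≺-above (⊖ x)
      L = m ℕ.+ m′
      ≤L : ∀ {k} → k ℕ.≤ L → ι (+ k) ≼ ι (+ L)
      ≤L k≤L = ι-mono-≼ (ℤ.+≤+ k≤L)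
  in L ,
     ≺-shift (solve 2 (λ x l → l :- (:- x) := x :- (:- l)) ≐-refl x (ι (+ L))) (≺-≼-trans -x<m′ (≤L (ℕₚ.m≤n+m m′ m))) ,
     ≺-≼-trans x<m (≤L (ℕₚ.m≤m+n m m′))

module Separation (a b : ℝ) (independent : Independent a b) where

  Trivial : ℤ → ℤ → ℤ → ℝ → Set
  Trivial x y z γ = Within γ (form a b x y z) → x ≡ 0ℤ × y ≡ 0ℤ × z ≡ 0ℤ

  separate-one : ∀ y z x → ¬ ¬ (∃[ γ ] (Pos γ × Trivial x y z γ))
  separate-one y z x with (x ℤ.≟ 0ℤ) ×-dec (y ℤ.≟ 0ℤ) ×-dec (z ℤ.≟ 0ℤ)
  ... | yes all0 = return (ι 1ℤ , Pos-ι (ℤ.+<+ ℕ.z<s) , λ _ → all0)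
  ... | no ¬all0 = λ k → ¬all0 (independent x y z
    (λ p → k (_ , p , λ (_ , u) → contradiction u ≺-irrefl))
    (λ p → k (_ , p , λ (l , _) → contradiction
      (≺-resp (solve 1 (λ e → :- (:- e) := e) ≐-refl (form a b x y z)) ≐-refl l) ≺-irrefl)))

  -- Although x is unbounded, a form of absolute value below 1 confines it to a finite range once y
  -- and z are fixed.
  separate-all-x : ∀ y z → ¬ ¬ (∃[ γ ] (Pos γ × ∀ x → Trivial x y z γ))
  separate-all-x y z =
    bounded-gap (λ δ≼γ t → t ∘ Within-mono δ≼γ) (separate-one y z) L >>= λ (γ , 0<γ , t) →
    minimum 0<γ (Pos-ι {1ℤ} (ℤ.+<+ ℕ.z<s)) >>= λ (δ , 0<δ , δ≼γ , δ≼1) →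
    return (δ , 0<δ , λ x w → t x (Within⇒∣∣≤ (Within-resp (peel x) (Within-mono (≐⇒≼ (≐-sym (ι-+ 1ℤ (+ L))))
      (Within-+ (Within-mono δ≼1 w) (Within-neg (proj₂ (bounded (ι y ⊗ a ⊕ ι z ⊗ b)))))))) (Within-mono δ≼γ w))
    where
    L = proj₁ (bounded (ι y ⊗ a ⊕ ι z ⊗ b))
    peel : ∀ x → form a b x y z ⊕ ⊖ (ι y ⊗ a ⊕ ι z ⊗ b) ≐ ι x
    peel x = solve 3 (λ x y z → (x :+ y :+ z) :- (y :+ z) := x) ≐-refl (ι x) (ι y ⊗ a) (ι z ⊗ b)

  -- Applied to differences, this spaces out the points `u n p` of bounded index, likewise the
  -- `v k l`, and the targets of bounded facts modulo 1.
  separation : ∀ M → ¬ ¬ (∃[ γ ] (Pos γ × ∀ y → ∣ y ∣ ℕ.≤ M → ∀ z → ∣ z ∣ ℕ.≤ M → ∀ x → Trivial x y z γ))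
  separation M = bounded-gap (λ δ≼γ t z ∣z∣≤M x w → t z ∣z∣≤M x (Within-mono δ≼γ w))
    (λ y → bounded-gap (λ δ≼γ t x w → t x (Within-mono δ≼γ w)) (separate-all-x y) M) M

-- Storing facts in elements

Fact : Set
Fact = ℕ × ℕ

form-⊝ : ∀ a b x y z x′ y′ z′ →
  form a b (x ℤ.- x′) (y ℤ.- y′) (z ℤ.- z′) ≐ form a b x y z ⊝ form a b x′ y′ z′
form-⊝ a b x y z x′ y′ z′ = ≐-trans
  (⊕-cong (⊕-cong (ι-sub x x′) (⊗-cong (ι-sub y y′) ≐-refl)) (⊗-cong (ι-sub z z′) ≐-refl))
  (solve 8 (λ a b x y z x′ y′ z′ → (x :- x′) :+ (y :- y′) :* a :+ (z :- z′) :* b :=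
    (x :+ y :* a :+ z :* b) :- (x′ :+ y′ :* a :+ z′ :* b)) ≐-refl
    a b (ι x) (ι y) (ι z) (ι x′) (ι y′) (ι z′))

≺⇒⊝≺ : ∀ {x y g} → y ⊝ g ≺ x → y ⊝ x ≺ g
≺⇒⊝≺ {x} {y} {g} = ≺-shift (solve 3 (λ x y g → x :- (y :- g) := g :- (y :- x)) ≐-refl x y g)

≼⇒⊝≼ : ∀ {x y g} → g ≼ y ⊝ x → x ≼ y ⊝ g
≼⇒⊝≼ {x} {y} {g} = ≼-shift (solve 3 (λ x y g → g :- (y :- x) := x :- (y :- g)) ≐-refl x y g)

⊝-monoˡ-≼ : ∀ {x y z} → x ≼ y → x ⊝ z ≼ y ⊝ z
⊝-monoˡ-≼ {x} {y} {z} = ≼-shift (solve 3 (λ x y z → x :- y := (x :- z) :- (y :- z)) ≐-refl x y z)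

⊝-monoˡ-≺ : ∀ {x y z} → x ≺ y → x ⊝ z ≺ y ⊝ z
⊝-monoˡ-≺ {x} {y} {z} = ≺-shift (solve 3 (λ x y z → y :- x := (y :- z) :- (x :- z)) ≐-refl x y z)

⊝-antimono-≼ : ∀ {x y z} → x ≼ y → z ⊝ y ≼ z ⊝ x
⊝-antimono-≼ {x} {y} {z} = ≼-shift (solve 3 (λ x y z → x :- y := (z :- y) :- (z :- x)) ≐-refl x y z)

⊝-antimono-≺ : ∀ {x y z} → x ≺ y → z ⊝ y ≺ z ⊝ x
⊝-antimono-≺ {x} {y} {z} = ≺-shift (solve 3 (λ x y z → y :- x := (z :- x) :- (z :- y)) ≐-refl x y z)

⊝-pos-≺ : ∀ {x g} → Pos g → x ⊝ g ≺ x
⊝-pos-≺ {x} {g} p = diff (Pos-resp (solve 2 (λ x g → g := x :- (x :- g)) ≐-refl x g) p)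

⊕-≼⇒≺⊝ : ∀ {x y z g} → x ≺ y → y ⊕ g ≼ z → g ≺ z ⊝ x
⊕-≼⇒≺⊝ {x} {y} {z} {g} x<y y+g≼z = ≺-≼-trans
  (≺-shift (solve 3 (λ x y g → y :- x := ((y :+ g) :- x) :- g) ≐-refl x y g) x<y) (⊝-monoˡ-≼ y+g≼z)

+1≤ : ∀ {i j} → i ℤ.< j → i ℤ.+ 1ℤ ℤ.≤ j
+1≤ {i} {j} i<j = subst (ℤ._≤ j) (ℤₚ.+-comm 1ℤ i) (ℤₚ.i<j⇒suc[i]≤j i<j)

<+1 : ∀ i → i ℤ.< i ℤ.+ 1ℤ
<+1 i = subst (ℤ._< i ℤ.+ 1ℤ) (ℤₚ.+-identityʳ i) (ℤₚ.+-monoʳ-< i (ℤ.+<+ ℕ.z<s))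

module Elements (a b : ℝ) (independent : Independent a b) where

  open Kronecker a b independent
  open Separation a b independent

  -- Written as `form`, differences fall under `separation`, and the values of the terms `uᶠ` and
  -- `vᶠ` are these reals on the nose.
  u v : ℤ → ℤ → ℝ
  u n p = form a b (ℤ.- p) n 0ℤ
  v k l = form a b (ℤ.- l) 0ℤ k

  u≐pt : ∀ n p → u n p ≐ pt a n p
  u≐pt = pt-form

  v≐pt : ∀ k l → v k l ≐ pt b k l
  v≐pt k l = ≐-trans (⊕-cong (⊕-cong (ι-neg l) ≐-refl) ≐-refl)
    (solve 4 (λ a b k l → :- l :+ con 0ℤ :* a :+ k :* b := k :* b :- l) ≐-refl a b (ι k) (ι l))

  dense : ∀ {x x′ y y′} → x ≺ x′ → y ≺ y′ → ∀ N → ¬ ¬ (∃[ n ] ∃[ p ] ∃[ q ]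
    (N ℤ.≤ n × (x ≺ u n p × u n p ≺ x′) × (y ≺ v n q × v n q ≺ y′)))
  dense x<x′ y<y′ N = kronecker x<x′ y<y′ N >>= λ (n , p , q , N≤n , (l , r) , (l′ , r′)) →
    return (n , p , q , N≤n ,
      (≺-resp ≐-refl (≐-sym (u≐pt n p)) l , ≺-resp (≐-sym (u≐pt n p)) ≐-refl r) ,
      (≺-resp ≐-refl (≐-sym (v≐pt n q)) l′ , ≺-resp (≐-sym (v≐pt n q)) ≐-refl r′))

  0<1 : ι 0ℤ ≺ ι 1ℤ
  0<1 = ι-mono-≺ (ℤ.+<+ ℕ.z<s)

  -- (n, p) is the first point to come closer to s than every (k′, l′) with k′ ≤ n comes to r (both
  -- from above), where (k, l) is the point closest to r.
  record Element (s r : ℝ) (n p k l : ℤ) : Set where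
    field
      0<n     : 0ℤ ℤ.< n
      0≤k     : 0ℤ ℤ.≤ k
      k≤n     : k ℤ.≤ n
      s≺u     : s ≺ u n p
      r≺v     : r ≺ v k l
      closer  : ∀ k′ l′ → 0ℤ ℤ.≤ k′ → k′ ℤ.≤ n → r ≺ v k′ l′ → u n p ⊝ s ≺ v k′ l′ ⊝ r
      first   : ∀ m p′ → 0ℤ ℤ.≤ m → m ℤ.< n → s ≺ u m p′ → v k l ⊝ r ≼ u m p′ ⊝ s

  open Element

  target : Fact → ℝ
  target (X , Y) = form a b 0ℤ (+ X) (+ Y)

  Encodes : ℝ → ℤ → ℤ → Fact → Set
  Encodes ε n q F = target F ≺ v n q × v n q ⊝ target F ≺ ε

  Bounded : ℕ → Fact → Set
  Bounded M (X , Y) = X ℕ.≤ M × Y ℕ.≤ M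

  Coded : ℕ → ℝ → ℝ → ℝ → ℤ → Fact → Set
  Coded M ε s r N G = ∃[ n ] ∃[ p ] ∃[ k ] ∃[ l ] ∃[ q ]
    (Element s r n p k l × Encodes ε n q G × Bounded M G × n ℤ.< N)

  Separates : ℕ → ℝ → Set
  Separates M γ = ∀ y → ∣ y ∣ ℕ.≤ M → ∀ z → ∣ z ∣ ℕ.≤ M → ∀ x → Trivial x y z γ

  ∣-∣≤ : ∀ {i j N} → 0ℤ ℤ.≤ i → i ℤ.≤ N → 0ℤ ℤ.≤ j → j ℤ.≤ N → ∣ i ℤ.- j ∣ ℕ.≤ ∣ N ∣
  ∣-∣≤ {+ i} {+ j} {+ N} _ (ℤ.+≤+ i≤N) _ (ℤ.+≤+ j≤N) = ℕₚ.≤-trans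
    (ℕₚ.≤-reflexive (cong ∣_∣ (ℤₚ.m-n≡m⊖n i j)))
    (ℕₚ.≤-trans (ℤₚ.∣m⊝n∣≤m⊔n i j) (ℕₚ.⊔-lub i≤N j≤N))

  u-isolated : ∀ {N γ n p n′ p′} → Separates ∣ N ∣ γ → 0ℤ ℤ.≤ n → n ℤ.≤ N → 0ℤ ℤ.≤ n′ → n′ ℤ.≤ N →
    Within γ (u n p ⊝ u n′ p′) → n ≡ n′ × p ≡ p′
  u-isolated {N} {γ} {n} {p} {n′} {p′} sep 0≤n n≤N 0≤n′ n′≤N w =
    let p≡ , n≡ , _ = sep (n ℤ.- n′) (∣-∣≤ 0≤n n≤N 0≤n′ n′≤N) 0ℤ z≤n (ℤ.- p ℤ.- ℤ.- p′)
          (Within-resp (≐-sym (form-⊝ a b (ℤ.- p) n 0ℤ (ℤ.- p′) n′ 0ℤ)) w)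
    in ℤₚ.i-j≡0⇒i≡j n n′ n≡ , ℤₚ.neg-injective (ℤₚ.i-j≡0⇒i≡j (ℤ.- p) (ℤ.- p′) p≡)

  v-isolated : ∀ {N γ n p n′ p′} → Separates ∣ N ∣ γ → 0ℤ ℤ.≤ n → n ℤ.≤ N → 0ℤ ℤ.≤ n′ → n′ ℤ.≤ N →
    Within γ (v n p ⊝ v n′ p′) → n ≡ n′ × p ≡ p′
  v-isolated {N} {γ} {n} {p} {n′} {p′} sep 0≤n n≤N 0≤n′ n′≤N w =
    let p≡ , _ , n≡ = sep 0ℤ z≤n (n ℤ.- n′) (∣-∣≤ 0≤n n≤N 0≤n′ n′≤N) (ℤ.- p ℤ.- ℤ.- p′)
          (Within-resp (≐-sym (form-⊝ a b (ℤ.- p) 0ℤ n (ℤ.- p′) 0ℤ n′)) w)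
    in ℤₚ.i-j≡0⇒i≡j n n′ n≡ , ℤₚ.neg-injective (ℤₚ.i-j≡0⇒i≡j (ℤ.- p) (ℤ.- p′) p≡)

  -- At equal n the term n b cancels, so two stored targets differ by an integer up to less than ε,
  -- and `Separates` makes X - X′ and Y - Y′ vanish.
  encodes-unique : ∀ {M γ ε n q q′ F G} → Separates M γ → ε ≼ γ → Bounded M F → Bounded M G →
    Encodes ε n q F → Encodes ε n q′ G → F ≡ G
  encodes-unique {M} {γ} {ε} {n} {q} {q′} {X , Y} {X′ , Y′} sep ε≼γ (X≤M , Y≤M) (X′≤M , Y′≤M) (l , r) (l′ , r′) =
    let _ , X≡ , Y≡ = sep (+ X ℤ.- + X′) (∣-∣≤ {N = + M} (ℤ.+≤+ z≤n) (ℤ.+≤+ X≤M) (ℤ.+≤+ z≤n) (ℤ.+≤+ X′≤M))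
                          (+ Y ℤ.- + Y′) (∣-∣≤ {N = + M} (ℤ.+≤+ z≤n) (ℤ.+≤+ Y≤M) (ℤ.+≤+ z≤n) (ℤ.+≤+ Y′≤M))
                          (q ℤ.- q′) (Within-mono ε≼γ w)
    in cong₂ _,_ (ℤₚ.+-injective (ℤₚ.i-j≡0⇒i≡j _ _ X≡)) (ℤₚ.+-injective (ℤₚ.i-j≡0⇒i≡j _ _ Y≡))
    where
    difference : (v n q′ ⊝ target (X′ , Y′)) ⊝ (v n q ⊝ target (X , Y)) ≐ form a b (q ℤ.- q′) (+ X ℤ.- + X′) (+ Y ℤ.- + Y′)
    difference = ≐-trans
      (solve 9 (λ a b n q q′ x y x′ y′ →
        ((q′ :+ con 0ℤ :* a :+ n :* b) :- (con 0ℤ :+ x′ :* a :+ y′ :* b)) :-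
        ((q :+ con 0ℤ :* a :+ n :* b) :- (con 0ℤ :+ x :* a :+ y :* b)) :=
        (q′ :- q) :+ (x :- x′) :* a :+ (y :- y′) :* b) ≐-refl
        a b (ι n) (ι (ℤ.- q)) (ι (ℤ.- q′)) (ι (+ X)) (ι (+ Y)) (ι (+ X′)) (ι (+ Y′)))
      (≐-sym (⊕-cong (⊕-cong
        (≐-trans (≡⇒≐ (cong ι (swap q q′))) (ι-sub (ℤ.- q′) (ℤ.- q)))
        (⊗-cong (ι-sub (+ X) (+ X′)) ≐-refl)) (⊗-cong (ι-sub (+ Y) (+ Y′)) ≐-refl)))
      where
      swap : ∀ q q′ → q ℤ.- q′ ≡ ℤ.- q′ ℤ.- ℤ.- q
      swap = ℤ-Tactic.solve-∀
    w : Within ε (form a b (q ℤ.- q′) (+ X ℤ.- + X′) (+ Y ℤ.- + Y′))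
    w = Within-resp difference
      ( diff (Pos-resp (solve 3 (λ e d d′ → d′ :+ (e :- d) := (d′ :- d) :- (:- e)) ≐-refl
          ε (v n q ⊝ target (X , Y)) (v n q′ ⊝ target (X′ , Y′))) (Pos-+ (gap l′) (gap r)))
      , diff (Pos-resp (solve 3 (λ e d d′ → d :+ (e :- d′) := e :- (d′ :- d)) ≐-refl
          ε (v n q ⊝ target (X , Y)) (v n q′ ⊝ target (X′ , Y′))) (Pos-+ (gap l) (gap r′))) )

  -- `J F Known` abstracts "F is justified by known facts"; monotonicity carries a justification
  -- from membership in a list over to facts stored in earlier elements.
  module Stages (M : ℕ) (ε γ : ℝ) (0<ε : Pos ε) (ε≼γ : ε ≼ γ) (γ-separates : Separates M γ)
    (J : Fact → (Fact → Set) → Set)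
    (J-map : ∀ {F} {P Q : Fact → Set} → (∀ {G} → P G → Q G) → J F P → J F Q) where

    data Ok : List Fact → Set where
      []  : Ok []
      _∷_ : ∀ {F L} → Bounded M F × J F (_∈ L) → Ok L → Ok (F ∷ L)

    record Content (s r : ℝ) (N : ℤ) (L : List Fact) : Set where
      field
        have : ∀ {G} → G ∈ L → Coded M ε s r (N ℤ.+ 1ℤ) G
        only : ∀ {n p k l q F} → Element s r n p k l → n ℤ.≤ N → Bounded M F → Encodes ε n q F →
               J F (Coded M ε s r n)

    open Content

    -- The content is guaranteed for all s and r in open intervals, so a further element is added by
    -- shrinking them. The last point `u N pN` is the upper end for s.
    record Stage (L : List Fact) : Set where
      field
        N pN      : ℤ
        0≤N       : 0ℤ ℤ.≤ N
        s⁻ r⁻ r⁺  : ℝ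
        s⁻≺       : s⁻ ≺ u N pN
        r⁻≺r⁺     : r⁻ ≺ r⁺
        content   : ∀ {s r} → s⁻ ≺ s → s ≺ u N pN → r⁻ ≺ r → r ≺ r⁺ → Content s r N L

    open Stage

    Coded-mono : ∀ {s r N N′ G} → N ℤ.≤ N′ → Coded M ε s r N G → Coded M ε s r N′ G
    Coded-mono N≤N′ (n , p , k , l , q , el , en , G≤M , n<N) = n , p , k , l , q , el , en , G≤M , ℤₚ.<-≤-trans n<N N≤N′

    initial : Stage []
    initial = record
      -- The point (0, 0) serves as the first blocker without being an element, as elements have
      -- positive index.
      { N = 0ℤ ; pN = 0ℤ ; 0≤N = ℤₚ.≤-refl ; s⁻ = u 0ℤ 0ℤ ⊝ ι 1ℤ ; r⁻ = ι 0ℤ ; r⁺ = ι 1ℤ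
      ; s⁻≺ = ⊝-pos-≺ (Pos-ι (ℤ.+<+ ℕ.z<s)) ; r⁻≺r⁺ = 0<1
      ; content = λ _ _ _ _ → record
        { have = λ ()
        ; only = λ el n≤0 _ _ → contradiction (ℤₚ.<-≤-trans (0<n el) n≤0) (ℤₚ.<-irrefl refl) } }

    -- First (k, l), then (n, p) beyond it.  With v k l ⊝ r in (h, g) and u n p ⊝ s in (0, h), the previous
    -- element blocks all points before k, the closeness of r to v k l those from k on, until (n, p).
    record Choice {L} (S : Stage L) (F : Fact) : Set where
      field
        k l n p q          : ℤ
        γ₁ γ₂ g h          : ℝ
        N<k                : N S ℤ.< k
        k<n                : k ℤ.< n
        sep₁               : Separates ∣ k ∣ γ₁
        sep₂               : Separates ∣ n ∣ γ₂
        0<h                : Pos h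
        h≺g                : h ≺ g
        g≼γ₁               : g ≼ γ₁
        g≼γ₂               : g ≼ γ₂
        r⁻≼                : r⁻ S ≼ v k l ⊝ g
        v≺r⁺               : v k l ≺ r⁺ S
        s⁻≼                : s⁻ S ≼ u n p ⊝ h
        near               : u (N S) (pN S) ⊝ γ₁ ≼ u n p ⊝ h
        u≺                 : u n p ≺ u (N S) (pN S)
        encodes            : Encodes ε n q F

    choose : ∀ {L} (S : Stage L) F → ¬ ¬ Choice S F
    choose S F =
      -- Only v k l matters here; the interval (0, 1) for the u-coordinate is a dummy.
      dense 0<1 (r⁻≺r⁺ S) (N S ℤ.+ 1ℤ) >>= λ (k , _ , l , N<k , _ , r⁻≺v , v≺r⁺) →
      separation ∣ k ∣ >>= λ (γ₁ , 0<γ₁ , sep₁) →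
      minimum 0<γ₁ (gap (s⁻≺ S)) >>= λ (η , 0<η , η≼γ₁ , η≼) →
      -- u n p goes just below the previous point, within `η` of it, while v n q at the same index
      -- is still free to store F.
      dense (⊝-pos-≺ {u (N S) (pN S)} 0<η) (room F) (k ℤ.+ 1ℤ) >>= λ (n , p , q , k<n , (u> , u≺) , en) →
      separation ∣ n ∣ >>= λ (γ₂ , 0<γ₂ , sep₂) →
      minimum 0<γ₁ 0<γ₂ >>= λ (g₁ , 0<g₁ , g₁≼γ₁ , g₁≼γ₂) →
      minimum 0<g₁ (gap r⁻≺v) >>= λ (g , 0<g , g≼g₁ , g≼r) →
      -- 2h below g leaves the new interval (v k l - g, v k l - h) for r nonempty.
      fraction 2 0<g >>= λ (h₁ , 0<h₁ , 2h₁≺g) →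
      minimum 0<h₁ (gap u>) >>= λ (h , 0<h , h≼h₁ , h≼) →
      return record
        { k = k ; l = l ; n = n ; p = p ; q = q ; γ₁ = γ₁ ; γ₂ = γ₂ ; g = g ; h = h
        ; N<k = ℤₚ.<-≤-trans (<+1 (N S)) N<k ; k<n = ℤₚ.<-≤-trans (<+1 k) k<n ; sep₁ = sep₁ ; sep₂ = sep₂
        ; 0<h = 0<h
        ; h≺g = ≼-≺-trans h≼h₁ (≺-trans
            (diff (Pos-resp (solve 1 (λ h → h := con (+ 2) :* h :- h) ≐-refl h₁) 0<h₁)) 2h₁≺g)
        ; g≼γ₁ = ≼-trans g≼g₁ g₁≼γ₁ ; g≼γ₂ = ≼-trans g≼g₁ g₁≼γ₂
        ; r⁻≼ = ≼⇒⊝≼ g≼r ; v≺r⁺ = v≺r⁺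
        ; s⁻≼ = ≼-trans (≼⇒⊝≼ η≼) (≼⇒⊝≼ h≼)
        ; near = ≼-trans (⊝-antimono-≼ η≼γ₁) (≼⇒⊝≼ h≼)
        ; u≺ = u≺
        ; encodes = proj₁ en ,
            ≺-shift (solve 3 (λ t e v → (t :+ e) :- v := e :- (v :- t)) ≐-refl (target F) ε _) (proj₂ en) }
      where
      room : ∀ F → target F ≺ target F ⊕ ε
      room F = diff (Pos-resp (solve 2 (λ t e → e := (t :+ e) :- t) ≐-refl (target F) ε) 0<ε)

    module Extension {L} (S : Stage L) {F} (C : Choice S F) (F≤M : Bounded M F) (justified : J F (_∈ L)) where

      open Choice C

      0≤k′ : 0ℤ ℤ.≤ k
      0≤k′ = ℤₚ.≤-trans (0≤N S) (ℤₚ.<⇒≤ N<k)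

      0≤n : 0ℤ ℤ.≤ n
      0≤n = ℤₚ.≤-trans 0≤k′ (ℤₚ.<⇒≤ k<n)

      module _ {s r} (<s : u n p ⊝ h ≺ s) (s< : s ≺ u n p) (<r : v k l ⊝ g ≺ r) (r< : r ≺ v k l ⊝ h) where

        0<g : Pos g
        0<g = ≻0⇒Pos (≺-trans (Pos⇒≻0 0<h) h≺g)

        r≺vkl : r ≺ v k l
        r≺vkl = ≺-trans r< (⊝-pos-≺ 0<h)

        old : Content s r (N S) L
        old = content S (≼-≺-trans s⁻≼ <s) (≺-trans s< u≺) (≼-≺-trans r⁻≼ <r) (≺-trans r≺vkl v≺r⁺)

        h≺v-r : h ≺ v k l ⊝ r
        h≺v-r = ≺-shift (solve 3 (λ h v r → (v :- h) :- r := (v :- r) :- h) ≐-refl h (v k l) r) r<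

        v-r≺g : v k l ⊝ r ≺ g
        v-r≺g = ≺⇒⊝≺ <r

        u-s≺h : u n p ⊝ s ≺ h
        u-s≺h = ≺⇒⊝≺ <s

        Within-below : ∀ {x y t δ} → y ⊝ t ≺ δ → t ≺ x → x ≺ y ⊕ δ → Within δ (x ⊝ y)
        Within-below {x} {y} {t} {δ} y-t<δ t<x x<y+δ =
          ≺-trans (≺-shift (solve 3 (λ y t δ → δ :- (y :- t) := (t :- y) :- (:- δ)) ≐-refl y t δ) y-t<δ) (⊝-monoˡ-≺ t<x) ,
          ≺-shift (solve 3 (λ x y δ → (y :+ δ) :- x := δ :- (x :- y)) ≐-refl x y δ) x<y+δ

        -- v k l is less than γ₁ above r, and values of v at distinct indices up to k are at least
        -- γ₁ apart.
        v-far : ∀ {m l′} → 0ℤ ℤ.≤ m → m ℤ.< k → r ≺ v m l′ → v k l ⊕ γ₁ ≼ v m l′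
        v-far {m} {l′} 0≤m m<k r<v v<+γ₁ = ℤₚ.<-irrefl
          (proj₁ (v-isolated {k} {γ₁} sep₁ 0≤m (ℤₚ.<⇒≤ m<k) 0≤k′ ℤₚ.≤-refl
            (Within-below (≺-≼-trans v-r≺g g≼γ₁) r<v v<+γ₁))) m<k

        v-closest : ∀ {m l′} → 0ℤ ℤ.≤ m → m ℤ.≤ n → r ≺ v m l′ → v k l ≼ v m l′
        v-closest {m} {l′} 0≤m m≤n r<v v<v = contradiction v<v
          (subst₂ (λ i j → v k l ≼ v i j) (sym (proj₁ same)) (sym (proj₂ same)) ≼-refl)
          where
          same : m ≡ k × l′ ≡ l
          same = v-isolated {n} {γ₂} sep₂ 0≤m m≤n 0≤k′ (ℤₚ.<⇒≤ k<n) (Within-below (≺-≼-trans v-r≺g g≼γ₂) r<v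
            (≺-trans v<v (diff (Pos-resp (solve 2 (λ v g → g := (v :+ g) :- v) ≐-refl (v k l) γ₂)
              (≻0⇒Pos (≺-≼-trans (Pos⇒≻0 0<g) g≼γ₂))))))

        u-isolated-below : ∀ {m p′} → 0ℤ ℤ.≤ m → m ℤ.≤ n → s ≺ u m p′ → u m p′ ≺ u n p ⊕ γ₂ → m ≡ n × p′ ≡ p
        u-isolated-below 0≤m m≤n s<u u<+γ₂ = u-isolated {n} {γ₂} sep₂ 0≤m m≤n 0≤n ℤₚ.≤-refl
          (Within-below (≺-≼-trans (≺-trans u-s≺h h≺g) g≼γ₂) s<u u<+γ₂)

        -- The distances satisfy u n p - s < h < v k l - r < g. Isolation at scale γ₂ makes v k l
        -- the closest v up to index n and keeps every earlier u more than γ₂ above s.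
        new : Element s r n p k l
        new = record
          { 0<n = ℤₚ.≤-<-trans 0≤k′ k<n ; 0≤k = 0≤k′ ; k≤n = ℤₚ.<⇒≤ k<n ; s≺u = s< ; r≺v = r≺vkl
          ; closer = λ m l′ 0≤m m≤n r<v →
              ≺-≼-trans (≺-trans u-s≺h h≺v-r) (⊝-monoˡ-≼ (v-closest 0≤m m≤n r<v))
          ; first = λ m p′ 0≤m m<n s<u → ≺⇒≼ (≺-trans (≺-≼-trans v-r≺g g≼γ₂)
              (⊕-≼⇒≺⊝ s< λ u<+γ₂ → ℤₚ.<-irrefl (proj₁ (u-isolated-below 0≤m (ℤₚ.<⇒≤ m<n) s<u u<+γ₂)) m<n)) }

        have′ : ∀ {G} → G ∈ F ∷ L → Coded M ε s r (n ℤ.+ 1ℤ) G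
        have′ (here refl) = n , p , k , l , q , new , encodes , F≤M , <+1 n
        have′ (there G∈L) = Coded-mono (ℤₚ.+-monoˡ-≤ 1ℤ (ℤₚ.<⇒≤ (ℤₚ.<-trans N<k k<n))) (have old G∈L)

        only′ : ∀ {m p′ k′ l′ q′ G} → Element s r m p′ k′ l′ → m ℤ.≤ n → Bounded M G → Encodes ε m q′ G →
          J G (Coded M ε s r m)
        only′ {m} {p′} {k′} {l′} {q′} {G} el m≤n G≤M en with m ℤ.≤? N S
        ... | yes m≤N = only old el m≤N G≤M en
        ... | no m≰N with m ℤ.<? k
        -- Strictly between N and k: the previous point is less than γ₁ above s, so `first` puts v
        -- k′ l′ less than γ₁ above r, whereas k′ < k makes that distance exceed γ₁.
        ...   | yes m<k = contradiction (⊕-≼⇒≺⊝ r≺vkl (v-far (0≤k el) (ℤₚ.≤-<-trans (k≤n el) m<k) (r≺v el)))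
          (≼-trans (first el (N S) (pN S) (0≤N S) (ℤₚ.≰⇒> m≰N) (≺-trans s< u≺))
            (≺⇒≼ (≺⇒⊝≺ (≼-≺-trans near <s))))
        -- From k on, `closer` applied to (k, l) puts u m p′ within γ₂ of s, and up to index n only
        -- u n p is that close.
        ...   | no m≮k = same (u-isolated-below (ℤₚ.<⇒≤ (0<n el)) m≤n (s≺u el) (⊝≺⇒≺⊕ far))
          where
          far : u m p′ ⊝ s ≺ γ₂
          far = ≺-≼-trans (≺-trans (closer el k l 0≤k′ (ℤₚ.≮⇒≥ m≮k) r≺vkl) v-r≺g) g≼γ₂
          ⊝≺⇒≺⊕ : ∀ {x γ} → x ⊝ s ≺ γ → x ≺ u n p ⊕ γ
          ⊝≺⇒≺⊕ {x} {γ} lt = diff (Pos-resp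
            (solve 4 (λ x s u γ → (γ :- (x :- s)) :+ (u :- s) := (u :+ γ) :- x) ≐-refl x s (u n p) γ)
            (Pos-+ (gap lt) (gap s<)))
          same : m ≡ n × p′ ≡ p → J G (Coded M ε s r m)
          same (refl , refl) = subst (λ H → J H (Coded M ε s r n)) (encodes-unique γ-separates ε≼γ F≤M G≤M encodes en)
            (J-map {P = _∈ L} {Q = Coded M ε s r n} earlier justified)
            where
            earlier : ∀ {H} → H ∈ L → Coded M ε s r n H
            earlier {H} H∈L = Coded-mono {N = N S ℤ.+ 1ℤ} {G = H} (+1≤ (ℤₚ.<-trans N<k k<n)) (have old H∈L)

      extended : Stage (F ∷ L)
      extended = record
        { N = n ; pN = p ; 0≤N = 0≤n ; s⁻ = u n p ⊝ h ; r⁻ = v k l ⊝ g ; r⁺ = v k l ⊝ h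
        ; s⁻≺ = ⊝-pos-≺ 0<h
        ; r⁻≺r⁺ = ⊝-antimono-≺ h≺g
        ; content = λ <s s< <r r< → record { have = have′ <s s< <r r< ; only = only′ <s s< <r r< } }

    stage : ∀ {L} → Ok L → ¬ ¬ Stage L
    stage [] = return initial
    stage {F ∷ L} ((F≤M , justified) ∷ ok) = stage ok >>= λ S → choose S F >>= λ C →
      return (Extension.extended S C F≤M justified)

-- Cantor's pairing

triangle-mono-≤ : ∀ {m n} → m ℕ.≤ n → triangle m ℕ.≤ triangle n
triangle-mono-≤ z≤n       = z≤n
triangle-mono-≤ (s≤s m≤n) = ℕₚ.+-mono-≤ (s≤s m≤n) (triangle-mono-≤ m≤n)

triangle-gap : ∀ {m n b c} → b ℕ.≤ m → m ℕ.< n → triangle m ℕ.+ b ℕ.< triangle n ℕ.+ c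
triangle-gap {m} {n} {b} {c} b≤m m<n = begin-strict
  triangle m ℕ.+ b     <⟨ ℕₚ.+-monoʳ-< (triangle m) (s≤s b≤m) ⟩
  triangle m ℕ.+ suc m ≡⟨ ℕₚ.+-comm (triangle m) (suc m) ⟩
  triangle (suc m)     ≤⟨ triangle-mono-≤ m<n ⟩
  triangle n           ≤⟨ ℕₚ.m≤m+n (triangle n) c ⟩
  triangle n ℕ.+ c     ∎
  where open ℕₚ.≤-Reasoning

pair-injective : ∀ {a b c d} → pair a b ≡ pair c d → a ≡ c × b ≡ d
pair-injective {a} {b} {c} {d} eq with ℕₚ.<-cmp (a ℕ.+ b) (c ℕ.+ d)
... | tri< lt _ _ = contradiction eq (ℕₚ.<⇒≢ (triangle-gap (ℕₚ.m≤n+m b a) lt))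
... | tri> _ _ gt = contradiction (sym eq) (ℕₚ.<⇒≢ (triangle-gap (ℕₚ.m≤n+m d c) gt))
... | tri≈ _ sum≡ _ =
  ℕₚ.+-cancelʳ-≡ b a c (trans sum≡ (cong (λ n → c ℕ.+ n) (sym b≡d))) , b≡d
  where
  b≡d : b ≡ d
  b≡d = ℕₚ.+-cancelˡ-≡ (triangle (a ℕ.+ b)) b d
    (trans eq (cong (λ s → triangle s ℕ.+ d) (sym sum≡)))

-- Horn clauses with linear arguments

data Lin : Set where
  var : Fin 8 → Lin
  lit : ℕ → Lin
  _⊹_ : Lin → Lin → Lin

infixl 6 _⊹_

Env : Set
Env = Fin 8 → ℕ

⟦_⟧ᴸ : Lin → Env → ℕ
⟦ var i ⟧ᴸ z = z i
⟦ lit n ⟧ᴸ z = n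
⟦ s ⊹ t ⟧ᴸ z = ⟦ s ⟧ᴸ z ℕ.+ ⟦ t ⟧ᴸ z

record Atom : Set where
  constructor atom
  field
    tag     : ℕ
    arg res : Lin

open Atom

infix 4 _⟸_

record Rule : Set where
  constructor _⟸_
  field
    conclusion : Atom
    premises   : List Atom

open Rule

-- Only the first five premises count; shorter lists are padded with the axiom (0, 0, 0).
premise : ∀ {n} → List Atom → Fin n → Atom
premise []       i       = atom 0 (lit 0) (lit 0)
premise (a ∷ as) zero    = a
premise (a ∷ as) (suc i) = premise as i

Relation : Set₁
Relation = ℕ → ℕ → ℕ → Set

Holds : Relation → Env → Atom → Set
Holds M z a = M (tag a) (⟦ arg a ⟧ᴸ z) (⟦ res a ⟧ᴸ z)

Sound : Relation → Rule → Set
Sound M r = ∀ z → (∀ (i : Fin 5) → Holds M z (premise (premises r) i)) → Holds M z (conclusion r)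

data Derivable (rs : List Rule) : Relation where
  axiom : Derivable rs 0 0 0
  infer : ∀ {r} → r ∈ rs → (z : Env) → (∀ (i : Fin 5) → Holds (Derivable rs) z (premise (premises r) i)) →
          Holds (Derivable rs) z (conclusion r)

env : List ℕ → ∀ {n} → Fin n → ℕ
env []       i       = 0
env (x ∷ xs) zero    = x
env (x ∷ xs) (suc i) = env xs i

premises-hold : ∀ {M : Relation} {z as n} → M 0 0 0 → All (Holds M z) as → (i : Fin n) → Holds M z (premise as i)
premises-hold             base []       i       = base
premises-hold             base (p ∷ ps) zero    = p
premises-hold {M} {z = z} base (p ∷ ps) (suc i) = premises-hold {M} {z} base ps i

-- Clauses for partial recursive functions

Path : Set
Path = List Bool

args : ∀ {n} → Vec ℕ n → ℕ
args = codeVec id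

x₀ x₁ x₂ x₃ x₄ x₅ x₆ : Lin
x₀ = var (# 0)
x₁ = var (# 1)
x₂ = var (# 2)
x₃ = var (# 3)
x₄ = var (# 4)
x₅ = var (# 5)
x₆ = var (# 6)

0ᴸ 1ᴸ : Lin
0ᴸ = lit 0
1ᴸ = lit 1

-- Tag 0 is reserved for the graph of `triangle`, the nonlinear ingredient of `pair`.
Δ : Lin → Lin → Atom
Δ = atom 0

-- Every subprogram has its own predicate, addressed by its path in the syntax tree.
Tags : Set
Tags = Path → ℕ

below : Bool → Tags → Tags
below b τ p = τ (b ∷ p)

mutual
  -- A premise `Δ (x₀ ⊹ x₁) x₂` makes x₂ the triangular number of x₀ + x₁. Then `x₂ ⊹ x₁` is the
  -- pair of x₀ and x₁, and adding 1 + (x₀ + x₁) to it gives the pair of the successor of x₀ and x₁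
  -- without another premise.
  rules : ∀ {n} → Rec n → Tags → List Rule
  rules zeroᴿ τ = (atom (τ []) 0ᴸ 0ᴸ ⟸ []) ∷ []
  rules sucᴿ τ = (atom (τ []) (x₁ ⊹ 0ᴸ) (1ᴸ ⊹ x₀) ⟸ Δ (x₀ ⊹ 0ᴸ) x₁ ∷ []) ∷ []
  rules (projᴿ zero) τ = (atom (τ []) (x₂ ⊹ x₁) x₀ ⟸ Δ (x₀ ⊹ x₁) x₂ ∷ []) ∷ []
  rules (projᴿ (suc i)) τ =
    (atom (τ []) (x₂ ⊹ x₁) x₃ ⟸ Δ (x₀ ⊹ x₁) x₂ ∷ atom (τ (false ∷ [])) x₁ x₃ ∷ []) ∷
    rules (projᴿ i) (below false τ)
  rules (compᴿ f gs) τ =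
    (atom (τ []) x₀ x₂ ⟸ atom (τ (true ∷ [])) x₀ x₁ ∷ atom (τ (false ∷ [])) x₁ x₂ ∷ []) ∷
    rules f (below false τ) ++ rules* gs (below true τ)
  rules (precᴿ f g) τ =
    (atom (τ []) (x₂ ⊹ x₀) x₁ ⟸ Δ (0ᴸ ⊹ x₀) x₂ ∷ atom (τ (false ∷ [])) x₀ x₁ ∷ []) ∷
    -- The longest clause: its five premises set the width `Fin 5`, and its seven variables fit into
    -- the eight of `Env`.
    (atom (τ []) (((1ᴸ ⊹ (x₀ ⊹ x₁)) ⊹ x₂) ⊹ x₁) x₆ ⟸
      Δ (x₀ ⊹ x₁) x₂ ∷ atom (τ []) (x₂ ⊹ x₁) x₃ ∷ Δ (x₃ ⊹ x₁) x₄ ∷ Δ (x₀ ⊹ (x₄ ⊹ x₁)) x₅ ∷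
      atom (τ (true ∷ [])) (x₅ ⊹ (x₄ ⊹ x₁)) x₆ ∷ []) ∷
    rules f (below false τ) ++ rules g (below true τ)
  rules (μᴿ f) τ =
    (atom (τ (true ∷ [])) (x₁ ⊹ x₀) 0ᴸ ⟸ Δ (0ᴸ ⊹ x₀) x₁ ∷ []) ∷
    (atom (τ (true ∷ [])) (((1ᴸ ⊹ (x₀ ⊹ x₁)) ⊹ x₂) ⊹ x₁) 0ᴸ ⟸
      Δ (x₀ ⊹ x₁) x₂ ∷ atom (τ (true ∷ [])) (x₂ ⊹ x₁) 0ᴸ ∷ atom (τ (false ∷ [])) (x₂ ⊹ x₁) (1ᴸ ⊹ x₃) ∷ []) ∷
    (atom (τ []) x₁ x₀ ⟸
      Δ (x₀ ⊹ x₁) x₂ ∷ atom (τ (true ∷ [])) (x₂ ⊹ x₁) 0ᴸ ∷ atom (τ (false ∷ [])) (x₂ ⊹ x₁) 0ᴸ ∷ []) ∷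
    rules f (below false τ)

  rules* : ∀ {m n} → Vec (Rec n) m → Tags → List Rule
  rules* [] τ = (atom (τ []) x₀ 0ᴸ ⟸ []) ∷ []
  rules* (g ∷ gs) τ =
    (atom (τ []) x₀ (x₃ ⊹ x₂) ⟸ atom (τ (false ∷ [])) x₀ x₁ ∷ atom (τ (true ∷ [])) x₀ x₂ ∷ Δ (x₁ ⊹ x₂) x₃ ∷ []) ∷
    rules g (below false τ) ++ rules* gs (below true τ)

-- Quantifying over the vectors with code x replaces decoding, and a number that codes no vector
-- satisfies it vacuously.
Computes : ∀ {n} → Rec n → ℕ → ℕ → Set
Computes f x y = ∀ xs → args xs ≡ x → f [ xs ]⇓ y

-- Encodes the positivity condition of μᴿ f below y for the argument pair y (args xs).
PositiveBelow : ∀ {n} → Rec (suc n) → ℕ → ℕ → Set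
PositiveBelow f x _ = ∀ y xs → pair y (args xs) ≡ x → ∀ z → z ℕ.< y → ∃[ w ] f [ z ∷ xs ]⇓ suc w

mutual
  Meaning : ∀ {n} → Rec n → Path → ℕ → ℕ → Set
  Meaning f            []          = Computes f
  Meaning (projᴿ (suc i)) (_ ∷ p)  = Meaning (projᴿ i) p
  Meaning (compᴿ f gs) (false ∷ p) = Meaning f p
  Meaning (compᴿ f gs) (true ∷ p)  = Meaning* gs p
  Meaning (precᴿ f g)  (false ∷ p) = Meaning f p
  Meaning (precᴿ f g)  (true ∷ p)  = Meaning g p
  Meaning (μᴿ f)       (false ∷ p) = Meaning f p
  Meaning (μᴿ f)       (true ∷ p)  = PositiveBelow f
  Meaning _            _           = λ _ _ → ⊤

  Meaning* : ∀ {m n} → Vec (Rec n) m → Path → ℕ → ℕ → Set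
  Meaning* gs       []          x y = ∀ xs → args xs ≡ x → ∃[ ys ] (gs [ xs ]⇓* ys × args ys ≡ y)
  Meaning* []       (_ ∷ p)     = λ _ _ → ⊤
  Meaning* (g ∷ gs) (false ∷ p) = Meaning g p
  Meaning* (g ∷ gs) (true ∷ p)  = Meaning* gs p

proj-suc : ∀ {n} {i : Fin n} {x xs y} → projᴿ i [ xs ]⇓ y → projᴿ (suc i) [ x ∷ xs ]⇓ y
proj-suc (proj⇓ i) = proj⇓ (suc i)

module Soundness (M : Relation) (M-Δ : ∀ {x y} → M 0 x y → triangle x ≡ y) where

  Interprets : Tags → (Path → ℕ → ℕ → Set) → Set
  Interprets τ P = ∀ p {x y} → M (τ p) x y ⇔ P p x y

  open Equivalence

  Δ≡ : ∀ x d {t} → M 0 (x ℕ.+ d) t → t ℕ.+ d ≡ pair x d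
  Δ≡ x d m = cong (ℕ._+ d) (sym (M-Δ m))

  Δ-suc≡ : ∀ x d {t} → M 0 (x ℕ.+ d) t → ((1 ℕ.+ (x ℕ.+ d)) ℕ.+ t) ℕ.+ d ≡ pair (suc x) d
  Δ-suc≡ x d m = cong (λ t → ((1 ℕ.+ (x ℕ.+ d)) ℕ.+ t) ℕ.+ d) (sym (M-Δ m))

  uncons : ∀ {n} x d (xs : Vec ℕ (suc n)) → args xs ≡ pair x d → ∃[ ys ] (xs ≡ x ∷ ys × args ys ≡ d)
  uncons x d (y ∷ ys) eq with pair-injective {y} {args ys} {x} {d} eq
  ... | refl , eq′ = ys , refl , eq′

  mutual
    rules-sound : ∀ {n} (f : Rec n) τ → Interprets τ (Meaning f) → All (Sound M) (rules f τ)
    rules-sound zeroᴿ τ i = (λ z ps → from (i []) λ { [] refl → zero⇓ }) ∷ []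
    rules-sound sucᴿ τ i = (λ z ps → from (i []) λ xs eq →
      case uncons (z (# 0)) 0 xs (trans eq (Δ≡ (z (# 0)) 0 (ps (# 0)))) of λ { ([] , refl , _) → suc⇓ }) ∷ []
    rules-sound (projᴿ zero) τ i = (λ z ps → from (i []) λ xs eq →
      case uncons (z (# 0)) (z (# 1)) xs (trans eq (Δ≡ (z (# 0)) (z (# 1)) (ps (# 0)))) of λ { (ys , refl , _) → proj⇓ zero }) ∷ []
    rules-sound (projᴿ (suc j)) τ i = (λ z ps → from (i []) λ xs eq →
      case uncons (z (# 0)) (z (# 1)) xs (trans eq (Δ≡ (z (# 0)) (z (# 1)) (ps (# 0)))) of λ
        { (ys , refl , eq′) → proj-suc (to (i (false ∷ [])) (ps (# 1)) ys eq′) }) ∷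
      rules-sound (projᴿ j) (below false τ) (λ p → i (false ∷ p))
    rules-sound (compᴿ f gs) τ i = (λ z ps → from (i []) λ xs eq →
      let ys , gs⇓ , eq′ = to (i (true ∷ [])) (ps (# 0)) xs eq
      in comp⇓ gs⇓ (to (i (false ∷ [])) (ps (# 1)) ys eq′)) ∷
      Allₚ.++⁺ (rules-sound f (below false τ) (λ p → i (false ∷ p))) (rules*-sound gs (below true τ) (λ p → i (true ∷ p)))
    rules-sound (precᴿ f g) τ i = (λ z ps → from (i []) λ xs eq →
      case uncons 0 (z (# 0)) xs (trans eq (Δ≡ 0 (z (# 0)) (ps (# 0)))) of λ
        { (ys , refl , eq′) → prec⇓₀ (to (i (false ∷ [])) (ps (# 1)) ys eq′) }) ∷
      (λ z ps → from (i []) λ xs eq →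
      case uncons (suc (z (# 0))) (z (# 1)) xs (trans eq (Δ-suc≡ (z (# 0)) (z (# 1)) (ps (# 0)))) of λ
        { (ys , refl , eq′) → prec⇓₁
            (to (i []) (ps (# 1)) (z (# 0) ∷ ys) (trans (cong (pair (z (# 0))) eq′) (sym (Δ≡ (z (# 0)) (z (# 1)) (ps (# 0))))))
            (to (i (true ∷ [])) (ps (# 4)) (z (# 0) ∷ z (# 3) ∷ ys)
              (trans (cong (pair (z (# 0))) (trans (cong (pair (z (# 3))) eq′) (sym (Δ≡ (z (# 3)) (z (# 1)) (ps (# 2))))))
                (sym (Δ≡ (z (# 0)) (z (# 4) ℕ.+ z (# 1)) (ps (# 3)))))) }) ∷
      Allₚ.++⁺ (rules-sound f (below false τ) (λ p → i (false ∷ p))) (rules-sound g (below true τ) (λ p → i (true ∷ p)))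
    rules-sound (μᴿ f) τ i = (λ z ps → from (i (true ∷ [])) λ y xs eq w w<y →
      contradiction (ℕₚ.≤-trans w<y (ℕₚ.≤-reflexive (proj₁
        (pair-injective {y} {args xs} {0} {z (# 0)} (trans eq (Δ≡ 0 (z (# 0)) (ps (# 0)))))))) λ ()) ∷
      (λ z ps → from (i (true ∷ [])) λ y xs eq →
        case pair-injective {y} {args xs} {suc (z (# 0))} {z (# 1)} (trans eq (Δ-suc≡ (z (# 0)) (z (# 1)) (ps (# 0)))) of λ
        { (refl , eq′) w w<y →
          let eq″ = trans (cong (pair (z (# 0))) eq′) (sym (Δ≡ (z (# 0)) (z (# 1)) (ps (# 0)))) in
          case ℕₚ.m≤n⇒m<n∨m≡n (ℕₚ.≤-pred w<y) of λ
          { (inj₁ w<) → to (i (true ∷ [])) (ps (# 1)) (z (# 0)) xs eq″ w w<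
          ; (inj₂ refl) → z (# 3) , to (i (false ∷ [])) (ps (# 2)) (z (# 0) ∷ xs) eq″ } }) ∷
      (λ z ps → from (i []) λ xs eq →
        let eq′ = trans (cong (pair (z (# 0))) eq) (sym (Δ≡ (z (# 0)) (z (# 1)) (ps (# 0)))) in
        μ⇓ (to (i (false ∷ [])) (ps (# 2)) (z (# 0) ∷ xs) eq′) (to (i (true ∷ [])) (ps (# 1)) (z (# 0)) xs eq′)) ∷
      rules-sound f (below false τ) (λ p → i (false ∷ p))

    rules*-sound : ∀ {m n} (gs : Vec (Rec n) m) τ → Interprets τ (Meaning* gs) → All (Sound M) (rules* gs τ)
    rules*-sound [] τ i = (λ z ps → from (i []) λ xs eq → [] , []⇓ , refl) ∷ []
    rules*-sound (g ∷ gs) τ i = (λ z ps → from (i []) λ xs eq →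
      let ys , gs⇓ , eq′ = to (i (true ∷ [])) (ps (# 1)) xs eq in
      z (# 1) ∷ ys , ∷⇓ (to (i (false ∷ [])) (ps (# 0)) xs eq) gs⇓ ,
      trans (cong (pair (z (# 1))) eq′) (sym (Δ≡ (z (# 1)) (z (# 2)) (ps (# 2))))) ∷
      Allₚ.++⁺ (rules-sound g (below false τ) (λ p → i (false ∷ p))) (rules*-sound gs (below true τ) (λ p → i (true ∷ p)))

Δ-step : Rule
Δ-step = Δ (1ᴸ ⊹ x₀) ((1ᴸ ⊹ x₀) ⊹ x₁) ⟸ Δ x₀ x₁ ∷ []

module Completeness (rs : List Rule) (Δ-step∈ : Δ-step ∈ rs) where

  D : Relation
  D = Derivable rs

  apply : ∀ {r} → r ∈ rs → (xs : List ℕ) → All (Holds D (env xs)) (premises r) → Holds D (env xs) (conclusion r)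
  apply r∈ xs ps = infer r∈ (env xs) (premises-hold {D} {env xs} axiom ps)

  D-Δ : ∀ n → D 0 n (triangle n)
  D-Δ zero    = axiom
  D-Δ (suc n) = apply Δ-step∈ (n ∷ triangle n ∷ []) (D-Δ n ∷ [])

  mutual
    complete : ∀ {n} (f : Rec n) τ → (∀ {r} → r ∈ rules f τ → r ∈ rs) → ∀ {xs y} → f [ xs ]⇓ y → D (τ []) (args xs) y
    complete zeroᴿ τ ⊆rs zero⇓ = apply (⊆rs (here refl)) [] []
    complete sucᴿ τ ⊆rs {x ∷ []} suc⇓ = apply (⊆rs (here refl)) (x ∷ triangle (x ℕ.+ 0) ∷ []) (D-Δ (x ℕ.+ 0) ∷ [])
    complete (projᴿ zero) τ ⊆rs {x ∷ xs} (proj⇓ .zero) =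
      apply (⊆rs (here refl)) (x ∷ args xs ∷ triangle (x ℕ.+ args xs) ∷ []) (D-Δ (x ℕ.+ args xs) ∷ [])
    complete (projᴿ (suc i)) τ ⊆rs {x ∷ xs} (proj⇓ .(suc i)) =
      apply (⊆rs (here refl)) (x ∷ args xs ∷ triangle (x ℕ.+ args xs) ∷ Vec.lookup xs i ∷ [])
        (D-Δ (x ℕ.+ args xs) ∷ complete (projᴿ i) (below false τ) (⊆rs ∘ there) {xs} (proj⇓ i) ∷ [])
    complete (compᴿ f gs) τ ⊆rs {xs} {z} (comp⇓ {ys = ys} gs⇓ f⇓) =
      apply (⊆rs (here refl)) (args xs ∷ args ys ∷ z ∷ [])
        (complete* gs (below true τ) (⊆rs ∘ there ∘ ∈ₚ.∈-++⁺ʳ (rules f (below false τ))) gs⇓ ∷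
         complete f (below false τ) (⊆rs ∘ there ∘ ∈ₚ.∈-++⁺ˡ) f⇓ ∷ [])
    complete (precᴿ f g) τ ⊆rs (prec⇓₀ {xs = xs} {y = y} f⇓) =
      apply (⊆rs (here refl)) (args xs ∷ y ∷ triangle (args xs) ∷ [])
        (D-Δ (args xs) ∷ complete f (below false τ) (⊆rs ∘ there ∘ there ∘ ∈ₚ.∈-++⁺ˡ) f⇓ ∷ [])
    complete (precᴿ f g) τ ⊆rs (prec⇓₁ {xs = xs} {k = k} {y = y} {z = z} h⇓ g⇓) =
      apply (⊆rs (there (here refl)))
        (k ∷ c ∷ triangle (k ℕ.+ c) ∷ y ∷ triangle (y ℕ.+ c) ∷ triangle (k ℕ.+ pair y c) ∷ z ∷ [])
        (D-Δ (k ℕ.+ c) ∷ complete (precᴿ f g) τ ⊆rs h⇓ ∷ D-Δ (y ℕ.+ c) ∷ D-Δ (k ℕ.+ pair y c) ∷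
         complete g (below true τ) (⊆rs ∘ there ∘ there ∘ ∈ₚ.∈-++⁺ʳ (rules f (below false τ))) g⇓ ∷ [])
      where
      c = args xs
    complete (μᴿ f) τ ⊆rs (μ⇓ {xs = xs} {y = y} f⇓ below-y) =
      apply (⊆rs (there (there (here refl)))) (y ∷ c ∷ triangle (y ℕ.+ c) ∷ [])
        (D-Δ (y ℕ.+ c) ∷ positive y below-y ∷
         complete f (below false τ) (⊆rs ∘ there ∘ there ∘ there) f⇓ ∷ [])
      where
      c = args xs
      positive : ∀ y → (∀ z → z ℕ.< y → ∃[ w ] f [ z ∷ xs ]⇓ suc w) → D (τ (true ∷ [])) (pair y c) 0
      positive zero    h = apply (⊆rs (here refl)) (c ∷ triangle c ∷ []) (D-Δ c ∷ [])
      positive (suc y) h =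
        let w , f⇓ = h y ℕₚ.≤-refl in
        apply (⊆rs (there (here refl))) (y ∷ c ∷ triangle (y ℕ.+ c) ∷ w ∷ [])
          (D-Δ (y ℕ.+ c) ∷ positive y (λ z z<y → h z (ℕₚ.m<n⇒m<1+n z<y)) ∷
           complete f (below false τ) (⊆rs ∘ there ∘ there ∘ there) f⇓ ∷ [])

    complete* : ∀ {m n} (gs : Vec (Rec n) m) τ → (∀ {r} → r ∈ rules* gs τ → r ∈ rs) → ∀ {xs ys} → gs [ xs ]⇓* ys →
      D (τ []) (args xs) (args ys)
    complete* [] τ ⊆rs {xs} []⇓ = apply (⊆rs (here refl)) (args xs ∷ []) []
    complete* (g ∷ gs) τ ⊆rs {xs} {y ∷ ys} (∷⇓ g⇓ gs⇓) =
      apply (⊆rs (here refl)) (args xs ∷ y ∷ args ys ∷ triangle (y ℕ.+ args ys) ∷ [])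
        (complete g (below false τ) (⊆rs ∘ there ∘ ∈ₚ.∈-++⁺ˡ) g⇓ ∷
         complete* gs (below true τ) (⊆rs ∘ there ∘ ∈ₚ.∈-++⁺ʳ (rules g (below false τ))) gs⇓ ∷
         D-Δ (y ℕ.+ args ys) ∷ [])

-- Clauses for a unary program

number : Path → ℕ
number []          = 0
number (false ∷ p) = suc (pair 0 (number p))
number (true ∷ p)  = suc (pair 1 (number p))

number-injective : ∀ p q → number p ≡ number q → p ≡ q
number-injective []          []          eq = refl
number-injective []          (false ∷ q) ()
number-injective []          (true ∷ q)  ()
number-injective (false ∷ p) []          ()
number-injective (true ∷ p)  []          ()
number-injective (false ∷ p) (false ∷ q) eq =
  cong (false ∷_) (number-injective p q (proj₂ (pair-injective {0} {_} {0} (ℕₚ.suc-injective eq))))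
number-injective (true ∷ p)  (true ∷ q)  eq =
  cong (true ∷_) (number-injective p q (proj₂ (pair-injective {1} {_} {1} (ℕₚ.suc-injective eq))))
number-injective (false ∷ p) (true ∷ q)  eq with pair-injective {0} {number p} {1} {number q} (ℕₚ.suc-injective eq)
... | () , _
number-injective (true ∷ p)  (false ∷ q) eq with pair-injective {1} {number p} {0} {number q} (ℕₚ.suc-injective eq)
... | () , _

module Program (P : Rec 1) where

  -- The shift by two leaves tag 0 to `Δ` and tag 1 to `unary`.
  tags : Tags
  tags p = suc (suc (number p))

  -- The argument vector x ∷ [] has code triangle x, so that tag 1 relates x itself to the value.
  unary : Rule
  unary = atom 1 x₀ x₂ ⟸ Δ (x₀ ⊹ 0ᴸ) x₁ ∷ atom (tags []) (x₁ ⊹ 0ᴸ) x₂ ∷ []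

  clauses : List Rule
  clauses = Δ-step ∷ unary ∷ rules P tags

  data Model : Relation where
    modelΔ : ∀ {x} → Model 0 x (triangle x)
    model₁ : ∀ {x y} → P [ x ∷ [] ]⇓ y → Model 1 x y
    modelₚ : ∀ {t x y} p → tags p ≡ t → Meaning P p x y → Model t x y

  Model-Δ : ∀ {x y} → Model 0 x y → triangle x ≡ y
  Model-Δ modelΔ = refl

  open Soundness Model Model-Δ

  interprets : Interprets tags (Meaning P)
  interprets p = mk⇔ from-model (modelₚ p refl)
    where
    from-model : ∀ {x y} → Model (tags p) x y → Meaning P p x y
    from-model {x} {y} (modelₚ q eq m) =
      subst (λ q → Meaning P q x y) (number-injective q p (ℕₚ.suc-injective (ℕₚ.suc-injective eq))) m

  clauses-sound : All (Sound Model) clauses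
  clauses-sound =
    (λ z ps → subst (Model 0 (suc (z (# 0)))) (cong (λ t → suc (z (# 0)) ℕ.+ t) (Model-Δ (ps (# 0)))) modelΔ) ∷
    (λ z ps → model₁ (Equivalence.to (interprets []) (ps (# 1)) (z (# 0) ∷ []) (sym (Δ≡ (z (# 0)) 0 (ps (# 0)))))) ∷
    rules-sound P tags interprets

  clauses-complete : ∀ {x y} → P [ x ∷ [] ]⇓ y → Derivable clauses 1 x y
  clauses-complete {x} {y} P⇓ = apply (there (here refl)) (x ∷ triangle (x ℕ.+ 0) ∷ y ∷ [])
    (D-Δ (x ℕ.+ 0) ∷ complete P tags (there ∘ there) P⇓ ∷ [])
    where open Completeness clauses (here refl)

-- Tagged facts as pairs

ruleTags : Rule → ℕ
ruleTags r = tag (conclusion r) ℕ.+ sum (List.map tag (premises r))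

∈⇒≤sum : ∀ {A : Set} (f : A → ℕ) {x xs} → x ∈ xs → f x ℕ.≤ sum (List.map f xs)
∈⇒≤sum f (here refl) = ℕₚ.m≤m+n _ _
∈⇒≤sum f (there x∈)  = ℕₚ.≤-trans (∈⇒≤sum f x∈) (ℕₚ.m≤n+m _ _)

premise-tag≤ : ∀ {n} as (i : Fin n) → tag (premise as i) ℕ.≤ sum (List.map tag as)
premise-tag≤ []       i       = z≤n
premise-tag≤ (a ∷ as) zero    = ℕₚ.m≤m+n _ _
premise-tag≤ (a ∷ as) (suc i) = ℕₚ.≤-trans (premise-tag≤ as i) (ℕₚ.m≤n+m _ _)

scale-< : ∀ {Q x x′ t} t′ → t ℕ.< Q → x ℕ.< x′ → Q ℕ.* x ℕ.+ t ℕ.< Q ℕ.* x′ ℕ.+ t′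
scale-< {Q} {x} {x′} {t} t′ t<Q x<x′ = begin-strict
  Q ℕ.* x ℕ.+ t     <⟨ ℕₚ.+-monoʳ-< (Q ℕ.* x) t<Q ⟩
  Q ℕ.* x ℕ.+ Q     ≡⟨ ℕₚ.+-comm (Q ℕ.* x) Q ⟩
  Q ℕ.+ Q ℕ.* x     ≡⟨ ℕₚ.*-suc Q x ⟨
  Q ℕ.* suc x       ≤⟨ ℕₚ.*-monoʳ-≤ Q x<x′ ⟩
  Q ℕ.* x′          ≤⟨ ℕₚ.m≤m+n _ t′ ⟩
  Q ℕ.* x′ ℕ.+ t′   ∎
  where open ℕₚ.≤-Reasoning

module Facts (rs : List Rule) where

  -- Larger than every tag that occurs, so a tag can be kept as a remainder modulo `Q`. Since `Q` is
  -- a constant, Q x + t stays linear in x.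
  Q : ℕ
  Q = suc (sum (List.map ruleTags rs))

  conclusion-tag< : ∀ {r} → r ∈ rs → tag (conclusion r) ℕ.< Q
  conclusion-tag< r∈ = s≤s (ℕₚ.≤-trans (ℕₚ.m≤m+n _ _) (∈⇒≤sum ruleTags r∈))

  premise-tag< : ∀ {r} → r ∈ rs → (i : Fin 5) → tag (premise (premises r) i) ℕ.< Q
  premise-tag< {r} r∈ i = s≤s (ℕₚ.≤-trans (premise-tag≤ (premises r) i)
    (ℕₚ.≤-trans (ℕₚ.m≤n+m _ (tag (conclusion r))) (∈⇒≤sum ruleTags r∈)))

  fact : ℕ → ℕ → ℕ → Fact
  fact t x y = Q ℕ.* x ℕ.+ t , y

  fact-of : Env → Atom → Fact
  fact-of z a = fact (tag a) (⟦ arg a ⟧ᴸ z) (⟦ res a ⟧ᴸ z)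

  fact-injective : ∀ {t x t′ x′} → t ℕ.< Q → t′ ℕ.< Q → Q ℕ.* x ℕ.+ t ≡ Q ℕ.* x′ ℕ.+ t′ → t ≡ t′ × x ≡ x′
  fact-injective {t} {x} {t′} {x′} t<Q t′<Q eq with ℕₚ.<-cmp x x′
  ... | tri≈ _ refl _ = ℕₚ.+-cancelˡ-≡ (Q ℕ.* x) t t′ eq , refl
  ... | tri< x<x′ _ _ = contradiction eq (ℕₚ.<⇒≢ (scale-< t′ t<Q x<x′))
  ... | tri> _ _ x>x′ = contradiction (sym eq) (ℕₚ.<⇒≢ (scale-< t t′<Q x>x′))

  base : Fact
  base = 0 , 0

  Justified : Fact → (Fact → Set) → Set
  Justified F Known = F ≡ base ⊎ ∃[ r ] (r ∈ rs × ∃[ z ] (F ≡ fact-of z (conclusion r) ×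
    (∀ (i : Fin 5) → Known (fact-of z (premise (premises r) i)))))

  Justified-map : ∀ {F} {P R : Fact → Set} → (∀ {G} → P G → R G) → Justified F P → Justified F R
  Justified-map f (inj₁ eq) = inj₁ eq
  Justified-map f (inj₂ (r , r∈ , z , eq , ps)) = inj₂ (r , r∈ , z , eq , λ i → f (ps i))

  data Chain : List Fact → Set where
    []  : Chain []
    _∷_ : ∀ {F L} → Justified F (_∈ L) → Chain L → Chain (F ∷ L)

  Extends : List Fact → Fact → Set
  Extends L F = ∃[ L′ ] (Chain L′ × F ∈ L′ × (∀ {G} → G ∈ L → G ∈ L′))

  extend-all : ∀ {n} (Fs : Fin n → Fact) → (∀ i {L} → Chain L → Extends L (Fs i)) → ∀ {L} → Chain L →
    ∃[ L′ ] (Chain L′ × (∀ i → Fs i ∈ L′) × (∀ {G} → G ∈ L → G ∈ L′))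
  extend-all {zero}  Fs steps c = _ , c , (λ ()) , id
  extend-all {suc n} Fs steps c =
    let L₁ , c₁ , ∈L₁ , L⊆L₁ = steps zero c
        L₂ , c₂ , ∈L₂ , L₁⊆L₂ = extend-all (Fs ∘ suc) (steps ∘ suc) c₁
    in L₂ , c₂ , (λ { zero → L₁⊆L₂ ∈L₁ ; (suc i) → ∈L₂ i }) , L₁⊆L₂ ∘ L⊆L₁

  -- A derivation tree is flattened by prolonging a given chain, so that the chains for several
  -- premises can be built one upon the other.
  chain : ∀ {t x y} → Derivable rs t x y → ∀ {L} → Chain L → Extends L (fact t x y)
  chain axiom {L} c = base ∷ L , inj₁ refl ∷ c , here (cong (_, 0) (trans (ℕₚ.+-identityʳ _) (ℕₚ.*-zeroʳ Q))) , there
  chain (infer {r} r∈ z ps) c =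
    let L′ , c′ , ∈L′ , L⊆L′ = extend-all (λ i → fact-of z (premise (premises r) i)) (λ i → chain (ps i)) c
    in _ , inj₂ (r , r∈ , z , refl , ∈L′) ∷ c′ , here refl , there ∘ L⊆L′

  module Truth (M : Relation) (M-base : M 0 0 0) (sound : All (Sound M) rs) where

    -- At most one decomposition of X has t < Q, so the universal form acts as division with
    -- remainder.
    True-fact : Fact → Set
    True-fact (X , Y) = ∀ t x → t ℕ.< Q → X ≡ Q ℕ.* x ℕ.+ t → M t x Y

    justified⇒true : ∀ {F} → Justified F True-fact → True-fact F
    justified⇒true (inj₁ refl) t x t<Q eq with fact-injective {0} {0} {t} {x} ℕ.z<s t<Q
      (trans (trans (ℕₚ.+-identityʳ _) (ℕₚ.*-zeroʳ Q)) eq)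
    ... | refl , refl = M-base
    justified⇒true (inj₂ (r , r∈ , z , refl , ps)) t x t<Q eq =
      let t≡ , x≡ = fact-injective {tag (conclusion r)} {⟦ arg (conclusion r) ⟧ᴸ z} {t} {x} (conclusion-tag< r∈) t<Q eq
      in subst₂ (λ t x → M t x (⟦ res (conclusion r) ⟧ᴸ z)) t≡ x≡
           (All.lookup sound r∈ z λ i → ps i _ _ (premise-tag< r∈ i) refl)

open Equivalence

-- Formulas with named variables

infixl 6 _∔_
infix 8 ∸_

data ZT (V : Set) : Set where
  `_   : V → ZT V
  κ_   : ℤ → ZT V
  _∔_  : ZT V → ZT V → ZT V
  ∸_   : ZT V → ZT V
  _·_  : ℤ → ZT V → ZT V

⟦_⟧ᶻ : ∀ {V} → ZT V → (V → ℤ) → ℤ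
⟦ ` v ⟧ᶻ   ρ = ρ v
⟦ κ c ⟧ᶻ   ρ = c
⟦ s ∔ t ⟧ᶻ ρ = ⟦ s ⟧ᶻ ρ ℤ.+ ⟦ t ⟧ᶻ ρ
⟦ ∸ t ⟧ᶻ   ρ = ℤ.- ⟦ t ⟧ᶻ ρ
⟦ c · t ⟧ᶻ ρ = c ℤ.* ⟦ t ⟧ᶻ ρ

-- Linear terms x + yα + zα²
record LT (V : Set) : Set where
  constructor ⟨_,_,_⟩
  field
    part₀ part₁ part₂ : ZT V

infix 5 _≺ᶠ_ _<ᶠ_

data Frm (V : Set) : Set where
  _≺ᶠ_ : LT V → LT V → Frm V
  _<ᶠ_ : ZT V → ZT V → Frm V
  notᶠ : Frm V → Frm V
  andᶠ : Frm V → Frm V → Frm V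
  orᶠ  : Frm V → Frm V → Frm V

_⊝ᴸ_ : ∀ {V} → LT V → LT V → LT V
⟨ x , y , z ⟩ ⊝ᴸ ⟨ x′ , y′ , z′ ⟩ = ⟨ x ∔ ∸ x′ , y ∔ ∸ y′ , z ∔ ∸ z′ ⟩

Dot : ∀ {n} → (Fin n → ℤ) → Vec ℤ n → ℤ
Dot c []       = 0ℤ
Dot c (x ∷ xs) = c zero ℤ.* x ℤ.+ Dot (c ∘ suc) xs

δ : ∀ {n} → Fin n → Fin n → ℤ
δ zero    zero    = 1ℤ
δ zero    (suc j) = 0ℤ
δ (suc i) zero    = 0ℤ
δ (suc i) (suc j) = δ i j

module _ {V : Set} {n} (θ : V → Fin n) where

  coefficient : ZT V → Fin n → ℤ
  coefficient (` v)   i = δ (θ v) i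
  coefficient (κ c)   i = 0ℤ
  coefficient (s ∔ t) i = coefficient s i ℤ.+ coefficient t i
  coefficient (∸ t)   i = ℤ.- coefficient t i
  coefficient (c · t) i = c ℤ.* coefficient t i

  constant : ZT V → ℤ
  constant (` v)   = 0ℤ
  constant (κ c)   = c
  constant (s ∔ t) = constant s ℤ.+ constant t
  constant (∸ t)   = ℤ.- constant t
  constant (c · t) = c ℤ.* constant t

Dot-0 : ∀ {n} (x : Vec ℤ n) → Dot (λ _ → 0ℤ) x ≡ 0ℤ
Dot-0 []       = refl
Dot-0 (x ∷ xs) = trans (cong (λ k → 0ℤ ℤ.* x ℤ.+ k) (Dot-0 xs)) (trans (ℤₚ.+-identityʳ _) (ℤₚ.*-zeroˡ x))

Dot-+ : ∀ {n} c d (x : Vec ℤ n) → Dot (λ i → c i ℤ.+ d i) x ≡ Dot c x ℤ.+ Dot d x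
Dot-+ c d []       = refl
Dot-+ c d (x ∷ xs) = trans (cong (λ k → (c zero ℤ.+ d zero) ℤ.* x ℤ.+ k) (Dot-+ (c ∘ suc) (d ∘ suc) xs))
  (identity (c zero) (d zero) x (Dot (c ∘ suc) xs) (Dot (d ∘ suc) xs))
  where
  identity : ∀ c d x e f → (c ℤ.+ d) ℤ.* x ℤ.+ (e ℤ.+ f) ≡ (c ℤ.* x ℤ.+ e) ℤ.+ (d ℤ.* x ℤ.+ f)
  identity = ℤ-Tactic.solve-∀

Dot-neg : ∀ {n} c (x : Vec ℤ n) → Dot (λ i → ℤ.- c i) x ≡ ℤ.- Dot c x
Dot-neg c []       = refl
Dot-neg c (x ∷ xs) = trans (cong (λ k → (ℤ.- c zero) ℤ.* x ℤ.+ k) (Dot-neg (c ∘ suc) xs))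
  (identity (c zero) x (Dot (c ∘ suc) xs))
  where
  identity : ∀ c x e → (ℤ.- c) ℤ.* x ℤ.+ ℤ.- e ≡ ℤ.- (c ℤ.* x ℤ.+ e)
  identity = ℤ-Tactic.solve-∀

Dot-* : ∀ {n} k c (x : Vec ℤ n) → Dot (λ i → k ℤ.* c i) x ≡ k ℤ.* Dot c x
Dot-* k c []       = sym (ℤₚ.*-zeroʳ k)
Dot-* k c (x ∷ xs) = trans (cong (λ e → (k ℤ.* c zero) ℤ.* x ℤ.+ e) (Dot-* k (c ∘ suc) xs))
  (identity k (c zero) x (Dot (c ∘ suc) xs))
  where
  identity : ∀ k c x e → (k ℤ.* c) ℤ.* x ℤ.+ k ℤ.* e ≡ k ℤ.* (c ℤ.* x ℤ.+ e)
  identity = ℤ-Tactic.solve-∀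

Dot-δ : ∀ {n} (i : Fin n) x → Dot (δ i) x ≡ lookup x i
Dot-δ zero    (x ∷ xs) = trans (cong (λ k → 1ℤ ℤ.* x ℤ.+ k) (Dot-0 xs))
  (trans (ℤₚ.+-identityʳ _) (ℤₚ.*-identityˡ x))
Dot-δ (suc i) (x ∷ xs) = trans (cong (λ k → 0ℤ ℤ.* x ℤ.+ k) (Dot-δ i xs))
  (trans (cong (ℤ._+ lookup xs i) (ℤₚ.*-zeroˡ x)) (ℤₚ.+-identityˡ _))

module _ {V : Set} {n} (θ : V → Fin n) (x : Vec ℤ n) {ρ : V → ℤ} (agrees : ∀ v → lookup x (θ v) ≡ ρ v) where

  ZT-correct : ∀ t → Dot (coefficient θ t) x ℤ.+ constant θ t ≡ ⟦ t ⟧ᶻ ρ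
  ZT-correct (` v)   = trans (ℤₚ.+-identityʳ _) (trans (Dot-δ (θ v) x) (agrees v))
  ZT-correct (κ c)   = trans (cong (ℤ._+ c) (Dot-0 x)) (ℤₚ.+-identityˡ c)
  ZT-correct (s ∔ t) = trans (cong (ℤ._+ (constant θ s ℤ.+ constant θ t)) (Dot-+ (coefficient θ s) (coefficient θ t) x))
    (trans (identity (Dot (coefficient θ s) x) (Dot (coefficient θ t) x) (constant θ s) (constant θ t))
      (cong₂ ℤ._+_ (ZT-correct s) (ZT-correct t)))
    where
    identity : ∀ a b c d → (a ℤ.+ b) ℤ.+ (c ℤ.+ d) ≡ (a ℤ.+ c) ℤ.+ (b ℤ.+ d)
    identity = ℤ-Tactic.solve-∀
  ZT-correct (∸ t)   = trans (cong (ℤ._+ (ℤ.- constant θ t)) (Dot-neg (coefficient θ t) x))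
    (trans (sym (ℤₚ.neg-distrib-+ (Dot (coefficient θ t) x) (constant θ t))) (cong ℤ.-_ (ZT-correct t)))
  ZT-correct (c · t) = trans (cong (ℤ._+ (c ℤ.* constant θ t)) (Dot-* c (coefficient θ t) x))
    (trans (sym (ℤₚ.*-distribˡ-+ c (Dot (coefficient θ t) x) (constant θ t))) (cong (λ k → c ℤ.* k) (ZT-correct t)))

-- The element x + yα + zα² of ℤ[α]; meaningful when the degree is at least 3.
embed : ∀ d → ℤ → ℤ → ℤ → Vec ℤ d
embed (suc (suc (suc d))) x y z = x ∷ y ∷ z ∷ replicate d 0ℤ
embed d                   x y z = replicate d 0ℤ

embed-value : ∀ {d} → 3 ℕ.≤ d → ∀ x y z a → ⟪ embed d x y z ⟫ a ≐ form a (a ⊗ a) x y z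
embed-value {suc (suc (suc d))} (s≤s (s≤s (s≤s z≤n))) x y z a = ⟪⟫-triple x y z d a

abstract

  Linear : ∀ α {n} → Vec ℤ[ α ] n → Vec ℤ n → ℝ
  Linear α as x = linear {α} as x

  Linear≐linear : ∀ α {n} (as : Vec ℤ[ α ] n) x → Linear α as x ≐ linear {α} as x
  Linear≐linear α as x = ≐-refl

  Linear-[] : ∀ α → Linear α [] [] ≐ ι 0ℤ
  Linear-[] α = ≐-sym (ι≐ 0ℤ)

  Linear-∷ : ∀ α {n} c (cs : Vec ℤ[ α ] n) x xs →
    Linear α (c ∷ cs) (x ∷ xs) ≐ ⟪ c ⟫ (value α) ⊗ ι x ⊕ Linear α cs xs
  Linear-∷ α c cs x xs = pointwise λ n → sym (trans (at (⊕≐+ (⟪ c ⟫ (value α) ⊗ ι x) (linear {α} cs xs)) n)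
    (cong (λ p → p ℚ.+ seq (linear {α} cs xs) n) (trans (at (⊗≐* (⟪ c ⟫ (value α)) (ι x)) n)
      (cong₂ ℚ._*_ (at (⟪⟫≐eval c (value α)) n) (at (ι≐ x) n)))))

≺⇔< : ∀ {x y} → x ≺ y ⇔ (¬ ¬ (x < y))
≺⇔< = mk⇔ (λ p → classical (gap p) >>= λ p → return (Pos⁺⇒< p))
          (λ p → diff (pos (p >>= λ p → return (<⇒Pos⁺ p))))

module Semantics (α : RealAlgebraic) (3≤d : 3 ℕ.≤ degree α) where

  a b : ℝ
  a = value α
  b = a ⊗ a

  value-of : ∀ {V} → LT V → (V → ℤ) → ℝ
  value-of ⟨ x , y , z ⟩ ρ = form a b (⟦ x ⟧ᶻ ρ) (⟦ y ⟧ᶻ ρ) (⟦ z ⟧ᶻ ρ)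

  ⟦_⟧ᶠ : ∀ {V} → Frm V → (V → ℤ) → Set
  ⟦ s ≺ᶠ t ⟧ᶠ   ρ = value-of s ρ ≺ value-of t ρ
  ⟦ s <ᶠ t ⟧ᶠ   ρ = ⟦ s ⟧ᶻ ρ ℤ.< ⟦ t ⟧ᶻ ρ
  ⟦ notᶠ φ ⟧ᶠ   ρ = ¬ ⟦ φ ⟧ᶠ ρ
  ⟦ andᶠ φ ψ ⟧ᶠ ρ = ⟦ φ ⟧ᶠ ρ × ⟦ ψ ⟧ᶠ ρ
  ⟦ orᶠ φ ψ ⟧ᶠ  ρ = ¬ (¬ ⟦ φ ⟧ᶠ ρ × ¬ ⟦ ψ ⟧ᶠ ρ)

  module _ {V : Set} {n} (θ : V → Fin n) where

    coefficients : LT V → Vec ℤ[ α ] n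
    coefficients ⟨ x , y , z ⟩ = tabulate λ i →
      embed (degree α) (coefficient θ x i) (coefficient θ y i) (coefficient θ z i)

    minus-constant : LT V → ℤ[ α ]
    minus-constant ⟨ x , y , z ⟩ =
      embed (degree α) (ℤ.- constant θ x) (ℤ.- constant θ y) (ℤ.- constant θ z)

    -- Atoms are nonstrict, so positivity of a term is the negation of "linear part ≤ minus the
    -- constant".
    positive : LT V → Formula α n
    positive t = ¬ᶠ (coefficients t ≤ᵃ minus-constant t)

    compile : Frm V → Formula α n
    compile (s ≺ᶠ t)   = positive (t ⊝ᴸ s)
    compile (s <ᶠ t)   = positive ⟨ t ∔ ∸ s , κ 0ℤ , κ 0ℤ ⟩
    compile (notᶠ φ)   = ¬ᶠ compile φ
    compile (andᶠ φ ψ) = compile φ ∧ᶠ compile ψ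
    compile (orᶠ φ ψ)  = compile φ ∨ᶠ compile ψ

  Linear-tabulate : ∀ {n} (f g h : Fin n → ℤ) x →
    Linear α (tabulate λ i → embed (degree α) (f i) (g i) (h i)) x ≐ form a b (Dot f x) (Dot g x) (Dot h x)
  Linear-tabulate f g h []       = ≐-trans (Linear-[] α)
    (solve 2 (λ a b → con 0ℤ := con 0ℤ :+ con 0ℤ :* a :+ con 0ℤ :* b) ≐-refl a b)
  Linear-tabulate f g h (x ∷ xs) = ≐-trans (Linear-∷ α _ _ x xs) (≐-trans
    (⊕-cong (⊗-cong (embed-value 3≤d (f zero) (g zero) (h zero) a) ≐-refl)
      (Linear-tabulate (f ∘ suc) (g ∘ suc) (h ∘ suc) xs))
    (≐-trans
      (solve 9 (λ a b x f g h f′ g′ h′ → (f :+ g :* a :+ h :* b) :* x :+ (f′ :+ g′ :* a :+ h′ :* b) :=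
        (f :* x :+ f′) :+ (g :* x :+ g′) :* a :+ (h :* x :+ h′) :* b) ≐-refl
        a b (ι x) (ι (f zero)) (ι (g zero)) (ι (h zero)) (ι (Dot (f ∘ suc) xs)) (ι (Dot (g ∘ suc) xs)) (ι (Dot (h ∘ suc) xs)))
      (⊕-cong (⊕-cong (fold f) (⊗-cong (fold g) ≐-refl)) (⊗-cong (fold h) ≐-refl))))
    where
    fold : ∀ f → ι (f zero) ⊗ ι x ⊕ ι (Dot (f ∘ suc) xs) ≐ ι (Dot f (x ∷ xs))
    fold f = ≐-sym (≐-trans (ι-+ _ _) (⊕-cong (ι-* (f zero) x) ≐-refl))

  form-constant : ∀ i → form a b i 0ℤ 0ℤ ≐ ι i
  form-constant i = solve 3 (λ a b i → i :+ con 0ℤ :* a :+ con 0ℤ :* b := i) ≐-refl a b (ι i)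

  module _ {V : Set} {n} (θ : V → Fin n) (x : Vec ℤ n) {ρ : V → ℤ} (agrees : ∀ v → lookup x (θ v) ≡ ρ v) where

    positive-correct : ∀ t → (x ⊨ positive θ t) ⇔ (ι 0ℤ ≺ value-of t ρ)
    positive-correct t@(⟨ t₀ , t₁ , t₂ ⟩) = mk⇔
      (λ p → ≺-shift shift (≺-resp constant≐ linear≐ (from ≺⇔< p)))
      (λ p → to ≺⇔< (≺-resp (≐-sym constant≐) (≐-sym linear≐) (≺-shift (≐-sym shift) p)))
      where
      D = λ t → Dot (coefficient θ t) x
      constant≐ : ⟦_⟧ {α} (minus-constant θ t) ≐ form a b (ℤ.- constant θ t₀) (ℤ.- constant θ t₁) (ℤ.- constant θ t₂)
      constant≐ = ≐-trans (≐-sym (⟪⟫≐eval (minus-constant θ t) a)) (embed-value 3≤d _ _ _ a)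
      linear≐ : linear {α} (coefficients θ t) x ≐ form a b (D t₀) (D t₁) (D t₂)
      linear≐ = ≐-trans (≐-sym (Linear≐linear α (coefficients θ t) x))
        (Linear-tabulate (coefficient θ t₀) (coefficient θ t₁) (coefficient θ t₂) x)
      shift : form a b (D t₀) (D t₁) (D t₂) ⊝ form a b (ℤ.- constant θ t₀) (ℤ.- constant θ t₁) (ℤ.- constant θ t₂) ≐
              value-of t ρ ⊝ ι 0ℤ
      shift = ≐-trans (≐-sym (form-⊝ a b (D t₀) (D t₁) (D t₂) _ _ _)) (≐-trans
        (⊕-cong (⊕-cong (part t₀) (⊗-cong (part t₁) ≐-refl)) (⊗-cong (part t₂) ≐-refl))
        (solve 1 (λ e → e := e :- con 0ℤ) ≐-refl (value-of t ρ)))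
        where
        part : ∀ t → ι (D t ℤ.- (ℤ.- constant θ t)) ≐ ι (⟦ t ⟧ᶻ ρ)
        part t = ≡⇒≐ (cong ι (trans (cong (λ k → D t ℤ.+ k) (ℤₚ.neg-involutive (constant θ t))) (ZT-correct θ x agrees t)))

    correct : ∀ φ → (x ⊨ compile θ φ) ⇔ ⟦ φ ⟧ᶠ ρ
    correct (⟨ s₀ , s₁ , s₂ ⟩ ≺ᶠ ⟨ t₀ , t₁ , t₂ ⟩) =
      mk⇔ (λ p → ≺-shift e (to (positive-correct t-s) p)) (λ p → from (positive-correct t-s) (≺-shift (≐-sym e) p))
      where
      t-s = ⟨ t₀ , t₁ , t₂ ⟩ ⊝ᴸ ⟨ s₀ , s₁ , s₂ ⟩
      e : value-of t-s ρ ⊝ ι 0ℤ ≐ value-of ⟨ t₀ , t₁ , t₂ ⟩ ρ ⊝ value-of ⟨ s₀ , s₁ , s₂ ⟩ ρ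
      e = ≐-trans (solve 1 (λ e → e :- con 0ℤ := e) ≐-refl (value-of t-s ρ)) (form-⊝ a b _ _ _ _ _ _)
    correct (s <ᶠ t) = mk⇔
      (λ p → ι-cancel-≺ (≺-shift e (to (positive-correct t-s) p)))
      (λ p → from (positive-correct t-s) (≺-shift (≐-sym e) (ι-mono-≺ p)))
      where
      t-s = ⟨ t ∔ ∸ s , κ 0ℤ , κ 0ℤ ⟩
      e : value-of t-s ρ ⊝ ι 0ℤ ≐ ι (⟦ t ⟧ᶻ ρ) ⊝ ι (⟦ s ⟧ᶻ ρ)
      e = ≐-trans (solve 1 (λ e → e :- con 0ℤ := e) ≐-refl (value-of t-s ρ))
        (≐-trans (form-constant _) (ι-sub (⟦ t ⟧ᶻ ρ) (⟦ s ⟧ᶻ ρ)))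
    correct (notᶠ φ) = mk⇔ (λ p q → p (from (correct φ) q)) (λ p q → p (to (correct φ) q))
    correct (andᶠ φ ψ) = mk⇔ (λ (p , q) → to (correct φ) p , to (correct ψ) q)
                             (λ (p , q) → from (correct φ) p , from (correct ψ) q)
    correct (orᶠ φ ψ) = mk⇔
      (λ h (p , q) → h ((λ p′ → p (to (correct φ) p′)) , (λ q′ → q (to (correct ψ) q′))))
      (λ h (p , q) → h ((λ p′ → p (from (correct φ) p′)) , (λ q′ → q (from (correct ψ) q′))))

  -- Every connective is read classically, which lets a matrix be pulled out of a double negation.
  ⟦⟧ᶠ-stable : ∀ {V} (φ : Frm V) ρ → ¬ ¬ ⟦ φ ⟧ᶠ ρ → ⟦ φ ⟧ᶠ ρ
  ⟦⟧ᶠ-stable (s ≺ᶠ t)   ρ h = ≺-stable h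
  ⟦⟧ᶠ-stable (s <ᶠ t)   ρ h = decidable-stable (_ ℤ.<? _) h
  ⟦⟧ᶠ-stable (notᶠ φ)   ρ h = stable¬ h
  ⟦⟧ᶠ-stable (andᶠ φ ψ) ρ h =
    ⟦⟧ᶠ-stable φ ρ (λ k → h (k ∘ proj₁)) , ⟦⟧ᶠ-stable ψ ρ (λ k → h (k ∘ proj₂))
  ⟦⟧ᶠ-stable (orᶠ φ ψ)  ρ h = stable¬ h

-- Blocks of variables, each arranged as rows of eight

data Block : Set where
  b₁ b₂ b₃ b₄ : Block

Var : Set
Var = Block × Fin 8 × Fin 8

Row : Set → Set
Row A = Fin 8 → A

Rows : Set
Rows = Fin 8 → Row ℤ

row : Block → Fin 8 → Row Var
row B i j = B , i , j

module Blocks (k : ℕ) where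

  -- The 8 by 8 grid takes 64 coordinates, and k pads each block to the required length.
  K : ℕ
  K = 64 ℕ.+ k

  position : Fin 8 → Fin 8 → Fin K
  position i j = Fin.combine i j ↑ˡ k

  get : Vec ℤ K → Rows
  get x i j = lookup x (position i j)

  put : Rows → Vec ℤ K
  put f = tabulate {n = 64} (λ e → f (proj₁ (Fin.remQuot {8} 8 e)) (proj₂ (Fin.remQuot {8} 8 e))) Vec.++ replicate k 0ℤ

  get-put : ∀ f i j → get (put f) i j ≡ f i j
  get-put f i j = trans (Vecₚ.lookup-++ˡ (tabulate {n = 64} g) (replicate k 0ℤ) (Fin.combine i j))
    (trans (Vecₚ.lookup∘tabulate g (Fin.combine i j))
      (cong (λ (i , j) → f i j) (Finₚ.remQuot-combine {8} i j)))
    where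
    g : Fin 64 → ℤ
    g e = f (proj₁ (Fin.remQuot {8} 8 e)) (proj₂ (Fin.remQuot {8} 8 e))

  index : Var → Fin (#vars (∃∀∃∀ K))
  index (b₁ , i , j) = position i j ↑ˡ (K ℕ.+ (K ℕ.+ (K ℕ.+ 0)))
  index (b₂ , i , j) = K ↑ʳ (position i j ↑ˡ (K ℕ.+ (K ℕ.+ 0)))
  index (b₃ , i , j) = K ↑ʳ (K ↑ʳ (position i j ↑ˡ (K ℕ.+ 0)))
  index (b₄ , i , j) = K ↑ʳ (K ↑ʳ (K ↑ʳ (position i j ↑ˡ 0)))

  valuation : Rows → Rows → Rows → Rows → Var → ℤ
  valuation f₁ f₂ f₃ f₄ (b₁ , i , j) = f₁ i j
  valuation f₁ f₂ f₃ f₄ (b₂ , i , j) = f₂ i j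
  valuation f₁ f₂ f₃ f₄ (b₃ , i , j) = f₃ i j
  valuation f₁ f₂ f₃ f₄ (b₄ , i , j) = f₄ i j

  Represents : Vec ℤ K → Rows → Set
  Represents x f = ∀ i j → get x i j ≡ f i j

  agrees : ∀ {x₁ x₂ x₃ x₄ f₁ f₂ f₃ f₄} → Represents x₁ f₁ → Represents x₂ f₂ → Represents x₃ f₃ → Represents x₄ f₄ →
    ∀ v → lookup (x₁ Vec.++ (x₂ Vec.++ (x₃ Vec.++ (x₄ Vec.++ [])))) (index v) ≡ valuation f₁ f₂ f₃ f₄ v
  agrees {x₁} {x₂} {x₃} {x₄} e₁ e₂ e₃ e₄ (b₁ , i , j) = trans (Vecₚ.lookup-++ˡ x₁ _ _) (e₁ i j)
  agrees {x₁} {x₂} {x₃} {x₄} e₁ e₂ e₃ e₄ (b₂ , i , j) = trans (Vecₚ.lookup-++ʳ x₁ _ _)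
    (trans (Vecₚ.lookup-++ˡ x₂ _ _) (e₂ i j))
  agrees {x₁} {x₂} {x₃} {x₄} e₁ e₂ e₃ e₄ (b₃ , i , j) = trans (Vecₚ.lookup-++ʳ x₁ _ _)
    (trans (Vecₚ.lookup-++ʳ x₂ _ _) (trans (Vecₚ.lookup-++ˡ x₃ _ _) (e₃ i j)))
  agrees {x₁} {x₂} {x₃} {x₄} e₁ e₂ e₃ e₄ (b₄ , i , j) = trans (Vecₚ.lookup-++ʳ x₁ _ _)
    (trans (Vecₚ.lookup-++ʳ x₂ _ _) (trans (Vecₚ.lookup-++ʳ x₃ _ _) (trans (Vecₚ.lookup-++ˡ x₄ _ _) (e₄ i j))))

-- The matrix of the sentence

infixr 3 _∧_
infixr 2 _∨_
infix 5 _≤ᶠ_ _≡ᶠ_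

_∧_ _∨_ : ∀ {V} → Frm V → Frm V → Frm V
_∧_ = andᶠ
_∨_ = orᶠ

_≤ᶠ_ _≡ᶠ_ : ∀ {V} → ZT V → ZT V → Frm V
s ≤ᶠ t = notᶠ (t <ᶠ s)
s ≡ᶠ t = s ≤ᶠ t ∧ t ≤ᶠ s

⋀ : ∀ {V n} → (Fin n → Frm V) → Frm V
⋀ {n = zero}  φ = κ 0ℤ <ᶠ κ 1ℤ
⋀ {n = suc n} φ = φ zero ∧ ⋀ (φ ∘ suc)

⋁ : ∀ {V} {A : Set} → (A → Frm V) → List A → Frm V
⋁ φ []       = κ 0ℤ <ᶠ κ 0ℤ
⋁ φ (x ∷ xs) = φ x ∨ ⋁ φ xs

uᶠ vᶠ targetᶠ : ∀ {V} → ZT V → ZT V → LT V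
uᶠ n p      = ⟨ ∸ p , n , κ 0ℤ ⟩
vᶠ k l      = ⟨ ∸ l , κ 0ℤ , k ⟩
targetᶠ X Y = ⟨ κ 0ℤ , X , Y ⟩

-- Parameter rows: s₀ s₁ r₀ r₁ ε₀ ε₁ M.  Element rows: n p X Y q k l.  Test rows: k′ l′ m p′.
module _ {V : Set} (P r t : Row V) where

  private
    s = uᶠ (` P (# 1)) (` P (# 0))
    ρ = vᶠ (` P (# 3)) (` P (# 2))
    ε = uᶠ (` P (# 5)) (` P (# 4))
    M = ` P (# 6)
    n = ` r (# 0)
    p = ` r (# 1)
    X = ` r (# 2)
    Y = ` r (# 3)
    q = ` r (# 4)
    k = ` r (# 5)
    l = ` r (# 6)
    k′ = ` t (# 0)
    l′ = ` t (# 1)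
    m = ` t (# 2)
    p′ = ` t (# 3)

  elementᶠ : Frm V
  elementᶠ =
    κ 0ℤ <ᶠ n ∧ κ 0ℤ ≤ᶠ k ∧ k ≤ᶠ n ∧ s ≺ᶠ uᶠ n p ∧ ρ ≺ᶠ vᶠ k l ∧
    notᶠ (κ 0ℤ ≤ᶠ k′ ∧ k′ ≤ᶠ n ∧ ρ ≺ᶠ vᶠ k′ l′ ∧ notᶠ (uᶠ n p ⊝ᴸ s ≺ᶠ vᶠ k′ l′ ⊝ᴸ ρ)) ∧
    notᶠ (κ 0ℤ ≤ᶠ m ∧ m <ᶠ n ∧ s ≺ᶠ uᶠ m p′ ∧ uᶠ m p′ ⊝ᴸ s ≺ᶠ vᶠ k l ⊝ᴸ ρ) ∧
    targetᶠ X Y ≺ᶠ vᶠ n q ∧ vᶠ n q ⊝ᴸ targetᶠ X Y ≺ᶠ ε ∧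
    κ 0ℤ ≤ᶠ X ∧ X ≤ᶠ M ∧ κ 0ℤ ≤ᶠ Y ∧ Y ≤ᶠ M

lin : ∀ {V} → Row V → Lin → ZT V
lin z (var i) = ` z i
lin z (lit n) = κ (+ n)
lin z (s ⊹ t) = lin z s ∔ lin z t

atomᶠ : ∀ {V} → ℕ → Row V → Row V → Atom → Frm V
atomᶠ Q z r a = ` r (# 2) ≡ᶠ (+ Q) · lin z (Atom.arg a) ∔ κ (+ Atom.tag a) ∧ ` r (# 3) ≡ᶠ lin z (Atom.res a)

-- In block 3, row 0 is the test, rows 1 to 5 are the premises and row 6 holds the values of the
-- clause variables.
premise-row : Fin 5 → Fin 8
premise-row i = suc (i ↑ˡ 2)

ruleᶠ : ∀ {V} → ℕ → (z r : Row V) → (Fin 5 → Row V) → Rule → Frm V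
ruleᶠ Q z r ps R = atomᶠ Q z r (Rule.conclusion R) ∧ ⋀ λ (i : Fin 5) → atomᶠ Q z (ps i) (premise (Rule.premises R) i)

-- Block 1 holds the parameters, the goal element, the input x₀ and x₀ + 1; block 2 an arbitrary
-- element; block 3 a test refuting it, or premises justifying it; block 4 a test of all elements.
goalᶠ : ℕ → Frm Var
goalᶠ Q =
  ` row b₁ (# 2) (# 1) ≡ᶠ ` row b₁ (# 2) (# 0) ∔ κ 1ℤ ∧
  ` row b₁ (# 1) (# 2) ≡ᶠ (+ Q) · (` row b₁ (# 2) (# 0)) ∔ κ 1ℤ ∧
  ` row b₁ (# 1) (# 3) ≡ᶠ κ 0ℤ ∧
  elementᶠ (row b₁ (# 0)) (row b₁ (# 1)) (row b₄ (# 0))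

stepᶠ matrixᶠ : List Rule → ℕ → Frm Var
stepᶠ rs Q =
  ` row b₁ (# 1) (# 0) <ᶠ ` row b₂ (# 0) (# 0) ∨
  notᶠ (elementᶠ (row b₁ (# 0)) (row b₂ (# 0)) (row b₃ (# 0))) ∨
  (` row b₂ (# 0) (# 2) ≡ᶠ κ 0ℤ ∧ ` row b₂ (# 0) (# 3) ≡ᶠ κ 0ℤ) ∨
  ((⋀ λ (i : Fin 5) → elementᶠ (row b₁ (# 0)) (row b₃ (premise-row i)) (row b₄ (# 0)) ∧
                      ` row b₃ (premise-row i) (# 0) <ᶠ ` row b₂ (# 0) (# 0)) ∧
   (⋀ λ j → κ 0ℤ ≤ᶠ ` row b₃ (# 6) j) ∧
   ⋁ (ruleᶠ Q (row b₃ (# 6)) (row b₂ (# 0)) (λ i → row b₃ (premise-row i))) rs)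
matrixᶠ rs Q = goalᶠ Q ∧ stepᶠ rs Q

list-row : ∀ {A : Set} → A → List A → ∀ {n} → Fin n → A
list-row d []       i       = d
list-row d (x ∷ xs) zero    = x
list-row d (x ∷ xs) (suc i) = list-row d xs i

-- Meaning of the matrix

module Meaning-of-formulas (α : RealAlgebraic) (3≤d : 3 ℕ.≤ degree α) where

  open Semantics α 3≤d
  open Elements (value α) (value α ⊗ value α) (α-powers-independent α 3≤d)
  open Element
  open Equivalence

  ≡ᶠ⇔ : ∀ {V} (s t : ZT V) ρ → ⟦ s ≡ᶠ t ⟧ᶠ ρ ⇔ (⟦ s ⟧ᶻ ρ ≡ ⟦ t ⟧ᶻ ρ)
  ≡ᶠ⇔ s t ρ = mk⇔ (λ (p , q) → ℤₚ.≤-antisym (ℤₚ.≮⇒≥ p) (ℤₚ.≮⇒≥ q))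
                  (λ e → (λ lt → ℤₚ.<-irrefl (sym e) lt) , (λ lt → ℤₚ.<-irrefl e lt))

  ⋀⇔ : ∀ {V n} (φ : Fin n → Frm V) ρ → ⟦ ⋀ φ ⟧ᶠ ρ ⇔ (∀ i → ⟦ φ i ⟧ᶠ ρ)
  ⋀⇔ {n = zero}  φ ρ = mk⇔ (λ _ ()) (λ _ → ℤ.+<+ ℕ.z<s)
  ⋀⇔ {n = suc n} φ ρ = mk⇔
    (λ { (p , ps) zero → p ; (p , ps) (suc i) → to (⋀⇔ (φ ∘ suc) ρ) ps i })
    (λ h → h zero , from (⋀⇔ (φ ∘ suc) ρ) (h ∘ suc))

  ⋁⇔ : ∀ {V} {A : Set} (φ : A → Frm V) xs ρ → ⟦ ⋁ φ xs ⟧ᶠ ρ ⇔ (¬ ¬ (∃[ x ] (x ∈ xs × ⟦ φ x ⟧ᶠ ρ)))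
  ⋁⇔ φ []       ρ = mk⇔ (λ 0<0 → contradiction 0<0 (ℤₚ.<-irrefl refl)) (λ h → contradiction (λ { (_ , () , _) }) h)
  ⋁⇔ φ (x ∷ xs) ρ = mk⇔
    (λ h k → h ((λ p → k (x , here refl , p)) , (λ ps → to (⋁⇔ φ xs ρ) ps λ (y , y∈ , p) → k (y , there y∈ , p))))
    (λ h (p , q) → h λ { (_ , here refl , r) → p r ; (y , there y∈ , r) → q (from (⋁⇔ φ xs ρ) (return (y , y∈ , r))) })

  lin-value : ∀ {V} (z : Row V) {e : Env} {ρ : V → ℤ} → (∀ j → ρ (z j) ≡ + e j) → ∀ t → ⟦ lin z t ⟧ᶻ ρ ≡ + ⟦ t ⟧ᴸ e
  lin-value z eq (var i) = eq i
  lin-value z eq (lit n) = refl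
  lin-value z eq (s ⊹ t) = cong₂ ℤ._+_ (lin-value z eq s) (lin-value z eq t)

  module _ (rs : List Rule) where

    open Facts rs

    atomᶠ⇔ : ∀ {V} (z r : Row V) {e : Env} {ρ : V → ℤ} {X Y} → (∀ j → ρ (z j) ≡ + e j) →
      ρ (r (# 2)) ≡ + X → ρ (r (# 3)) ≡ + Y → ∀ A → ⟦ atomᶠ Q z r A ⟧ᶠ ρ ⇔ ((X , Y) ≡ fact-of e A)
    atomᶠ⇔ z r {e} {ρ} {X} {Y} eq eqX eqY A = mk⇔
      (λ (p , q) → cong₂ _,_ (ℤₚ.+-injective (trans (sym eqX) (trans (to (≡ᶠ⇔ (` r (# 2)) X-term ρ) p) X-value)))
                             (ℤₚ.+-injective (trans (sym eqY) (trans (to (≡ᶠ⇔ (` r (# 3)) (lin z (Atom.res A)) ρ) q)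
                               (lin-value z eq (Atom.res A))))))
      (λ e → from (≡ᶠ⇔ (` r (# 2)) X-term ρ) (trans eqX (trans (cong (+_ ∘ proj₁) e) (sym X-value))) ,
             from (≡ᶠ⇔ (` r (# 3)) (lin z (Atom.res A)) ρ)
               (trans eqY (trans (cong (+_ ∘ proj₂) e) (sym (lin-value z eq (Atom.res A))))))
      where
      X-term = (+ Q) · lin z (Atom.arg A) ∔ κ (+ Atom.tag A)
      X-value : ⟦ X-term ⟧ᶻ ρ ≡ + (Q ℕ.* ⟦ Atom.arg A ⟧ᴸ e ℕ.+ Atom.tag A)
      X-value = cong (ℤ._+ + Atom.tag A) (trans (cong (λ i → + Q ℤ.* i) (lin-value z eq (Atom.arg A)))
        (sym (ℤₚ.pos-* Q (⟦ Atom.arg A ⟧ᴸ e))))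

  El : (P r t : Row ℤ) → Set
  El P r t = ⟦ elementᶠ P r t ⟧ᶠ id

  s-of r-of ε-of : Row ℤ → ℝ
  s-of P = u (P (# 1)) (P (# 0))
  r-of P = v (P (# 3)) (P (# 2))
  ε-of P = u (P (# 5)) (P (# 4))

  u⊝u : ∀ n p m p′ → value-of (uᶠ (` n) (` p) ⊝ᴸ uᶠ (` m) (` p′)) id ≐ u n p ⊝ u m p′
  u⊝u n p m p′ = form-⊝ a b (ℤ.- p) n 0ℤ (ℤ.- p′) m 0ℤ

  v⊝v : ∀ k l m l′ → value-of (vᶠ (` k) (` l) ⊝ᴸ vᶠ (` m) (` l′)) id ≐ v k l ⊝ v m l′
  v⊝v k l m l′ = form-⊝ a b (ℤ.- l) 0ℤ k (ℤ.- l′) 0ℤ m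

  -- Each universal clause is read off by placing the point in question into the test row.
  El⇒Element : ∀ {P r} → (∀ t → El P r t) →
    Element (s-of P) (r-of P) (r (# 0)) (r (# 1)) (r (# 5)) (r (# 6))
  El⇒Element {P} {r} el = let 0<n , 0≤k , k≤n , s≺u , r≺v , _ = el (λ _ → 0ℤ) in record
    { 0<n = 0<n ; 0≤k = ℤₚ.≮⇒≥ 0≤k ; k≤n = ℤₚ.≮⇒≥ k≤n ; s≺u = s≺u ; r≺v = r≺v
    ; closer = λ k′ l′ 0≤k′ k′≤n r≺v′ → ≺-stable λ nlt →
        let _ , _ , _ , _ , _ , closer , _ = el (list-row 0ℤ (k′ ∷ l′ ∷ [])) in
        closer (ℤₚ.≤⇒≯ 0≤k′ , ℤₚ.≤⇒≯ k′≤n , r≺v′ , λ lt → nlt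
          (≺-resp (u⊝u (r (# 0)) (r (# 1)) (P (# 1)) (P (# 0))) (v⊝v k′ l′ (P (# 3)) (P (# 2))) lt))
    ; first = λ m p′ 0≤m m<n s≺u′ lt →
        let _ , _ , _ , _ , _ , _ , first , _ = el (list-row 0ℤ (0ℤ ∷ 0ℤ ∷ m ∷ p′ ∷ [])) in
        first (ℤₚ.≤⇒≯ 0≤m , m<n , s≺u′ ,
          ≺-resp (≐-sym (u⊝u m p′ (P (# 1)) (P (# 0)))) (≐-sym (v⊝v (r (# 5)) (r (# 6)) (P (# 3)) (P (# 2)))) lt) }

  v⊝target : ∀ n q X Y → value-of (vᶠ (` n) (` q) ⊝ᴸ targetᶠ (` X) (` Y)) id ≐ v n q ⊝ form a b 0ℤ X Y
  v⊝target n q X Y = form-⊝ a b (ℤ.- q) 0ℤ n 0ℤ X Y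

  Encodes′ : ℝ → ℤ → ℤ → ℤ → ℤ → Set
  Encodes′ ε n q X Y = form a b 0ℤ X Y ≺ v n q × v n q ⊝ form a b 0ℤ X Y ≺ ε

  record Data (P r : Row ℤ) : Set where
    constructor data-of
    field
      {X Y}    : ℕ
      X≡       : r (# 2) ≡ + X
      Y≡       : r (# 3) ≡ + Y
      encodes  : Encodes (ε-of P) (r (# 0)) (r (# 4)) (X , Y)
      X≤M      : + X ℤ.≤ P (# 6)
      Y≤M      : + Y ℤ.≤ P (# 6)

  nonnegative : ∀ {i} → 0ℤ ℤ.≤ i → ∃[ n ] i ≡ + n
  nonnegative {+ n} _ = n , refl

  El⇒Data : ∀ {P r t} → El P r t → Data P r
  El⇒Data {P} {r} (_ , _ , _ , _ , _ , _ , _ , t≺v , v≺ε , 0≤X , X≤M , 0≤Y , Y≤M) =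
    let X , X≡ = nonnegative (ℤₚ.≮⇒≥ 0≤X)
        Y , Y≡ = nonnegative (ℤₚ.≮⇒≥ 0≤Y)
        en = subst₂ (Encodes′ (ε-of P) (r (# 0)) (r (# 4))) X≡ Y≡
               (t≺v , ≺-resp (v⊝target (r (# 0)) (r (# 4)) (r (# 2)) (r (# 3))) ≐-refl v≺ε)
    in data-of X≡ Y≡ en (subst (ℤ._≤ P (# 6)) X≡ (ℤₚ.≮⇒≥ X≤M)) (subst (ℤ._≤ P (# 6)) Y≡ (ℤₚ.≮⇒≥ Y≤M))

  El-intro : ∀ {P r} → Element (s-of P) (r-of P) (r (# 0)) (r (# 1)) (r (# 5)) (r (# 6)) → Data P r → ∀ t → El P r t
  El-intro {P} {r} e (data-of X≡ Y≡ en X≤M Y≤M) t =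
    let t≺v , v≺ε = subst₂ (Encodes′ (ε-of P) (r (# 0)) (r (# 4))) (sym X≡) (sym Y≡) en in
    0<n e , ℤₚ.≤⇒≯ (0≤k e) , ℤₚ.≤⇒≯ (k≤n e) , s≺u e , r≺v e ,
    (λ (0≤k′ , k′≤n , r≺v′ , nlt) → nlt (≺-resp
      (≐-sym (u⊝u (r (# 0)) (r (# 1)) (P (# 1)) (P (# 0)))) (≐-sym (v⊝v (t (# 0)) (t (# 1)) (P (# 3)) (P (# 2))))
      (closer e (t (# 0)) (t (# 1)) (ℤₚ.≮⇒≥ 0≤k′) (ℤₚ.≮⇒≥ k′≤n) r≺v′))) ,
    (λ (0≤m , m<n , s≺u′ , lt) → first e (t (# 2)) (t (# 3)) (ℤₚ.≮⇒≥ 0≤m) m<n s≺u′ (≺-resp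
      (u⊝u (t (# 2)) (t (# 3)) (P (# 1)) (P (# 0))) (v⊝v (r (# 5)) (r (# 6)) (P (# 3)) (P (# 2))) lt)) ,
    t≺v , ≺-resp (≐-sym (v⊝target (r (# 0)) (r (# 4)) (r (# 2)) (r (# 3)))) ≐-refl v≺ε ,
    ℤₚ.≤⇒≯ (subst (0ℤ ℤ.≤_) (sym X≡) (ℤ.+≤+ z≤n)) , ℤₚ.≤⇒≯ (subst (ℤ._≤ P (# 6)) (sym X≡) X≤M) ,
    ℤₚ.≤⇒≯ (subst (0ℤ ℤ.≤_) (sym Y≡) (ℤ.+≤+ z≤n)) , ℤₚ.≤⇒≯ (subst (ℤ._≤ P (# 6)) (sym Y≡) Y≤M)

-- From quantified vectors to quantified rows

module Prenex (α : RealAlgebraic) (3≤d : 3 ℕ.≤ degree α) (k : ℕ) where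

  open Semantics α 3≤d
  open Blocks k
  open Equivalence

  Satisfied : Frm Var → Rows → Set
  Satisfied φ f₁ = ∀ f₂ → ¬ ¬ (∃[ f₃ ] (∀ f₄ → ⟦ φ ⟧ᶠ (valuation f₁ f₂ f₃ f₄)))

  True⇔Satisfied : ∀ φ → True {α} (∃∀∃∀ K) (compile index φ) ⇔ (¬ ¬ (∃[ f₁ ] Satisfied φ f₁))
  True⇔Satisfied φ = mk⇔
    (λ t → t >>= λ (x₁ , h) → return (get x₁ , λ f₂ → h (put f₂) >>= λ (x₃ , h′) → return (get x₃ , λ f₄ →
      to (correct index (x₁ Vec.++ (put f₂ Vec.++ (x₃ Vec.++ (put f₄ Vec.++ []))))
          {valuation (get x₁) f₂ (get x₃) f₄}
          (agrees {x₁} {put f₂} {x₃} {put f₄} (λ _ _ → refl) (get-put f₂) (λ _ _ → refl) (get-put f₄)) φ)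
        (h′ (put f₄)))))
    (λ s → s >>= λ (f₁ , h) → return (put f₁ , λ x₂ → h (get x₂) >>= λ (f₃ , h′) → return (put f₃ , λ x₄ →
      from (correct index (put f₁ Vec.++ (x₂ Vec.++ (put f₃ Vec.++ (x₄ Vec.++ []))))
          {valuation f₁ (get x₂) f₃ (get x₄)}
          (agrees {put f₁} {x₂} {put f₃} {x₄} (get-put f₁) (λ _ _ → refl) (get-put f₃) (λ _ _ → refl)) φ)
        (h′ (get x₄)))))

<suc⇒≤ : ∀ {i j} → i ℤ.< ℤ.suc j → i ℤ.≤ j
<suc⇒≤ i<1+j = ℤₚ.≮⇒≥ λ j<i → ℤₚ.<-irrefl refl (ℤₚ.<-≤-trans i<1+j (ℤₚ.i<j⇒suc[i]≤j j<i))

-- The sentence expressing that a program halts with value 0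

module ProgramSentence (α : RealAlgebraic) (3≤d : 3 ℕ.≤ degree α) (P : Rec 1) where

  open Semantics α 3≤d
  open Elements (value α) (value α ⊗ value α) (α-powers-independent α 3≤d)
  open Separation (value α) (value α ⊗ value α) (α-powers-independent α 3≤d) using (separation)
  open Meaning-of-formulas α 3≤d
  open Program P
  open Facts clauses
  open Equivalence

  -- As the matrix forces x₁ = x₀ + 1, the two bounds say x₀ = m. Both contain m in the shape m <
  -- variable, so each compiles to an atom with right-hand side +m, whose code is simply 2 m.
  sentenceᶠ : ℕ → Frm Var
  sentenceᶠ m = notᶠ (κ (+ m) <ᶠ ` row b₁ (# 2) (# 0)) ∧ κ (+ m) <ᶠ ` row b₁ (# 2) (# 1) ∧ matrixᶠ clauses Q

  open Truth Model modelΔ clauses-sound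

  module Sound (k m : ℕ) (f₁ : Rows)
    (satisfied : ∀ f₂ → ¬ ¬ (∃[ f₃ ] (∀ f₄ → ⟦ sentenceᶠ m ⟧ᶠ (Blocks.valuation k f₁ f₂ f₃ f₄)))) where

    open Blocks k using (valuation)

    params goal : Row ℤ
    params = f₁ (# 0)
    goal = f₁ (# 1)

    justifyᶠ : Frm Var
    justifyᶠ =
      (⋀ λ (i : Fin 5) → elementᶠ (row b₁ (# 0)) (row b₃ (premise-row i)) (row b₄ (# 0)) ∧
                      ` row b₃ (premise-row i) (# 0) <ᶠ ` row b₂ (# 0) (# 0)) ∧
      (⋀ λ j → κ 0ℤ ≤ᶠ ` row b₃ (# 6) j) ∧
      ⋁ (ruleᶠ Q (row b₃ (# 6)) (row b₂ (# 0)) (λ i → row b₃ (premise-row i))) clauses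

    -- r passes every test, also the one offered in row 0 of block 3, and is neither beyond the goal
    -- nor the base fact, so the last disjunct remains.
    step-at : ∀ r → (∀ t → El params r t) → ¬ (goal (# 0) ℤ.< r (# 0)) → ¬ (r (# 2) ≡ 0ℤ × r (# 3) ≡ 0ℤ) →
      ∀ f₃ → (∀ f₄ → ⟦ sentenceᶠ m ⟧ᶠ (valuation f₁ (λ _ → r) f₃ f₄)) →
      ∀ f₄ → ⟦ justifyᶠ ⟧ᶠ (valuation f₁ (λ _ → r) f₃ f₄)
    step-at r el ≤goal nonbase f₃ h f₄ = ⟦⟧ᶠ-stable justifyᶠ ρ λ ¬justified →
      let _ , _ , _ , step = h f₄ in
      step (≤goal , λ rest → rest ((λ ¬el → ¬el (el (f₃ (# 0)))) , λ rest′ → rest′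
        ((λ (X≡0 , Y≡0) → nonbase (to (≡ᶠ⇔ (` row b₂ (# 0) (# 2)) (κ 0ℤ) ρ) X≡0 , to (≡ᶠ⇔ (` row b₂ (# 0) (# 3)) (κ 0ℤ) ρ) Y≡0)) ,
         ¬justified)))
      where
      ρ = valuation f₁ (λ _ → r) f₃ f₄

    module Justified-at (r : Row ℤ) (f₃ : Rows) (h : ∀ f₄ → ⟦ justifyᶠ ⟧ᶠ (valuation f₁ (λ _ → r) f₃ f₄)) where

      ρ : Row ℤ → Var → ℤ
      ρ t = valuation f₁ (λ _ → r) f₃ (λ _ → t)

      premiseᶠ : Fin 5 → Frm Var
      premiseᶠ i = elementᶠ (row b₁ (# 0)) (row b₃ (premise-row i)) (row b₄ (# 0)) ∧
                   ` row b₃ (premise-row i) (# 0) <ᶠ ` row b₂ (# 0) (# 0)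

      ruleᶠ′ : Rule → Frm Var
      ruleᶠ′ = ruleᶠ Q (row b₃ (# 6)) (row b₂ (# 0)) (λ i → row b₃ (premise-row i))

      premise-element : ∀ i t → El params (f₃ (premise-row i)) t
      premise-element i t = proj₁ (to (⋀⇔ premiseᶠ (ρ t)) (proj₁ (h (λ _ → t))) i)

      premise-earlier : ∀ i → f₃ (premise-row i) (# 0) ℤ.< r (# 0)
      premise-earlier i = proj₂ (to (⋀⇔ premiseᶠ (ρ (λ _ → 0ℤ))) (proj₁ (h (λ _ _ → 0ℤ))) i)

      premise-data : ∀ i → Data params (f₃ (premise-row i))
      premise-data i = El⇒Data {params} {f₃ (premise-row i)} {λ _ → 0ℤ} (premise-element i (λ _ → 0ℤ))

      premise-fact : Fin 5 → Fact
      premise-fact i = Data.X (premise-data i) , Data.Y (premise-data i)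

      e : Env
      e j = ∣ f₃ (# 6) j ∣

      e≡ : ∀ j → f₃ (# 6) j ≡ + e j
      e≡ j = sym (ℤₚ.0≤i⇒+∣i∣≡i (ℤₚ.≮⇒≥
        (to (⋀⇔ (λ j → κ 0ℤ ≤ᶠ ` row b₃ (# 6) j) (ρ (λ _ → 0ℤ))) (proj₁ (proj₂ (h (λ _ _ → 0ℤ)))) j)))

      justified : ∀ {X Y} → r (# 2) ≡ + X → r (# 3) ≡ + Y → (∀ i → True-fact (premise-fact i)) →
        ¬ ¬ Justified (X , Y) True-fact
      justified X≡ Y≡ known =
        to (⋁⇔ ruleᶠ′ clauses (ρ (λ _ → 0ℤ))) (proj₂ (proj₂ (h (λ _ _ → 0ℤ)))) >>= λ (R , R∈ , concl , prems) →
        return (inj₂ (R , R∈ , e ,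
          to (atomᶠ⇔ clauses (row b₃ (# 6)) (row b₂ (# 0)) e≡ X≡ Y≡ (Rule.conclusion R)) concl ,
          λ i → subst True-fact
            (to (atomᶠ⇔ clauses (row b₃ (# 6)) (row b₃ (premise-row i)) e≡ (Data.X≡ (premise-data i)) (Data.Y≡ (premise-data i))
                  (premise (Rule.premises R) i))
                (to (⋀⇔ (λ i → atomᶠ Q (row b₃ (# 6)) (row b₃ (premise-row i)) (premise (Rule.premises R) i)) (ρ (λ _ → 0ℤ)))
                prems i))
            (known i)))

    -- Induction on a bound for n, as premises have smaller n. The argument is uniform in the
    -- parameters, so it applies to whatever the first block supplies.
    elements-true : ∀ N r → r (# 0) ℤ.< + N → ¬ (goal (# 0) ℤ.< r (# 0)) → (∀ t → El params r t) →
      ∀ {X Y} → r (# 2) ≡ + X → r (# 3) ≡ + Y → ¬ ¬ True-fact (X , Y)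
    elements-true zero r r<0 _ el _ _ = contradiction (ℤₚ.<-trans (proj₁ (el (λ _ → 0ℤ))) r<0) (ℤₚ.<-irrefl refl)
    elements-true (suc N) r r<N ≤goal el {X} {Y} X≡ Y≡ = case (X ℕ.≟ 0) ×-dec (Y ℕ.≟ 0) of λ
      { (yes (refl , refl)) → return (justified⇒true (inj₁ refl))
      ; (no nonbase) →
          satisfied (λ _ → r) >>= λ (f₃ , h) →
          let open Justified-at r f₃ (step-at r el ≤goal
                (λ (X≡0 , Y≡0) → nonbase (ℤₚ.+-injective (trans (sym X≡) X≡0) , ℤₚ.+-injective (trans (sym Y≡) Y≡0))) f₃ h) in
          ¬¬-∀Fin (λ i → elements-true N (f₃ (premise-row i))
            (ℤₚ.<-≤-trans (premise-earlier i) (<suc⇒≤ r<N))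
            (λ lt → ≤goal (ℤₚ.<-trans lt (premise-earlier i)))
            (premise-element i) (Data.X≡ (premise-data i)) (Data.Y≡ (premise-data i))) >>= λ known →
          justified X≡ Y≡ known >>= λ j → return (justified⇒true j) }

    halts : ¬ ¬ (P [ m ∷ [] ]⇓ 0)
    halts =
      satisfied (λ _ → goal) >>= λ (f₃ , h) →
      let el : ∀ t → El params goal t
          el t = let _ , _ , (_ , _ , _ , el) , _ = h (λ _ → t) in el
          m≮x₀ , m<x₀+1 , (x₁≡ , X≡ , Y≡ , _) , _ = h (λ _ _ → 0ℤ)
          ρ = valuation f₁ (λ _ → goal) f₃ (λ _ _ → 0ℤ)
          x₁≡′ = to (≡ᶠ⇔ (` row b₁ (# 2) (# 1)) (` row b₁ (# 2) (# 0) ∔ κ 1ℤ) ρ) x₁≡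
          x₀≡ : f₁ (# 2) (# 0) ≡ + m
          x₀≡ = ℤₚ.≤-antisym (ℤₚ.≮⇒≥ m≮x₀)
            (<suc⇒≤ (subst (+ m ℤ.<_) (trans x₁≡′ (ℤₚ.+-comm (f₁ (# 2) (# 0)) 1ℤ)) m<x₀+1))
          X≡′ : goal (# 2) ≡ + (Q ℕ.* m ℕ.+ 1)
          X≡′ = trans (to (≡ᶠ⇔ (` row b₁ (# 1) (# 2)) ((+ Q) · (` row b₁ (# 2) (# 0)) ∔ κ 1ℤ) ρ) X≡)
            (cong (ℤ._+ 1ℤ) (trans (cong (λ i → + Q ℤ.* i) x₀≡) (sym (ℤₚ.pos-* Q m))))
          Y≡′ = to (≡ᶠ⇔ (` row b₁ (# 1) (# 3)) (κ 0ℤ) ρ) Y≡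
      in
      elements-true (suc ∣ goal (# 0) ∣) goal (i<1+∣i∣ (goal (# 0))) (ℤₚ.<-irrefl refl) el X≡′ Y≡′ >>= λ known →
      return (model₁⁻¹ (known 1 m (conclusion-tag< {unary} (there (here refl))) refl))
      where
      i<1+∣i∣ : ∀ i → i ℤ.< + suc ∣ i ∣
      i<1+∣i∣ (+ n)    = ℤ.+<+ ℕₚ.≤-refl
      i<1+∣i∣ -[1+ n ] = ℤ.-<+
      model₁⁻¹ : ∀ {x y} → Model 1 x y → P [ x ∷ [] ]⇓ y
      model₁⁻¹ (model₁ P⇓) = P⇓
      model₁⁻¹ (modelₚ _ () _)

  size : Fact → ℕ
  size (X , Y) = X ℕ.+ Y

  largest : List Fact → ℕ
  largest L = sum (List.map size L)

  bounded-by-largest : ∀ {F L} → F ∈ L → Bounded (largest L) F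
  bounded-by-largest {X , Y} F∈L =
    ℕₚ.≤-trans (ℕₚ.m≤m+n X Y) (∈⇒≤sum size F∈L) , ℕₚ.≤-trans (ℕₚ.m≤n+m Y X) (∈⇒≤sum size F∈L)

  module Witness (k m M : ℕ) (ε : ℝ) (params : Row ℤ) (N : ℤ)
    (ε≡ : ε-of params ≡ ε) (M≡ : params (# 6) ≡ + M)
    (only : ∀ {n p k l q F} → Element (s-of params) (r-of params) n p k l → n ℤ.≤ N → Bounded M F → Encodes ε n q F →
            Justified F (Coded M ε (s-of params) (r-of params) n))
    (goal-coded : Coded M ε (s-of params) (r-of params) (N ℤ.+ 1ℤ) (fact 1 m 0)) where

    open Blocks k using (valuation)

    coded-row : ∀ {n F} → Coded M ε (s-of params) (r-of params) n F → Row ℤ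
    coded-row {F = X , Y} (n , p , k , l , q , _) = list-row 0ℤ (n ∷ p ∷ + X ∷ + Y ∷ q ∷ k ∷ l ∷ [])

    coded-El : ∀ {n F} (c : Coded M ε (s-of params) (r-of params) n F) t → El params (coded-row {n} {F} c) t
    coded-El {F = X , Y} (n , p , k , l , q , el , en , (X≤M , Y≤M) , _) =
      El-intro {params} {list-row 0ℤ (n ∷ p ∷ + X ∷ + Y ∷ q ∷ k ∷ l ∷ [])} el
      (data-of refl refl (subst (λ ε → Encodes ε n q (X , Y)) (sym ε≡) en)
        (subst (+ X ℤ.≤_) (sym M≡) (ℤ.+≤+ X≤M)) (subst (+ Y ℤ.≤_) (sym M≡) (ℤ.+≤+ Y≤M)))

    goal : Row ℤ
    goal = coded-row {N ℤ.+ 1ℤ} {fact 1 m 0} goal-coded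

    f₁ : Rows
    f₁ = list-row (λ _ → 0ℤ) (params ∷ goal ∷ list-row 0ℤ (+ m ∷ + m ℤ.+ 1ℤ ∷ []) ∷ [])

    goal-holds : ∀ f₂ f₃ f₄ → ⟦ goalᶠ Q ⟧ᶠ (valuation f₁ f₂ f₃ f₄)
    goal-holds f₂ f₃ f₄ =
      from (≡ᶠ⇔ (` row b₁ (# 2) (# 1)) (` row b₁ (# 2) (# 0) ∔ κ 1ℤ) ρ) refl ,
      from (≡ᶠ⇔ (` row b₁ (# 1) (# 2)) ((+ Q) · (` row b₁ (# 2) (# 0)) ∔ κ 1ℤ) ρ)
        (cong (ℤ._+ 1ℤ) (ℤₚ.pos-* Q m)) ,
      from (≡ᶠ⇔ (` row b₁ (# 1) (# 3)) (κ 0ℤ) ρ) refl ,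
      coded-El {N ℤ.+ 1ℤ} {fact 1 m 0} goal-coded (f₄ (# 0))
      where
      ρ = valuation f₁ f₂ f₃ f₄

    input-holds : ∀ f₂ f₃ f₄ → ⟦ stepᶠ clauses Q ⟧ᶠ (valuation f₁ f₂ f₃ f₄) → ⟦ sentenceᶠ m ⟧ᶠ (valuation f₁ f₂ f₃ f₄)
    input-holds f₂ f₃ f₄ step = ℤₚ.<-irrefl refl , <+1 (+ m) , goal-holds f₂ f₃ f₄ , step

    goal≤N : goal (# 0) ℤ.≤ N
    goal≤N = let _ , _ , _ , _ , _ , _ , _ , _ , n<N+1 = goal-coded in
      <suc⇒≤ (subst (goal (# 0) ℤ.<_) (ℤₚ.+-comm N 1ℤ) n<N+1)

    block₃ : (Fin 5 → Row ℤ) → Row ℤ → Rows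
    block₃ prems z zero    = λ _ → 0ℤ
    block₃ prems z (suc i) = [ prems , (λ _ → z) ]′ (Fin.splitAt 5 i)

    block₃-premise : ∀ prems z i → block₃ prems z (premise-row i) ≡ prems i
    block₃-premise prems z i = cong [ prems , (λ _ → z) ]′ (Finₚ.splitAt-↑ˡ 5 i 2)

    -- Three classical cases: r lies beyond the goal; some test refutes r, and block 3 supplies that
    -- test; or r is an element up to N, and `only` supplies its premises.
    step-holds : ∀ f₂ → ¬ ¬ (∃[ f₃ ] (∀ f₄ → ⟦ stepᶠ clauses Q ⟧ᶠ (valuation f₁ f₂ f₃ f₄)))
    step-holds f₂ = excluded-middle (goal (# 0) ℤ.< r (# 0)) >>= λ
      { (inj₁ later) → return ((λ _ _ → 0ℤ) , λ f₄ (¬later , _) → ¬later later)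
      ; (inj₂ ≤goal) → excluded-middle (∃[ t ] ¬ El params r t) >>= λ
        { (inj₁ (t , ¬el)) → return ((λ _ → t) , λ f₄ (_ , rest) → rest λ (¬¬el , _) → ¬¬el ¬el)
        ; (inj₂ ¬∃) → return (justify ≤goal λ t →
            ⟦⟧ᶠ-stable (elementᶠ params r t) id λ ¬el → ¬∃ (t , ¬el)) } }
      where
      r : Row ℤ
      r = f₂ (# 0)
      justify : ¬ (goal (# 0) ℤ.< r (# 0)) → (∀ t → El params r t) →
        ∃[ f₃ ] (∀ f₄ → ⟦ stepᶠ clauses Q ⟧ᶠ (valuation f₁ f₂ f₃ f₄))
      justify ≤goal el = use (only (El⇒Element {params} {r} el) (ℤₚ.≤-trans (ℤₚ.≮⇒≥ ≤goal) goal≤N)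
          (ℤ.drop‿+≤+ (subst (+ X ℤ.≤_) M≡ X≤M) , ℤ.drop‿+≤+ (subst (+ Y ℤ.≤_) M≡ Y≤M))
          (subst (λ ε → Encodes ε (r (# 0)) (r (# 4)) (X , Y)) ε≡ encodes))
        where
        open Data (El⇒Data {params} {r} {λ _ → 0ℤ} (el (λ _ → 0ℤ)))
        use : Justified (X , Y) (Coded M ε (s-of params) (r-of params) (r (# 0))) →
          ∃[ f₃ ] (∀ f₄ → ⟦ stepᶠ clauses Q ⟧ᶠ (valuation f₁ f₂ f₃ f₄))
        use (inj₁ eq) = (λ _ _ → 0ℤ) , λ f₄ → λ (_ , rest) → rest λ (_ , rest′) → rest′ λ (¬base , _) →
          ¬base (from (≡ᶠ⇔ (` row b₂ (# 0) (# 2)) (κ 0ℤ) (valuation f₁ f₂ (λ _ _ → 0ℤ) f₄)) (trans X≡ (cong (+_ ∘ proj₁) eq)) ,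
                 from (≡ᶠ⇔ (` row b₂ (# 0) (# 3)) (κ 0ℤ) (valuation f₁ f₂ (λ _ _ → 0ℤ) f₄)) (trans Y≡ (cong (+_ ∘ proj₂) eq)))
        use (inj₂ (R , R∈ , z , eq , coded)) = f₃ , λ f₄ → λ (_ , rest) → rest λ (_ , rest′) → rest′ λ (_ , ¬justified) →
          ¬justified (justified f₄)
          where
          prem : Fin 5 → Row ℤ
          prem i = coded-row {r (# 0)} {fact-of z (premise (Rule.premises R) i)} (coded i)
          f₃ = block₃ prem (λ j → + z j)
          module _ (f₄ : Rows) where
            ρ = valuation f₁ f₂ f₃ f₄
            earlier : ∀ i → prem i (# 0) ℤ.< r (# 0)
            earlier i = let _ , _ , _ , _ , _ , _ , _ , _ , n<N = coded i in n<N
            justified : _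
            justified =
              from (⋀⇔ (λ (i : Fin 5) → elementᶠ (row b₁ (# 0)) (row b₃ (premise-row i)) (row b₄ (# 0)) ∧
                      ` row b₃ (premise-row i) (# 0) <ᶠ ` row b₂ (# 0) (# 0)) ρ)
                (λ i → subst (λ p → El params p (f₄ (# 0)) × p (# 0) ℤ.< r (# 0)) (sym (block₃-premise prem (λ j → + z j) i))
                  (coded-El {r (# 0)} {fact-of z (premise (Rule.premises R) i)} (coded i) (f₄ (# 0)) , earlier i)) ,
              from (⋀⇔ (λ j → κ 0ℤ ≤ᶠ ` row b₃ (# 6) j) ρ) (λ j → ℤₚ.≤⇒≯ (ℤ.+≤+ z≤n)) ,
              from (⋁⇔ (ruleᶠ Q (row b₃ (# 6)) (row b₂ (# 0)) (λ i → row b₃ (premise-row i))) clauses ρ)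
                (return (R , R∈ ,
                  from (atomᶠ⇔ clauses (row b₃ (# 6)) (row b₂ (# 0)) {z} {ρ} (λ _ → refl) X≡ Y≡ (Rule.conclusion R)) eq ,
                  from (⋀⇔ (λ i → atomᶠ Q (row b₃ (# 6)) (row b₃ (premise-row i)) (premise (Rule.premises R) i)) ρ) λ i →
                    from (atomᶠ⇔ clauses (row b₃ (# 6)) (row b₃ (premise-row i)) {z} {ρ} (λ _ → refl)
                      (cong (λ p → p (# 2)) (block₃-premise prem (λ j → + z j) i))
                      (cong (λ p → p (# 3)) (block₃-premise prem (λ j → + z j) i))
                      (premise (Rule.premises R) i)) refl))

    satisfied : ∀ f₂ → ¬ ¬ (∃[ f₃ ] (∀ f₄ → ⟦ sentenceᶠ m ⟧ᶠ (valuation f₁ f₂ f₃ f₄)))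
    satisfied f₂ = step-holds f₂ >>= λ (f₃ , h) → return (f₃ , λ f₄ → input-holds f₂ f₃ f₄ (h f₄))

  chain⇒ok : ∀ {M ε γ} (0<ε : Pos ε) (ε≼γ : ε ≼ γ) (separates : Separates M γ) {L} → Chain L →
    (∀ {F} → F ∈ L → Bounded M F) → Stages.Ok M ε γ 0<ε ε≼γ separates Justified Justified-map L
  chain⇒ok 0<ε ε≼γ separates []         bound = Stages.[]
  chain⇒ok 0<ε ε≼γ separates (j ∷ rest) bound =
    (bound (here refl) , j) Stages.∷ chain⇒ok 0<ε ε≼γ separates rest (bound ∘ there)

  satisfiable : ∀ k m → P [ m ∷ [] ]⇓ 0 →
    ¬ ¬ (∃[ f₁ ] (∀ f₂ → ¬ ¬ (∃[ f₃ ] (∀ f₄ → ⟦ sentenceᶠ m ⟧ᶠ (Blocks.valuation k f₁ f₂ f₃ f₄)))))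
  satisfiable k m P⇓ = build (chain (clauses-complete P⇓) [])
    where
    build : Extends [] (fact 1 m 0) → _
    build (L , chained , goal∈L , _) =
      separation M >>= λ (γ , 0<γ , separates) →
      -- ε has to be the value of a term, so it is found as `u e₁ e₀` between 0 and γ; the interval
      -- for v is a dummy.
      dense (Pos⇒≻0 0<γ) 0<1 0ℤ >>= λ (e₁ , e₀ , _ , _ , (0<ε , ε<γ) , _) →
      let open Stages M (u e₁ e₀) γ (≻0⇒Pos 0<ε) (≺⇒≼ ε<γ) separates Justified Justified-map
      in
      stage (chain⇒ok (≻0⇒Pos 0<ε) (≺⇒≼ ε<γ) separates chained bounded-by-largest) >>= λ S →
      let open Stage S in
      -- Only now are s and r fixed, as `u n p` and `v n q` with a common index n, inside the
      -- intervals left by the last stage.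
      dense s⁻≺ r⁻≺r⁺ 0ℤ >>= λ (n , p , q , _ , (s⁻≺s , s≺) , (r⁻≺r , r≺r⁺)) →
      let params = list-row 0ℤ (p ∷ n ∷ q ∷ n ∷ e₀ ∷ e₁ ∷ + M ∷ [])
          c = content s⁻≺s s≺ r⁻≺r r≺r⁺
          open Witness k m M (u e₁ e₀) params N refl refl (Content.only c) (Content.have c goal∈L)
      in return (f₁ , satisfied)
      where
      M = largest L

-- Determinism of partial recursive functions

mutual
  -- For `μᴿ`, the smaller of two results would be a zero of f and also, by minimality of the
  -- larger, a place where f is positive.
  deterministic : ∀ {n} (f : Rec n) {xs y z} → f [ xs ]⇓ y → f [ xs ]⇓ z → y ≡ z
  deterministic zeroᴿ zero⇓ zero⇓ = refl
  deterministic sucᴿ suc⇓ suc⇓ = refl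
  deterministic (projᴿ i) (proj⇓ .i) (proj⇓ .i) = refl
  deterministic (compᴿ f gs) (comp⇓ gs⇓ f⇓) (comp⇓ gs⇓′ f⇓′) with deterministic* gs gs⇓ gs⇓′
  ... | refl = deterministic f f⇓ f⇓′
  deterministic (precᴿ f g) (prec⇓₀ f⇓) (prec⇓₀ f⇓′) = deterministic f f⇓ f⇓′
  deterministic (precᴿ f g) (prec⇓₁ h⇓ g⇓) (prec⇓₁ h⇓′ g⇓′) with deterministic (precᴿ f g) h⇓ h⇓′
  ... | refl = deterministic g g⇓ g⇓′
  deterministic (μᴿ f) {y = y} {z} (μ⇓ f⇓ below-y) (μ⇓ f⇓′ below-z) with ℕₚ.<-cmp y z
  ... | tri≈ _ y≡z _ = y≡z
  ... | tri< y<z _ _ = contradiction (deterministic f f⇓ (proj₂ (below-z y y<z))) λ ()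
  ... | tri> _ _ z<y = contradiction (deterministic f f⇓′ (proj₂ (below-y z z<y))) λ ()

  deterministic* : ∀ {m n} (gs : Vec (Rec n) m) {xs ys zs} → gs [ xs ]⇓* ys → gs [ xs ]⇓* zs → ys ≡ zs
  deterministic* []       []⇓          []⇓            = refl
  deterministic* (g ∷ gs) (∷⇓ g⇓ gs⇓) (∷⇓ g⇓′ gs⇓′) =
    cong₂ _∷_ (deterministic g g⇓ g⇓′) (deterministic* gs gs⇓ gs⇓′)

-- Recursive programs for the coding functions

record Program-for {n} (F : Vec ℕ n → ℕ) : Set where
  constructor program
  field
    rec       : Rec n
    computes  : ∀ xs → rec [ xs ]⇓ F xs

open Program-for

constᴾ : ∀ {n} c → Program-for {n} (λ _ → c)
constᴾ zero    = program (compᴿ zeroᴿ []) λ xs → comp⇓ []⇓ zero⇓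
constᴾ (suc c) = program (compᴿ sucᴿ (rec (constᴾ c) ∷ [])) λ xs → comp⇓ (∷⇓ (computes (constᴾ c) xs) []⇓) suc⇓

infixr 4 _∙₂_

_∙₂_ : ∀ {n F} {G H : Vec ℕ n → ℕ} → Program-for {2} F → Program-for G × Program-for H →
  Program-for (λ xs → F (G xs ∷ H xs ∷ []))
f ∙₂ (g , h) = program (compᴿ (rec f) (rec g ∷ rec h ∷ [])) λ xs →
  comp⇓ (∷⇓ (computes g xs) (∷⇓ (computes h xs) []⇓)) (computes f _)

_∙₁_ : ∀ {n F} {G : Vec ℕ n → ℕ} → Program-for {1} F → Program-for G → Program-for (λ xs → F (G xs ∷ []))
f ∙₁ g = program (compᴿ (rec f) (rec g ∷ [])) λ xs → comp⇓ (∷⇓ (computes g xs) []⇓) (computes f _)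

addᴾ : Program-for {2} (λ { (x ∷ y ∷ []) → x ℕ.+ y })
addᴾ = program add-rec λ { (x ∷ y ∷ []) → add⇓ x y }
  where
  add-rec : Rec 2
  add-rec = precᴿ (projᴿ (# 0)) (compᴿ sucᴿ (projᴿ (# 1) ∷ []))
  add⇓ : ∀ x y → add-rec [ x ∷ y ∷ [] ]⇓ (x ℕ.+ y)
  add⇓ zero    y = prec⇓₀ (proj⇓ (# 0))
  add⇓ (suc x) y = prec⇓₁ (add⇓ x y) (comp⇓ (∷⇓ (proj⇓ (# 1)) []⇓) suc⇓)

triangleᴾ : Program-for {1} (λ { (x ∷ []) → triangle x })
triangleᴾ = program triangle-rec λ { (x ∷ []) → triangle⇓ x }
  where
  triangle-rec : Rec 1
  triangle-rec = precᴿ zeroᴿ (compᴿ sucᴿ (rec addᴾ ∷ []))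
  triangle⇓ : ∀ x → triangle-rec [ x ∷ [] ]⇓ triangle x
  triangle⇓ zero    = prec⇓₀ zero⇓
  triangle⇓ (suc x) = prec⇓₁ (triangle⇓ x) (comp⇓ (∷⇓ (computes addᴾ _) []⇓) suc⇓)

pairᴾ : ∀ {n} {G H : Vec ℕ n → ℕ} → Program-for G → Program-for H → Program-for (λ xs → pair (G xs) (H xs))
pairᴾ g h = addᴾ ∙₂ (triangleᴾ ∙₁ (addᴾ ∙₂ (g , h)) , h)

doubleᴾ : ∀ {n} {G : Vec ℕ n → ℕ} → Program-for G → Program-for (λ xs → 2 ℕ.* G xs)
doubleᴾ g = addᴾ ∙₂ (g , addᴾ ∙₂ (g , constᴾ 0))

run : ∀ {F : Vec ℕ 1 → ℕ} (g : Program-for F) {f m c y} → F (m ∷ []) ≡ c →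
  (compᴿ f (rec g ∷ []) [ m ∷ [] ]⇓ y) ⇔ (f [ c ∷ [] ]⇓ y)
run g {f} {m} {y = y} refl = mk⇔
  (λ { (comp⇓ (∷⇓ g⇓ []⇓) f⇓) →
    subst (λ c → f [ c ∷ [] ]⇓ y) (deterministic (rec g) g⇓ (computes g (m ∷ []))) f⇓ })
  (comp⇓ (∷⇓ (computes g (m ∷ [])) []⇓))

-- The Gödel number of the diagonal sentence

-- `Z` codes the zero coefficients after the first, so it depends on the degree alone.
code-embed : ∀ {d} → 3 ℕ.≤ d → ∃[ Z ] (∀ m → codeVec codeℤ (embed d (+ m) 0ℤ 0ℤ) ≡ pair (2 ℕ.* m) Z)
code-embed {suc (suc (suc d))} (s≤s (s≤s (s≤s z≤n))) = _ , λ m → refl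

module Diagonal (α : RealAlgebraic) (3≤d : 3 ℕ.≤ degree α) {V : Set} {n} (θ : V → Fin n) (v w : V) where

  open Semantics α 3≤d

  -- Coefficient vectors ignore constants, so 0 in place of m yields the vector of the bound m < v
  -- for every m.
  lower : V → LT V
  lower v = ⟨ ` v ∔ ∸ κ 0ℤ , κ 0ℤ , κ 0ℤ ⟩

  Z : ℕ
  Z = proj₁ (code-embed 3≤d)

  input : ℕ → Frm V → Frm V
  input m φ = notᶠ (κ (+ m) <ᶠ ` v) ∧ κ (+ m) <ᶠ ` w ∧ φ

  abstract

    input-code : ℕ → ℕ → ℕ
    input-code m c = pair 2 (pair (pair 1 (bound-code v)) (pair 2 (pair (bound-code w) c)))
      where
      bound-code : V → ℕ
      bound-code v = pair 1 (pair 0 (pair (codeVec (codeVec codeℤ) (coefficients θ (lower v))) (pair (2 ℕ.* m) Z)))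

    code-input : ∀ m φ → code (compile θ (input m φ)) ≡ input-code m (code (compile θ φ))
    code-input m φ = cong₂ (λ x y → pair 2 (pair (pair 1 x) (pair 2 (pair y (code (compile θ φ))))))
      (code-bound v) (code-bound w)
      where
      minus-minus : ℤ.- (0ℤ ℤ.+ ℤ.- + m) ≡ + m
      minus-minus = trans (cong ℤ.-_ (ℤₚ.+-identityˡ (ℤ.- + m))) (ℤₚ.neg-involutive (+ m))
      code-bound : ∀ v → code (compile θ (κ (+ m) <ᶠ ` v)) ≡
        pair 1 (pair 0 (pair (codeVec (codeVec codeℤ) (coefficients θ (lower v))) (pair (2 ℕ.* m) Z)))
      code-bound v = cong (λ c → pair 1 (pair 0 (pair (codeVec (codeVec codeℤ) (coefficients θ (lower v))) c)))
        (trans (cong (λ i → codeVec codeℤ (embed (degree α) i 0ℤ 0ℤ)) minus-minus) (proj₂ (code-embed 3≤d) m))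

    diagonalᴾ : Program-for {1} (λ xs → input-code (Vec.head xs) (Vec.head xs))
    diagonalᴾ = pairᴾ (constᴾ 2) (pairᴾ (pairᴾ (constᴾ 1) (boundᴾ v)) (pairᴾ (constᴾ 2) (pairᴾ (boundᴾ w) headᴾ)))
      where
      headᴾ : Program-for {1} Vec.head
      headᴾ = program (projᴿ zero) λ { (x ∷ []) → proj⇓ zero }
      boundᴾ : ∀ v → Program-for {1} (λ xs →
        pair 1 (pair 0 (pair (codeVec (codeVec codeℤ) (coefficients θ (lower v))) (pair (2 ℕ.* Vec.head xs) Z))))
      boundᴾ v = pairᴾ (constᴾ 1) (pairᴾ (constᴾ 0)
        (pairᴾ (constᴾ (codeVec (codeVec codeℤ) (coefficients θ (lower v)))) (pairᴾ (doubleᴾ headᴾ) (constᴾ Z))))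

-- Diagonalisation

module Undecidability (α : RealAlgebraic) (3≤d : 3 ℕ.≤ degree α) (k : ℕ) where

  open Semantics α 3≤d using (compile)
  open Blocks k using (K; index)
  open Prenex α 3≤d k
  open Diagonal α 3≤d index (row b₁ (# 2) (# 0)) (row b₁ (# 2) (# 1))
  open Equivalence

  diagonalise : Rec 1 → Rec 1
  diagonalise f = compᴿ f (rec diagonalᴾ ∷ [])

  -- `diagonalᴾ` sends the number m of ψ to the number of `input m ψ`, so `diagonalise f` on input m
  -- runs f on that very sentence. The sentence is true exactly if this run yields 0, that is, if f
  -- declares it false.
  not-decided : ∀ {f} → Decides α (∃∀∃∀ K) f → ∀ ψ {m} → m ≡ code (compile index ψ) →
    (∀ {f₁} → Satisfied (input m ψ) f₁ → ¬ ¬ (diagonalise f [ m ∷ [] ]⇓ 0)) →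
    (diagonalise f [ m ∷ [] ]⇓ 0 → ¬ ¬ (∃[ f₁ ] Satisfied (input m ψ) f₁)) → ⊥
  not-decided {f} decides ψ {m} m≡ sound complete =
    ¬true (from (True⇔Satisfied (input m ψ)) (complete (from (run diagonalᴾ code≡) (proj₂ (decides φ) ¬true))))
    where
    φ : Sentence α (∃∀∃∀ K)
    φ = compile index (input m ψ)
    code≡ : input-code m m ≡ code φ
    code≡ = trans (cong (input-code m) m≡) (sym (code-input m ψ))
    ¬true : ¬ True (∃∀∃∀ K) φ
    ¬true known = to (True⇔Satisfied (input m ψ)) known λ (_ , satisfied) → sound satisfied λ P⇓ →
      contradiction (deterministic f (to (run diagonalᴾ code≡) P⇓) (proj₁ (decides φ) known)) λ ()

  undecidable : Undecidable α (∃∀∃∀ K)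
  -- The matrix depends on the program `diagonalise f` but not on the input, so its own number can
  -- serve as the input.
  undecidable (f , decides) = not-decided decides (matrixᶠ (Program.clauses P) (Facts.Q (Program.clauses P))) refl
    (λ {f₁} → Sound.halts k _ f₁) (satisfiable k _)
    where
    P = diagonalise f
    open ProgramSentence α 3≤d P

theorem1p5 : (α : RealAlgebraic) → Irrational (value α) → ¬ Quadratic α →
    Undecidable α (∃∀∃∀ 20000)
theorem1p5 α irrational ¬quadratic =
  -- 19936 = 20000 - 64 is the padding of each block.
  Undecidability.undecidable α (α-degree≥3 α irrational ¬quadratic) 19936
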